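{- The problem Uniform Cluster Vertex Deletion (UCVD), parameterized by the solution size $k$, admits a kernel with $\mathcal{O}(k^3)$ vertices.
   Context: All graphs are finite, simple and undirected. A uniform cluster graph is a graph that is a disjoint union of cliques, all of the same size (every connected component is a clique and all components have the same number of vertices). UCVD: Input: a graph $G=(V,E)$ and a positive integer $k$. Question: is there a subset $S\subseteq V$ with $|S|\le k$ such that $G-S$ is a uniform cluster graph? A kernel with $f(k)$ vertices for a parameterized graph problem is a polynomial-time algorithm that maps every instance $(G,k)$ to an instance $(G',k')$ of the same problem such that $(G,k)$ is a yes-instance if and only if $(G',k')$ is a yes-instance, $|V(G')|\le f(k)$, and $k'$ is bounded by a computable function of $k$. -}

module Defs where

open import Data.Bool using (Bool; true; false; if_then_else_; _∧_)
open import Data.Fin using (Fin; toℕ; fromℕ<; combine; remQuot)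
open import Data.Fin.Properties
  using (toℕ<n; fromℕ<-toℕ; remQuot-combine; toℕ-combine)
open import Data.Fin.Subset using (Subset; _∈_; ∁; ∣_∣)
open import Data.Nat using (ℕ; suc; _+_; _*_; _∸_; _^_; _≤_; _<_; _≡ᵇ_; _<?_)
open import Data.Nat.Logarithm using (⌊log₂_⌋)
open import Data.Nat.Properties using (*-comm)
open import Data.Product using (∃-syntax; _×_; _,_; uncurry)
open import Function.Bundles using (_⇔_)
open import Relation.Binary.Construct.Closure.ReflexiveTransitive using (Star)
open import Relation.Binary.PropositionalEquality
open import Relation.Nullary using (yes; no; contradiction)

record Graph (n : ℕ) : Set where
  field
    adj        : Fin n → Fin n → Bool
    adj-sym    : ∀ u v → adj u v ≡ adj v u
    adj-irrefl : ∀ v → adj v v ≡ false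

open Graph public

-- The predicates below speak about the subgraph G[W] induced by W.
module Induced {n : ℕ} (G : Graph n) (W : Subset n) where

  Adjacent : Fin n → Fin n → Set
  Adjacent u v = u ∈ W × v ∈ W × adj G u v ≡ true

  Connected : Fin n → Fin n → Set
  Connected = Star Adjacent

  IsComponent : Subset n → Set
  IsComponent C = ∃[ v ] v ∈ W × (∀ x → x ∈ C ⇔ Connected v x)

  IsClique : Subset n → Set
  IsClique C = ∀ u v → u ∈ C → v ∈ C → u ≢ v → Adjacent u v

  IsUniformCluster : Set
  IsUniformCluster =
    (∀ C → IsComponent C → IsClique C) ×
    (∀ C D → IsComponent C → IsComponent D → ∣ C ∣ ≡ ∣ D ∣)

-- G − S is G[V ∖ S].
IsUniformClusterAfterDeleting : ∀ {n} → Graph n → Subset n → Set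
IsUniformClusterAfterDeleting G S = Induced.IsUniformCluster G (∁ S)

record Instance : Set where
  field
    order     : ℕ
    graph     : Graph order
    param     : ℕ
    param-pos : 0 < param

open Instance public

UCVD : Instance → Set
UCVD I = ∃[ S ] ∣ S ∣ ≤ param I × IsUniformClusterAfterDeleting (graph I) S

-- Random access machines, as structured programs over finitely many
-- arrays of natural numbers (a scalar is cell 0 of an array).
--
-- Addition and truncated subtraction are the only arithmetic operations,
-- so t steps produce numbers of bit length linear in t plus that of the
-- input; hence unit cost agrees with Turing machine time up to a
-- polynomial.  (A unit-cost multiplication would break this.)

infixl 6 _⊕_ _⊖_
infix  7 _[_]
infix  5 _[_]≔_
infixr 4 _⨾_

-- Array names are literals, never computed.
Name : Set
Name = ℕ

data Expr : Set where
  lit     : ℕ → Expr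
  _[_]    : Name → Expr → Expr
  _⊕_ _⊖_ : Expr → Expr → Expr

data Program : Set where
  skip   : Program
  _[_]≔_ : Name → Expr → Expr → Program
  _⨾_    : Program → Program → Program
  ifnz   : Expr → Program → Program → Program
  while  : Expr → Program → Program

State : Set
State = Name → ℕ → ℕ

_[_,_↦_] : State → Name → ℕ → ℕ → State
(s [ a , i ↦ x ]) b j = if (a ≡ᵇ b) ∧ (i ≡ᵇ j) then x else s b j

⟦_⟧ : Expr → State → ℕ
⟦ lit x ⟧   s = x
⟦ a [ e ] ⟧ s = s a (⟦ e ⟧ s)
⟦ e ⊕ f ⟧   s = ⟦ e ⟧ s + ⟦ f ⟧ s
⟦ e ⊖ f ⟧   s = ⟦ e ⟧ s ∸ ⟦ f ⟧ s

-- P , s ⇓[ t ] s′ : started in s, P halts in s′ after t steps.  Evaluating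
-- an expression is charged as one step: the expressions of a fixed program
-- have bounded size.
infix 3 _,_⇓[_]_

data _,_⇓[_]_ : Program → State → ℕ → State → Set where
  ⇓skip   : ∀ {s} → skip , s ⇓[ 1 ] s
  ⇓assign : ∀ {s a e f} →
            a [ e ]≔ f , s ⇓[ 1 ] (s [ a , ⟦ e ⟧ s ↦ ⟦ f ⟧ s ])
  ⇓seq    : ∀ {s s₁ s₂ P Q t u} →
            P , s ⇓[ t ] s₁ → Q , s₁ ⇓[ u ] s₂ → P ⨾ Q , s ⇓[ t + u ] s₂
  ⇓then   : ∀ {s s₁ e P Q t} →
            ⟦ e ⟧ s ≢ 0 → P , s ⇓[ t ] s₁ → ifnz e P Q , s ⇓[ suc t ] s₁
  ⇓else   : ∀ {s s₁ e P Q t} →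
            ⟦ e ⟧ s ≡ 0 → Q , s ⇓[ t ] s₁ → ifnz e P Q , s ⇓[ suc t ] s₁
  ⇓stop   : ∀ {s e P} →
            ⟦ e ⟧ s ≡ 0 → while e P , s ⇓[ 1 ] s
  ⇓loop   : ∀ {s s₁ s₂ e P t u} →
            ⟦ e ⟧ s ≢ 0 → P , s ⇓[ t ] s₁ → while e P , s₁ ⇓[ u ] s₂ →
            while e P , s ⇓[ suc (t + u) ] s₂

⇓-deterministic : ∀ {P s t₁ t₂ s₁ s₂} →
                  P , s ⇓[ t₁ ] s₁ → P , s ⇓[ t₂ ] s₂ → t₁ ≡ t₂ × s₁ ≡ s₂
⇓-deterministic ⇓skip   ⇓skip   = refl , refl
⇓-deterministic ⇓assign ⇓assign = refl , refl
⇓-deterministic (⇓seq p q) (⇓seq p′ q′) with ⇓-deterministic p p′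
... | refl , refl with ⇓-deterministic q q′
...   | refl , refl = refl , refl
⇓-deterministic (⇓then _ p) (⇓then _ p′) with ⇓-deterministic p p′
... | refl , refl = refl , refl
⇓-deterministic (⇓then ≢0 _) (⇓else ≡0 _) = contradiction ≡0 ≢0
⇓-deterministic (⇓else ≡0 _) (⇓then ≢0 _) = contradiction ≡0 ≢0
⇓-deterministic (⇓else _ p) (⇓else _ p′) with ⇓-deterministic p p′
... | refl , refl = refl , refl
⇓-deterministic (⇓stop _) (⇓stop _) = refl , refl
⇓-deterministic (⇓stop ≡0) (⇓loop ≢0 _ _) = contradiction ≡0 ≢0
⇓-deterministic (⇓loop ≢0 _ _) (⇓stop ≡0) = contradiction ≡0 ≢0
⇓-deterministic (⇓loop _ p q) (⇓loop _ p′ q′) with ⇓-deterministic p p′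
... | refl , refl with ⇓-deterministic q q′
...   | refl , refl = refl , refl

bit : Bool → ℕ
bit b = if b then 1 else 0

-- Row-major adjacency matrix, padded with zeros.
matrix : ∀ {n} → Graph n → ℕ → ℕ
matrix {n} G p with p <? n * n
... | yes p<n² = bit (uncurry (adj G) (remQuot n (fromℕ< p<n²)))
... | no  _    = 0

input : Instance → State
input I 0 0 = order I
input I 1 0 = param I
input I 2 p = matrix (graph I) p
input I _ _ = 0

-- All other cells are ignored when the output is read.
record Holds (s : State) (I : Instance) : Set where
  field
    order-cell : s 0 0 ≡ order I
    param-cell : s 1 0 ≡ param I
    adj-cell   : ∀ u v → s 2 (toℕ u * order I + toℕ v) ≡ bit (adj (graph I) u v)

matrix-entry : ∀ {n} (G : Graph n) u v →
               matrix G (toℕ u * n + toℕ v) ≡ bit (adj G u v)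
matrix-entry {n} G u v
  rewrite *-comm (toℕ u) n | sym (toℕ-combine u v)
  with toℕ (combine u v) <? n * n
... | no  ≮n²  = contradiction (toℕ<n (combine u v)) ≮n²
... | yes p<n² =
  cong (λ w → bit (uncurry (adj G) w))
       (trans (cong (remQuot n) (fromℕ<-toℕ (combine u v) p<n²)) (remQuot-combine u v))

input-holds : ∀ I → Holds (input I) I
input-holds I = record
  { order-cell = refl
  ; param-cell = refl
  ; adj-cell   = matrix-entry (graph I)
  }

-- The adjacency matrix and the parameter in binary.
size : Instance → ℕ
size I = order I * order I + suc ⌊log₂ param I ⌋

-- The size of the output is charged to the running time, since a machine
-- could otherwise describe a huge sparse graph without writing its entries.
PolynomialTime : (Instance → Instance) → Set
PolynomialTime F = ∃[ P ] ∃[ c ] ∃[ d ] ∀ I → ∃[ t ] ∃[ s ]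
  (P , input I ⇓[ t ] s) × Holds s (F I) × t + size (F I) ≤ c * size I ^ d

numberInput : ℕ → State
numberInput x 0 0 = x
numberInput x _ _ = 0

Computable : (ℕ → ℕ) → Set
Computable g = ∃[ P ] ∀ x → ∃[ t ] ∃[ s ] (P , numberInput x ⇓[ t ] s) × s 0 0 ≡ g x

record Kernel (Q : Instance → Set) (f : ℕ → ℕ) : Set where
  field
    reduce           : Instance → Instance
    polynomial-time  : PolynomialTime reduce
    equivalent       : ∀ I → Q I ⇔ Q (reduce I)
    order-bound      : ∀ I → order (reduce I) ≤ f (param I)
    bound            : ℕ → ℕ
    bound-computable : Computable bound
    param-bound      : ∀ I → param (reduce I) ≤ bound (param I)

_∈O_ : (ℕ → ℕ) → (ℕ → ℕ) → Set
f ∈O g = ∃[ c ] ∃[ k₀ ] ∀ k → k₀ ≤ k → f k ≤ c * g k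

{-# OPTIONS --safe #-}

-- Make adjacency reflexive.  A solution is then a set of kept vertices on
-- which adjacency is transitive and all degrees agree.  A pair of vertices in
-- more than k induced P₃ is hard: a solution deletes one of the two.  So a
-- vertex in more than k hard pairs must be deleted, and so must one with more
-- than k² + k partners in P₃ without hard pairs.  Among more than k disjoint
-- neighbourhoods of large twin classes with equally many vertices, one is left
-- intact; this reveals the clique size, all these neighbourhoods become
-- cliques of the solution, and what is attached to them must be deleted.  Of
-- the isolated cliques of one size, k + 1 suffice.  Finally, a vertex outside
-- a large clique of a solution is adjacent to at most k or to all but at most
-- k of its vertices, so all but k² of these are twins; hence equally many
-- vertices can be removed from all large twin classes at once.  In a
-- yes-instance at most 30 k³ vertices remain: O(k³) share a hard pair, or a P₃
-- without hard pairs, with a deleted vertex; any other one is in an isolated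
-- clique, in a small twin class next to one of k + k² vertices, or in one of
-- 3 k + 1 large twin classes of O(k²) vertices each.
--
-- All sets and numbers involved are tables indexed by two vertices, each
-- given by earlier ones through a Boolean formula or a sum over one further
-- vertex.  Such definitions compile to nested loops, which makes the running
-- time polynomial without a separate analysis of the algorithm.

module Submission where

open import Defs
open import Data.Nat using (ℕ; _^_)
open import Data.Product using (∃-syntax; _×_)

open import Data.Bool using (Bool; true; false; _∧_; _∨_; not; T; if_then_else_)
open import Data.Bool.Properties
  using (∧-assoc; ∧-identityʳ; ∧-zeroʳ; ∨-identityʳ; ∨-comm; not-injective; not-involutive)
open import Data.Empty using (⊥; ⊥-elim)
open import Data.Fin using (Fin; zero; suc; toℕ; fromℕ<; combine)
open import Data.Fin.Permutation using (transpose; _⟨$⟩ʳ_)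
open import Data.Fin.Properties
  using (toℕ-injective; toℕ<n; toℕ-fromℕ<; toℕ-combine; combine-injective)
  renaming (_≟_ to _≟ᶠ_)
open import Data.Fin.Subset using (Subset; ∁; ∣_∣) renaming (_∈_ to _∈ˢ_)
open import Data.List using (List; []; _∷_)
open import Data.Nat
open import Data.Nat.Logarithm using (⌊log₂⌋-mono-≤)
open import Data.Nat.Properties
open import Data.Nat.Solver using (module +-*-Solver)
open import Data.Product using (_,_; proj₁; proj₂)
open import Data.Sum using (_⊎_; inj₁; inj₂; [_,_]′; map₂)
open import Data.Unit using (⊤; tt)
open import Data.Vec using ([]; _∷_; lookup; tabulate)
open import Data.Vec.Properties using (lookup-map; lookup∘tabulate; []=⇒lookup; lookup⇒[]=)
open import Function using (_∘_)
open import Function.Bundles using (_⇔_; mk⇔; Equivalence)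
open import Function.Construct.Composition using (_⇔-∘_)
open import Relation.Binary.Construct.Closure.ReflexiveTransitive using (ε; _◅_)
open import Relation.Binary.PropositionalEquality hiding ([_])
open import Relation.Nullary using (¬_; Dec; yes; no; contradiction)
open import Relation.Nullary.Decidable
  using (does; dec-true; decidable-stable; ¬¬-excluded-middle)
open import Algebra.Properties.CommutativeMonoid.Sum +-0-commutativeMonoid
  using (sum; ∑-distrib-+; ∑-comm; sum-cong-≗; sum-replicate-zero; sum-permute)

-- Counting

-- Uniformity couples all cliques: taking vertices from one clique forces the same loss on every
-- other. The two rules that go beyond forced deletions therefore need control of all cliques of a
-- solution at once: either whole cliques disappear while one copy of the same size certainly
-- survives, or every clique loses exactly the same number `t`. The latter holds only for solutions
-- that keep all trimmed vertices; swapping twins brings any solution into this form. All rules act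
-- inside one fixed vertex set, through the shrinking predicates `A₀`, `A`, `B` and `K`, so vertices
-- are renamed only once, at the end. A parameter must be positive; hence a budget used up by forced
-- deletions is decided on the spot and a constant instance is returned. Inputs with at most k + 3
-- vertices are returned unchanged: on the others every output fits into a table of the size of the
-- input, and k² and k³ can be counted by sums over vertices, as the machine cannot multiply. For
-- this reason `k²` is a separate argument, equal to `k * k` by proof: the definitions then match
-- the compiled formulas by computation.

Pred : ℕ → Set
Pred n = Fin n → Bool

bool-cases : ∀ b → b ≡ true ⊎ b ≡ false
bool-cases true  = inj₁ refl
bool-cases false = inj₂ refl

true≢false : ∀ {b} → b ≡ true → b ≡ false → ⊥
true≢false refl ()

≢true : ∀ {b} → ¬ b ≡ true → b ≡ false
≢true {true}  h = ⊥-elim (h refl)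
≢true {false} h = refl

≢false : ∀ {b} → ¬ b ≡ false → b ≡ true
≢false {true}  h = refl
≢false {false} h = ⊥-elim (h refl)

infixr 6 _∧⁺_

_∧⁺_ : ∀ {a b} → a ≡ true → b ≡ true → a ∧ b ≡ true
refl ∧⁺ refl = refl

∧⁻ˡ : ∀ {a b} → a ∧ b ≡ true → a ≡ true
∧⁻ˡ {true} h = refl

∧⁻ʳ : ∀ {a b} → a ∧ b ≡ true → b ≡ true
∧⁻ʳ {true} h = h

∧⁻ : ∀ {a b} → a ∧ b ≡ true → a ≡ true × b ≡ true
∧⁻ h = ∧⁻ˡ h , ∧⁻ʳ h

∨⁺ˡ : ∀ {a b} → a ≡ true → a ∨ b ≡ true
∨⁺ˡ refl = refl

∨⁺ʳ : ∀ {a b} → b ≡ true → a ∨ b ≡ true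
∨⁺ʳ {true}  h = refl
∨⁺ʳ {false} h = h

∨⁻ : ∀ {a b} → a ∨ b ≡ true → a ≡ true ⊎ b ≡ true
∨⁻ {true}  h = inj₁ refl
∨⁻ {false} h = inj₂ h

not⁺ : ∀ {a} → a ≡ false → not a ≡ true
not⁺ refl = refl

not⁻ : ∀ {a} → not a ≡ true → a ≡ false
not⁻ {false} h = refl

T⇒≡ : ∀ {b} → T b → b ≡ true
T⇒≡ {true} _ = refl

≡⇒T : ∀ {b} → b ≡ true → T b
≡⇒T refl = tt

iff⇒≡ : ∀ {a b} → (a ≡ true → b ≡ true) → (b ≡ true → a ≡ true) → a ≡ b
iff⇒≡ {true}          f g = sym (f refl)
iff⇒≡ {false} {true}  f g = g refl
iff⇒≡ {false} {false} f g = refl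

<ᵇ⁺ : ∀ {m n} → m < n → (m <ᵇ n) ≡ true
<ᵇ⁺ h = T⇒≡ (<⇒<ᵇ h)

<ᵇ⁻ : ∀ {m n} → (m <ᵇ n) ≡ true → m < n
<ᵇ⁻ {m} {n} h = <ᵇ⇒< m n (≡⇒T h)

≮ᵇ⁻ : ∀ {m n} → (m <ᵇ n) ≡ false → n ≤ m
≮ᵇ⁻ h = ≮⇒≥ λ m<n → true≢false (<ᵇ⁺ m<n) h

≮ᵇ⁺ : ∀ {m n} → n ≤ m → (m <ᵇ n) ≡ false
≮ᵇ⁺ h = ≢true λ e → <⇒≱ (<ᵇ⁻ e) h

≡ᵇ⁺ : ∀ {m n} → m ≡ n → (m ≡ᵇ n) ≡ true
≡ᵇ⁺ {m} {n} h = T⇒≡ (≡⇒≡ᵇ m n h)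

≡ᵇ⁻ : ∀ {m n} → (m ≡ᵇ n) ≡ true → m ≡ n
≡ᵇ⁻ {m} {n} h = ≡ᵇ⇒≡ m n (≡⇒T h)

≡ᵇ-sym : ∀ m n → (m ≡ᵇ n) ≡ (n ≡ᵇ m)
≡ᵇ-sym m n = iff⇒≡ (λ e → ≡ᵇ⁺ (sym (≡ᵇ⁻ {m} e))) (λ e → ≡ᵇ⁺ (sym (≡ᵇ⁻ {n} e)))

bit-eq⁻ : ∀ {a b} → (bit a ≡ᵇ bit b) ≡ true → a ≡ b
bit-eq⁻ {true}  {true}  h = refl
bit-eq⁻ {false} {false} h = refl

bit-eq⁺ : ∀ {a b} → a ≡ b → (bit a ≡ᵇ bit b) ≡ true
bit-eq⁺ {true}  refl = refl
bit-eq⁺ {false} refl = refl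

bit-mono : ∀ {a b} → (a ≡ true → b ≡ true) → bit a ≤ bit b
bit-mono {true}  h rewrite h refl = ≤-refl
bit-mono {false} h = z≤n

sum-mono : ∀ {n} {f g : Fin n → ℕ} → (∀ i → f i ≤ g i) → sum f ≤ sum g
sum-mono {zero}  h = z≤n
sum-mono {suc n} h = +-mono-≤ (h zero) (sum-mono (h ∘ suc))

sum-≥ : ∀ {n} (f : Fin n → ℕ) i → f i ≤ sum f
sum-≥ f zero    = m≤m+n _ _
sum-≥ f (suc i) = ≤-trans (sum-≥ (f ∘ suc) i) (m≤n+m _ _)

sum-*ʳ : ∀ {n} (f : Fin n → ℕ) b → sum (λ x → f x * b) ≡ sum f * b
sum-*ʳ {zero}  f b = refl
sum-*ʳ {suc n} f b = trans (cong (f zero * b +_) (sum-*ʳ (f ∘ suc) b)) (sym (*-distribʳ-+ b (f zero) _))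

-- Opaque, so that counts stay in the form `cnt p`; the comparison with the compiled rules unfolds
-- it again.
opaque
  cnt : ∀ {n} → Pred n → ℕ
  cnt p = sum (λ i → bit (p i))

-- An existential is a positive count, so it needs only a table given by a sum; reading that table
-- as a condition gives literally this term.
some : ∀ {n} → Pred n → Bool
some p = 0 <ᵇ cnt p

module _ {n : ℕ} where

  infix 4 _⊆_
  _⊆_ : Pred n → Pred n → Set
  p ⊆ q = ∀ i → p i ≡ true → q i ≡ true

  infixr 6 _∩_ _∖_
  _∩_ _∖_ : Pred n → Pred n → Pred n
  (p ∩ q) i = p i ∧ q i
  (p ∖ q) i = p i ∧ not (q i)

module _ {n : ℕ} where

  opaque
    unfolding cnt

    cnt-mono : ∀ {p q : Pred n} → p ⊆ q → cnt p ≤ cnt q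
    cnt-mono h = sum-mono λ i → bit-mono (h i)

    cnt-cong : ∀ {p q : Pred n} → (∀ i → p i ≡ q i) → cnt p ≡ cnt q
    cnt-cong h = sum-cong-≗ λ i → cong bit (h i)

    cnt-none : ∀ {p : Pred n} → (∀ i → p i ≡ false) → cnt p ≡ 0
    cnt-none h = trans (sum-cong-≗ λ i → cong bit (h i)) (sum-replicate-zero n)

    cnt-∋ : ∀ {p : Pred n} i → p i ≡ true → 0 < cnt p
    cnt-∋ {p} i h = ≤-trans (≤-reflexive (sym (cong bit h))) (sum-≥ (bit ∘ p) i)

opaque
  unfolding cnt

  cnt-∃ : ∀ {n} (p : Pred n) → 0 < cnt p → ∃[ i ] p i ≡ true
  cnt-∃ {suc n} p h with p zero in eq
  ... | true = zero , eq
  ... | false with cnt-∃ (p ∘ suc) h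
  ...   | i , pi = suc i , pi

  cnt-all : ∀ {n} → cnt {n} (λ _ → true) ≡ n
  cnt-all {zero}  = refl
  cnt-all {suc n} = cong suc cnt-all

  cnt≤1 : ∀ {n} (p : Pred n) → (∀ i j → p i ≡ true → p j ≡ true → i ≡ j) → cnt p ≤ 1
  cnt≤1 {zero}  p h = z≤n
  cnt≤1 {suc n} p h with p zero in eq
  ... | false = cnt≤1 (p ∘ suc) λ i j pi pj → suc-inj (h _ _ pi pj)
    where
    suc-inj : ∀ {i j : Fin n} → Fin.suc i ≡ suc j → i ≡ j
    suc-inj refl = refl
  ... | true with cnt (p ∘ suc) in c
  ...   | zero  = ≤-refl
  ...   | suc m with cnt-∃ (p ∘ suc) (≤-trans (s≤s z≤n) (≤-reflexive (sym c)))
  ...     | i , pi = ⊥-elim (0≢suc (h _ _ eq pi))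
    where
    0≢suc : ∀ {i : Fin n} → Fin.zero ≡ suc i → ⊥
    0≢suc ()

  -- The offset c is there for the induction: it counts the elements of p passed so far.
  cnt-rank< : ∀ {n} (p : Pred n) c a →
              cnt (λ v → p v ∧ (c + cnt (λ w → p w ∧ (toℕ w <ᵇ toℕ v)) <ᵇ a)) ≡ cnt p ⊓ (a ∸ c)
  cnt-rank< {zero}  p c a = refl
  cnt-rank< {suc n} p c a with p zero in eq
  ... | false = trans (cnt-cong λ v → cong (p (suc v) ∧_) refl) (cnt-rank< (p ∘ suc) c a)
  ... | true  = begin
    bit (c + (cnt (λ w → p (suc w) ∧ false)) <ᵇ a) + _
      ≡⟨ cong₂ _+_ (cong (λ x → bit (x <ᵇ a)) (trans (cong (c +_) none) (+-identityʳ c)))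
                   (cnt-cong λ v → cong (λ x → p (suc v) ∧ (x <ᵇ a)) (+-suc c _)) ⟩
    bit (c <ᵇ a) + cnt (λ v → p (suc v) ∧ (suc c + cnt (λ w → p (suc w) ∧ (toℕ w <ᵇ toℕ v)) <ᵇ a))
      ≡⟨ cong (bit (c <ᵇ a) +_) (cnt-rank< (p ∘ suc) (suc c) a) ⟩
    bit (c <ᵇ a) + cnt (p ∘ suc) ⊓ (a ∸ suc c)
      ≡⟨ step c a ⟩
    suc (cnt (p ∘ suc)) ⊓ (a ∸ c) ∎
    where
    open ≡-Reasoning
    none : cnt (λ w → p (suc w) ∧ false) ≡ 0
    none = cnt-none λ w → ∧-zeroʳ (p (suc w))
    step : ∀ c a → bit (c <ᵇ a) + cnt (p ∘ suc) ⊓ (a ∸ suc c) ≡ suc (cnt (p ∘ suc)) ⊓ (a ∸ c)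
    step c       zero    rewrite 0∸n≡0 c | ⊓-zeroʳ (cnt (p ∘ suc)) = refl
    step zero    (suc a) = refl
    step (suc c) (suc a) = step c a

  least : ∀ {n} (p : Pred n) i → p i ≡ true →
          ∃[ j ] p j ≡ true × (∀ m → p m ≡ true → toℕ j ≤ toℕ m)
  least {suc n} p i h with p zero in eq
  least {suc n} p i       h | true = zero , eq , λ _ _ → z≤n
  least {suc n} p zero    h | false = ⊥-elim (true≢false h eq)
  least {suc n} p (suc i) h | false with least (p ∘ suc) i h
  ... | j , pj , min = suc j , pj , λ where
    zero    pm → ⊥-elim (true≢false pm eq)
    (suc m) pm → s≤s (min m pm)

module _ {n : ℕ} where

  opaque
    unfolding cnt

    some⁺ : ∀ (p : Pred n) i → p i ≡ true → some p ≡ true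
    some⁺ p i h = <ᵇ⁺ (cnt-∋ {p = p} i h)

    some⁻ : ∀ (p : Pred n) → some p ≡ true → ∃[ i ] p i ≡ true
    some⁻ p h = cnt-∃ p (<ᵇ⁻ h)

    none⁻ : ∀ (p : Pred n) → some p ≡ false → ∀ i → p i ≡ false
    none⁻ p h i = ≢true λ pi → true≢false (some⁺ p i pi) h

    none⁺ : ∀ (p : Pred n) → (∀ i → p i ≡ true → ⊥) → some p ≡ false
    none⁺ p h = ≢true λ e → let i , pi = some⁻ p e in h i pi

    cnt-split : ∀ (p q : Pred n) → cnt p ≡ cnt (p ∩ q) + cnt (p ∖ q)
    cnt-split p q = trans (sum-cong-≗ λ i → bits (p i) (q i)) (∑-distrib-+ (bit ∘ (p ∩ q)) (bit ∘ (p ∖ q)))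
      where
      bits : ∀ a b → bit a ≡ bit (a ∧ b) + bit (a ∧ not b)
      bits true  true  = refl
      bits true  false = refl
      bits false b     = refl

    cnt-∪ : ∀ {p q r : Pred n} → (∀ i → p i ≡ true → q i ≡ true ⊎ r i ≡ true) →
            cnt p ≤ cnt q + cnt r
    cnt-∪ {p} {q} {r} h =
      ≤-trans (sum-mono bits) (≤-reflexive (∑-distrib-+ (bit ∘ q) (bit ∘ r)))
      where
      bits : ∀ i → bit (p i) ≤ bit (q i) + bit (r i)
      bits i with p i in eq
      ... | false = z≤n
      ... | true with h i eq
      ...   | inj₁ qi rewrite qi = s≤s z≤n
      ...   | inj₂ ri rewrite ri = m≤n+m 1 _

    -- Double counting of the pairs (x, v) with `X x` and `R x v`. Most cardinality bounds below are
    -- instances of it.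
    cnt-⋃ : ∀ {m} {p : Pred n} (X : Pred m) (R : Fin m → Pred n) {b} →
            (∀ v → p v ≡ true → ∃[ x ] X x ≡ true × R x v ≡ true) →
            (∀ x → X x ≡ true → cnt (R x) ≤ b) → cnt p ≤ cnt X * b
    cnt-⋃ {m} {p} X R {b} cover size = begin
      cnt p                                   ≤⟨ sum-mono outer ⟩
      sum (λ v → sum (λ x → bit (X x ∧ R x v))) ≡⟨ ∑-comm (λ v x → bit (X x ∧ R x v)) ⟩
      sum (λ x → sum (λ v → bit (X x ∧ R x v))) ≤⟨ sum-mono inner ⟩
      sum (λ x → bit (X x) * b)               ≡⟨ sum-*ʳ (bit ∘ X) b ⟩
      cnt X * b                               ∎
      where
      open ≤-Reasoning
      outer : ∀ v → bit (p v) ≤ sum (λ x → bit (X x ∧ R x v))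
      outer v with p v in eq
      ... | false = z≤n
      ... | true with cover v eq
      ...   | x , Xx , Rxv = cnt-∋ {p = λ x → X x ∧ R x v} x (Xx ∧⁺ Rxv)
      inner : ∀ x → sum (λ v → bit (X x ∧ R x v)) ≤ bit (X x) * b
      inner x with X x in eq
      ... | true  = ≤-trans (size x eq) (≤-reflexive (sym (+-identityʳ b)))
      ... | false = ≤-reflexive (sum-replicate-zero n)

    cnt-< : ∀ (p q : Pred n) → cnt q < cnt p → ∃[ i ] p i ≡ true × q i ≡ false
    cnt-< p q h with cnt-∃ (p ∖ q) (n≢0⇒n>0 λ e → <⇒≱ h (begin
        cnt p                       ≡⟨ cnt-split p q ⟩
        cnt (p ∩ q) + cnt (p ∖ q)   ≡⟨ cong (cnt (p ∩ q) +_) e ⟩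
        cnt (p ∩ q) + 0             ≡⟨ +-identityʳ _ ⟩
        cnt (p ∩ q)                 ≤⟨ cnt-mono (λ i e → ∧⁻ʳ {p i} e) ⟩
        cnt q                       ∎))
      where open ≤-Reasoning
    ... | i , e = i , ∧⁻ˡ e , not⁻ (∧⁻ʳ {p i} e)

    ⊆-cnt-≥ : ∀ (p q : Pred n) → p ⊆ q → cnt q ≤ cnt p → q ⊆ p
    ⊆-cnt-≥ p q p⊆q h i qi with bool-cases (p i)
    ... | inj₁ pi = pi
    ... | inj₂ pi = contradiction h (<⇒≱ (begin-strict
        cnt p                      ≡⟨ cnt-cong (λ j → iff⇒≡ (λ pj → p⊆q j pj ∧⁺ pj) (∧⁻ʳ {q j})) ⟩
        cnt (q ∩ p)                <⟨ m<m+n _ (cnt-∋ {p = q ∖ p} i (qi ∧⁺ not⁺ pi)) ⟩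
        cnt (q ∩ p) + cnt (q ∖ p)  ≡⟨ cnt-split q p ⟨
        cnt q                      ∎))
      where open ≤-Reasoning

    cnt-transpose : ∀ (p : Pred n) u v → cnt p ≡ cnt (p ∘ (transpose u v ⟨$⟩ʳ_))
    cnt-transpose p u v = sum-permute (bit ∘ p) (transpose u v)

    cnt≤n : ∀ (p : Pred n) → cnt p ≤ n
    cnt≤n p = ≤-trans (cnt-mono {p = p} {λ _ → true} λ _ _ → refl) (≤-reflexive (cnt-all {n}))

opaque
  unfolding cnt

  cnt-below : ∀ n a → cnt {n} (λ j → toℕ j <ᵇ a) ≡ n ⊓ a
  cnt-below zero    a       = refl
  cnt-below (suc n) zero    = cnt-none {suc n} {λ j → toℕ j <ᵇ 0} λ _ → refl
  cnt-below (suc n) (suc a) = cong suc (cnt-below n a)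

transpose-cases : ∀ {n} (u v z : Fin n) → let z′ = transpose u v ⟨$⟩ʳ z in
                  z ≡ u × z′ ≡ v ⊎ z ≡ v × z′ ≡ u ⊎ z′ ≡ z
transpose-cases u v z with z ≟ᶠ u
... | yes z≡u = inj₁ (z≡u , refl)
... | no _ with z ≟ᶠ v
...   | yes z≡v = inj₂ (inj₁ (z≡v , refl))
...   | no _    = inj₂ (inj₂ refl)

transpose-ˡ : ∀ {n} (u v : Fin n) → transpose u v ⟨$⟩ʳ u ≡ v
transpose-ˡ u v rewrite dec-true (u ≟ᶠ u) refl = refl

-- Closed neighbourhoods, solutions and twin classes

module ClosedGraph {n : ℕ} (E : Fin n → Fin n → Bool)
                   (E-refl : ∀ v → E v v ≡ true) (E-sym : ∀ u v → E u v ≡ E v u) where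

  N : Pred n → Fin n → Pred n
  N S u l = S l ∧ E u l

  deg : Pred n → Fin n → ℕ
  deg S u = cnt (N S u)

  Transitive : Pred n → Set
  Transitive W = ∀ u v w → W u ≡ true → W v ≡ true → W w ≡ true →
                 E u v ≡ true → E v w ≡ true → E u w ≡ true

  -- Only deletions inside `A` are charged to `b`; what a rule removed before is accounted for
  -- separately. `cliqueSize` is a field since `W` may be empty.
  record Solves (A : Pred n) (b : ℕ) (W : Pred n) : Set where
    field
      inside     : W ⊆ A
      cost       : cnt (A ∖ W) ≤ b
      transitive : Transitive W
      cliqueSize : ℕ
      regular    : ∀ v → W v ≡ true → deg W v ≡ cliqueSize

  full : Pred n
  full _ = true

  E-sym⁻ : ∀ {u v b} → E u v ≡ b → E v u ≡ b
  E-sym⁻ {u} {v} h = trans (E-sym v u) h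

  -- E is reflexive, so exactly two of the three pairs are adjacent only if
  -- u, v and w are distinct: this says that they induce a P₃.
  opaque
    P : Fin n → Fin n → Fin n → Bool
    P u v w = (bit (E u v) + bit (E u w) + bit (E v w)) ≡ᵇ 2

  opaque
    unfolding P

    P-cong : ∀ {u v w u′ v′ w′} → E u v ≡ E u′ v′ → E u w ≡ E u′ w′ → E v w ≡ E v′ w′ →
             P u v w ≡ P u′ v′ w′
    P-cong p q r rewrite p | q | r = refl

    private
      swap₁ : ∀ a b c → (bit a + bit b + bit c ≡ᵇ 2) ≡ (bit a + bit c + bit b ≡ᵇ 2)
      swap₁ a true  true  = refl
      swap₁ a false false = refl
      swap₁ true  true  false = refl
      swap₁ true  false true  = refl
      swap₁ false true  false = refl
      swap₁ false false true  = refl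

      swap₂ : ∀ a b c → (bit a + bit b + bit c ≡ᵇ 2) ≡ (bit b + bit a + bit c ≡ᵇ 2)
      swap₂ a b c rewrite +-comm (bit a) (bit b) = refl

      two : ∀ {a b c} → (bit a + bit b + bit c ≡ᵇ 2) ≡ true →
            a ≡ false × b ≡ true × c ≡ true ⊎ a ≡ true × b ≡ false × c ≡ true ⊎
            a ≡ true × b ≡ true × c ≡ false
      two {false} {true}  {false} ()
      two {false} {false} {false} ()
      two {true}  {true}  {false} h = inj₂ (inj₂ (refl , refl , refl))
      two {true}  {false} {true}  h = inj₂ (inj₁ (refl , refl , refl))
      two {false} {true}  {true}  h = inj₁ (refl , refl , refl)

    P-swapˡ : ∀ u v w → P u v w ≡ P v u w
    P-swapˡ u v w rewrite E-sym v u = swap₁ (E u v) (E u w) (E v w)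

    P-swapʳ : ∀ u v w → P u v w ≡ P u w v
    P-swapʳ u v w rewrite E-sym w v = swap₂ (E u v) (E u w) (E v w)

    P-swapˡ⁺ : ∀ {u v w} → P u v w ≡ true → P v u w ≡ true
    P-swapˡ⁺ {u} {v} {w} h = trans (sym (P-swapˡ u v w)) h

    P-swapʳ⁺ : ∀ {u v w} → P u v w ≡ true → P u w v ≡ true
    P-swapʳ⁺ {u} {v} {w} h = trans (sym (P-swapʳ u v w)) h

    P⁺ : ∀ {u v w} → E u v ≡ true → E v w ≡ true → E u w ≡ false → P u v w ≡ true
    P⁺ p q r rewrite p | q | r = refl

    transitive⇒¬P : ∀ {W} → Transitive W → ∀ {u v w} →
                    W u ≡ true → W v ≡ true → W w ≡ true → P u v w ≡ true → ⊥
    transitive⇒¬P tr {u} {v} {w} Wu Wv Ww h with two {E u v} h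
    ... | inj₁ (uv , uw , vw)        = true≢false (tr u w v Wu Ww Wv uw (E-sym⁻ vw)) uv
    ... | inj₂ (inj₁ (uv , uw , vw)) = true≢false (tr u v w Wu Wv Ww uv vw) uw
    ... | inj₂ (inj₂ (uv , uw , vw)) = true≢false (tr v u w Wv Wu Ww (E-sym⁻ uv) uw) vw

    ¬P⇒transitive : ∀ {W} → (∀ {u v w} → W u ≡ true → W v ≡ true → W w ≡ true → P u v w ≡ true → ⊥) →
                    Transitive W
    ¬P⇒transitive h u v w Wu Wv Ww uv vw = ≢false λ uw → h Wu Wv Ww (P⁺ uv vw uw)

  -- The number of vertices of `S` that distinguish `u` from `v`. Bits are compared because the
  -- formulas have equality for numbers only.
  diff : Pred n → Fin n → Fin n → ℕ
  diff S u v = cnt λ l → S l ∧ not (bit (E u l) ≡ᵇ bit (E v l))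

  diff⁻ : ∀ S {u v} → (0 <ᵇ diff S u v) ≡ false → ∀ l → S l ≡ true → E u l ≡ E v l
  diff⁻ S {u} {v} h l Sl with bool-cases (bit (E u l) ≡ᵇ bit (E v l))
  ... | inj₁ e = bit-eq⁻ e
  ... | inj₂ e = ⊥-elim (true≢false (Sl ∧⁺ not⁺ e) (none⁻ _ h l))

  diff⁺ : ∀ S {u v} → (∀ l → S l ≡ true → E u l ≡ E v l) → (0 <ᵇ diff S u v) ≡ false
  diff⁺ S h = none⁺ _ λ l e → true≢false (bit-eq⁺ (h l (∧⁻ˡ e))) (not⁻ (∧⁻ʳ {S l} e))

  opaque
    tw : Pred n → Fin n → Fin n → Bool
    tw S u v = S u ∧ S v ∧ not (0 <ᵇ diff S u v)

  cls : Pred n → Fin n → ℕ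
  cls S u = cnt (tw S u)

  module Twins (S : Pred n) where

    opaque
      unfolding tw

      tw⁺ : ∀ {u v} → S u ≡ true → S v ≡ true → (∀ l → S l ≡ true → E u l ≡ E v l) → tw S u v ≡ true
      tw⁺ p q h = p ∧⁺ q ∧⁺ not⁺ (diff⁺ S h)

      tw-∈ˡ : ∀ {u v} → tw S u v ≡ true → S u ≡ true
      tw-∈ˡ h = ∧⁻ˡ h

      tw-∈ʳ : ∀ {u v} → tw S u v ≡ true → S v ≡ true
      tw-∈ʳ {u} h = ∧⁻ˡ (∧⁻ʳ {S u} h)

      tw-row : ∀ {u v} → tw S u v ≡ true → ∀ {l} → S l ≡ true → E u l ≡ E v l
      tw-row {u} {v} h {l} = diff⁻ S (not⁻ (∧⁻ʳ {S v} (∧⁻ʳ {S u} h))) l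

    tw-refl : ∀ {u} → S u ≡ true → tw S u u ≡ true
    tw-refl p = tw⁺ p p λ _ _ → refl

    tw-sym : ∀ {u v} → tw S u v ≡ true → tw S v u ≡ true
    tw-sym h = tw⁺ (tw-∈ʳ h) (tw-∈ˡ h) λ l Sl → sym (tw-row h Sl)

    tw-trans : ∀ {u v w} → tw S u v ≡ true → tw S v w ≡ true → tw S u w ≡ true
    tw-trans h g = tw⁺ (tw-∈ˡ h) (tw-∈ʳ g) λ l Sl → trans (tw-row h Sl) (tw-row g Sl)

    tw-E : ∀ {u v} → tw S u v ≡ true → E u v ≡ true
    tw-E {u} {v} h = trans (tw-row h (tw-∈ʳ h)) (E-refl v)

    tw-cls : ∀ {u v} → tw S u v ≡ true → cls S u ≡ cls S v
    tw-cls {u} {v} h = cnt-cong {p = tw S u} {q = tw S v} λ l → iff⇒≡ (tw-trans (tw-sym h)) (tw-trans h)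

    tw-deg : ∀ {u v} → tw S u v ≡ true → ∀ {R} → R ⊆ S → deg R u ≡ deg R v
    tw-deg {u} {v} h {R} R⊆S = cnt-cong λ l → iff⇒≡
      (λ e → ∧⁻ˡ e ∧⁺ trans (sym (tw-row h (R⊆S l (∧⁻ˡ e)))) (∧⁻ʳ {R l} e))
      (λ e → ∧⁻ˡ e ∧⁺ trans (tw-row h (R⊆S l (∧⁻ˡ e))) (∧⁻ʳ {R l} e))

    cls>⇒∈ : ∀ {m u} → m < cls S u → S u ≡ true
    cls>⇒∈ {u = u} h = let v , e = cnt-∃ (tw S u) (≤-trans (s≤s z≤n) h) in tw-∈ˡ {v = v} e

  cnt-complement : ∀ {A W : Pred n} → W ⊆ A →
                   cnt (full ∖ W) ≡ cnt (full ∖ A) + cnt (A ∖ W)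
  cnt-complement {A} {W} W⊆A = trans (cnt-split _ (full ∖ A)) (cong₂ _+_
    (cnt-cong λ l → iff⇒≡ (∧⁻ʳ {not (W l)}) λ ¬A → not⁺ (≢true λ Wl → true≢false (W⊆A l Wl) (not⁻ ¬A)) ∧⁺ ¬A)
    (cnt-cong λ l → bits (W l) (A l)))
    where
    bits : ∀ w a → not w ∧ not (not a) ≡ a ∧ not w
    bits true  true  = refl
    bits true  false = refl
    bits false true  = refl
    bits false false = refl

  -- The neighbourhoods of the centres in `q` are disjoint on `A`, so a deleted vertex spoils at
  -- most one of them, and there are more centres than deletions. The centres will be leaders of big
  -- twin classes or of isolated cliques.
  intact : ∀ (A W q : Pred n) → cnt (A ∖ W) < cnt q →
           (∀ {x u v} → A x ≡ true → q u ≡ true → q v ≡ true → E u x ≡ true → E v x ≡ true → u ≡ v) →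
           ∃[ v ] q v ≡ true × N A v ⊆ W
  intact A W q few disjoint with cnt-< q hit (≤-<-trans hit-few few)
    where
    hit : Pred n
    hit v = q v ∧ some (λ x → (A ∖ W) x ∧ E v x)
    hit-few : cnt hit ≤ cnt (A ∖ W)
    hit-few = ≤-trans (cnt-⋃ (A ∖ W) (λ x v → q v ∧ E v x)
      (λ v h → let x , e = some⁻ (λ x → (A ∖ W) x ∧ E v x) (∧⁻ʳ {q v} h) in
               x , ∧⁻ˡ e , ∧⁻ˡ h ∧⁺ ∧⁻ʳ {(A ∖ W) x} e)
      (λ x Xx → cnt≤1 _ λ u v hu hv →
        disjoint (∧⁻ˡ Xx) (∧⁻ˡ hu) (∧⁻ˡ hv) (∧⁻ʳ {q u} hu) (∧⁻ʳ {q v} hv)))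
      (≤-reflexive (*-identityʳ _))
  ... | v , qv , ¬hit = v , qv , λ x h → ≢false λ Wx → true≢false
    (qv ∧⁺ some⁺ (λ x → (A ∖ W) x ∧ E v x) x ((∧⁻ˡ h ∧⁺ not⁺ Wx) ∧⁺ ∧⁻ʳ {A x} h)) ¬hit

-- Forced deletions

module Forced {n : ℕ} (E : Fin n → Fin n → Bool)
              (E-refl : ∀ v → E v v ≡ true) (E-sym : ∀ u v → E u v ≡ E v u)
              (k k² : ℕ) (k²≡ : k² ≡ k * k) where

  open ClosedGraph E E-refl E-sym public

  hard : Fin n → Fin n → Bool
  hard u v = k <ᵇ cnt (P u v)

  hardDeg : Fin n → ℕ
  hardDeg u = cnt (hard u)

  -- The induced P₃ without hard pairs.
  easyP : Fin n → Fin n → Fin n → Bool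
  easyP u v w = P u v w ∧ not (hard u v) ∧ not (hard u w) ∧ not (hard v w)

  linked : Fin n → Fin n → Bool
  linked u v = some (easyP u v)

  linkDeg : Fin n → ℕ
  linkDeg u = cnt (linked u)

  opaque
    A₀ : Pred n
    A₀ u = not (k <ᵇ hardDeg u) ∧ not (k² + k <ᵇ linkDeg u)

    A₀⁺ : ∀ {u} → hardDeg u ≤ k → linkDeg u ≤ k² + k → A₀ u ≡ true
    A₀⁺ p q = not⁺ (≮ᵇ⁺ p) ∧⁺ not⁺ (≮ᵇ⁺ q)

    A₀-hardDeg : ∀ {u} → A₀ u ≡ true → hardDeg u ≤ k
    A₀-hardDeg h = ≮ᵇ⁻ (not⁻ (∧⁻ˡ h))

    A₀-linkDeg : ∀ {u} → A₀ u ≡ true → linkDeg u ≤ k * k + k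
    A₀-linkDeg {u} h = ≤-trans (≮ᵇ⁻ (not⁻ (∧⁻ʳ {not (k <ᵇ hardDeg u)} h))) (≤-reflexive (cong (_+ k) k²≡))

  open Twins A₀ public

  cls₀ deg₀ : Fin n → ℕ
  cls₀ = cls A₀
  deg₀ = deg A₀

  big : Pred n
  big u = k <ᵇ cls₀ u

  bigLeader : Pred n
  bigLeader v = big v ∧ not (some λ l → tw A₀ v l ∧ (toℕ l <ᵇ toℕ v))

  saturated : Pred n
  saturated u = big u ∧ (k <ᵇ cnt λ l → bigLeader l ∧ (deg₀ l ≡ᵇ deg₀ u))

  -- The neighbourhood of a saturated u will be a clique of every solution, so
  -- the vertices attached to it from outside are deleted.
  excluded : Pred n
  excluded x = some λ u → some λ s → saturated u ∧ A₀ s ∧ E u s ∧ E s x ∧ not (E u x)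

  opaque
    A : Pred n
    A x = A₀ x ∧ not (excluded x)

    A⁺ : ∀ {x} → A₀ x ≡ true → excluded x ≡ false → A x ≡ true
    A⁺ p q = p ∧⁺ not⁺ q

    A⊆A₀ : A ⊆ A₀
    A⊆A₀ v h = ∧⁻ˡ h

    A-¬excluded : ∀ {x} → A x ≡ true → excluded x ≡ false
    A-¬excluded {x} h = not⁻ (∧⁻ʳ {A₀ x} h)

  hard-sym : ∀ u v → hard u v ≡ hard v u
  hard-sym u v = cong (k <ᵇ_) (cnt-cong (P-swapˡ u v))

  big⇒A₀ : ∀ {u} → big u ≡ true → A₀ u ≡ true
  big⇒A₀ h = cls>⇒∈ (<ᵇ⁻ h)

  -- If y formed a P₃ with u and u′, then so it would with every twin of u and
  -- every twin of u′; hence y would be in a hard pair with every twin of u.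
  ¬P-big : ∀ {y u v} → A₀ y ≡ true → big u ≡ true → big v ≡ true → P y u v ≡ true → ⊥
  ¬P-big {y} {u} {v} Ay bu bv h = <⇒≱ (≤-trans (<ᵇ⁻ bu) (cnt-mono twins-hard)) (A₀-hardDeg Ay)
    where
    twins-hard : tw A₀ u ⊆ hard y
    twins-hard c uc = <ᵇ⁺ (≤-trans (<ᵇ⁻ bv) (cnt-mono λ c′ vc′ → trans
      (P-cong (E-sym⁻ (trans (sym (tw-row uc Ay)) (E-sym u y)))
              (E-sym⁻ (trans (sym (tw-row vc′ Ay)) (E-sym v y)))
              (trans (sym (tw-row uc (tw-∈ʳ vc′)))
                     (E-sym⁻ (trans (sym (tw-row vc′ (tw-∈ˡ uc))) (E-sym v u))))) h))

  -- No P₃ has two big vertices. So a common neighbour makes `u` and `v` adjacent, and then a vertex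
  -- seeing only one of them would again form a P₃ with both. Distinct big classes thus have
  -- disjoint neighbourhoods.
  big-disjoint : ∀ {u v s} → A₀ s ≡ true → big u ≡ true → big v ≡ true →
                 E u s ≡ true → E v s ≡ true → tw A₀ u v ≡ true
  big-disjoint {u} {v} {s} As bu bv us vs = tw⁺ (big⇒A₀ bu) (big⇒A₀ bv) λ l Al → iff⇒≡
    (λ ul → ≢false λ vl → ¬P-big Al bu bv (P⁺ (E-sym⁻ ul) uv (E-sym⁻ vl)))
    (λ vl → ≢false λ ul → ¬P-big Al bu bv (P-swapʳ⁺ (P⁺ (E-sym⁻ vl) (E-sym⁻ uv) (E-sym⁻ ul))))
    where
    uv : E u v ≡ true
    uv = ≢false λ ¬uv → ¬P-big As bu bv (P-swapˡ⁺ (P⁺ us (E-sym⁻ vs) ¬uv))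

  bigLeader⇒big : ∀ {v} → bigLeader v ≡ true → big v ≡ true
  bigLeader⇒big h = ∧⁻ˡ h

  bigLeader-least : ∀ {u v} → bigLeader u ≡ true → tw A₀ u v ≡ true → toℕ u ≤ toℕ v
  bigLeader-least {u} {v} h uv with bool-cases (toℕ v <ᵇ toℕ u)
  ... | inj₂ e = ≮ᵇ⁻ e
  ... | inj₁ e = ⊥-elim (true≢false (uv ∧⁺ e) (none⁻ (λ l → tw A₀ u l ∧ (toℕ l <ᵇ toℕ u)) (not⁻ (∧⁻ʳ {big u} h)) v))

  bigLeader-unique : ∀ {x u v} → A₀ x ≡ true → bigLeader u ≡ true → bigLeader v ≡ true →
                     E u x ≡ true → E v x ≡ true → u ≡ v
  bigLeader-unique Ax lu lv ux vx =
    let uv = big-disjoint Ax (bigLeader⇒big lu) (bigLeader⇒big lv) ux vx in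
    toℕ-injective (≤-antisym (bigLeader-least lu uv) (bigLeader-least lv (tw-sym uv)))

  big-leader : ∀ {v} → big v ≡ true → ∃[ l ] bigLeader l ≡ true × tw A₀ l v ≡ true
  big-leader {v} bv with least (tw A₀ v) v (tw-refl (big⇒A₀ bv))
  ... | l , vl , min = l , (trans (cong (k <ᵇ_) (tw-cls (tw-sym vl))) bv ∧⁺ not⁺ (none⁺ _ λ m h →
    <⇒≱ (<ᵇ⁻ (∧⁻ʳ {tw A₀ l m} h)) (min m (tw-trans vl (∧⁻ˡ h))))) , tw-sym vl

  module _ {W : Pred n} (sol : Solves full k W) where
    open Solves sol

    hard-hit : ∀ {u v} → hard u v ≡ true → W u ≡ true → W v ≡ false
    hard-hit h Wu = ≢true λ Wv → <⇒≱ (≤-trans (<ᵇ⁻ h) (cnt-mono λ w p →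
      not⁺ (≢true λ Ww → transitive⇒¬P transitive Wu Wv Ww p))) cost

    -- A partner `v` of a kept `u` in a P₃ without hard pairs is deleted itself or has a deleted `x`
    -- as the third vertex. As `u` and `x` are not a hard pair, each of the at most k vertices `x`
    -- accounts for at most k such `v`: k + k² in total.
    W⊆A₀ : W ⊆ A₀
    W⊆A₀ u Wu =
      A₀⁺ (≤-trans (cnt-mono λ v h → not⁺ (hard-hit h Wu)) cost) (begin
        linkDeg u                                 ≤⟨ cnt-∪ cover ⟩
        cnt (full ∖ W) + cnt via                  ≤⟨ +-mono-≤ cost (cnt-⋃ (full ∖ W) (λ x v → P u x v ∧ not (hard u x)) via-cover via-size) ⟩
        k + cnt (full ∖ W) * k                    ≤⟨ +-monoʳ-≤ k (*-monoˡ-≤ k cost) ⟩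
        k + k * k                                 ≡⟨ +-comm k (k * k) ⟩
        k * k + k                                 ≡⟨ cong (_+ k) k²≡ ⟨
        k² + k                                    ∎)
      where
      open ≤-Reasoning
      via : Pred n
      via v = some λ x → (full ∖ W) x ∧ P u x v ∧ not (hard u x)
      cover : ∀ v → linked u v ≡ true → (full ∖ W) v ≡ true ⊎ via v ≡ true
      cover v h with bool-cases (W v)
      ... | inj₂ ¬Wv = inj₁ (not⁺ ¬Wv)
      ... | inj₁ Wv with some⁻ (easyP u v) h
      ...   | w , p = inj₂ (some⁺ _ w
        (not⁺ (≢true λ Ww → transitive⇒¬P transitive Wu Wv Ww (∧⁻ˡ p)) ∧⁺
         P-swapʳ⁺ (∧⁻ˡ p) ∧⁺ ∧⁻ˡ (∧⁻ʳ {not (hard u v)} (∧⁻ʳ {P u v w} p))))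
      via-cover : ∀ v → via v ≡ true → ∃[ x ] (full ∖ W) x ≡ true × P u x v ∧ not (hard u x) ≡ true
      via-cover v h = let x , e = some⁻ _ h in x , ∧⁻ e
      via-size : ∀ x → (full ∖ W) x ≡ true → cnt (λ v → P u x v ∧ not (hard u x)) ≤ k
      via-size x _ with bool-cases (hard u x)
      ... | inj₁ h = ≤-trans (≤-reflexive (cnt-none λ v → ≢true λ e →
              true≢false h (not⁻ (∧⁻ʳ {P u x v} e)))) z≤n
      ... | inj₂ h = ≤-trans (cnt-mono λ v e → ∧⁻ˡ e) (≮ᵇ⁻ h)

    cost₀ : cnt (A₀ ∖ W) ≤ k
    cost₀ = ≤-trans (cnt-mono λ i h → ∧⁻ʳ {A₀ i} h) cost

    twin-kept : ∀ {u} → big u ≡ true → ∃[ c ] tw A₀ u c ≡ true × W c ≡ true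
    twin-kept {u} bu with cnt-< (tw A₀ u) (full ∖ W) (≤-<-trans cost (<ᵇ⁻ bu))
    ... | c , uc , ¬X with bool-cases (W c)
    ...   | inj₁ Wc = c , uc , Wc
    ...   | inj₂ ¬Wc = ⊥-elim (true≢false (not⁺ ¬Wc) ¬X)

    -- Some big class of the same degree is left intact, so deg₀ u is the clique
    -- size of the solution; a surviving twin of u then keeps all its neighbours.
    saturated-intact : ∀ {u} → saturated u ≡ true → N A₀ u ⊆ W
    saturated-intact {u} h s us with intact A₀ W _ (≤-<-trans cost₀ (<ᵇ⁻ (∧⁻ʳ {big u} h)))
      (λ Ax lu lv → bigLeader-unique Ax (∧⁻ˡ lu) (∧⁻ˡ lv)) | twin-kept {u} (∧⁻ˡ h)
    ... | v , lv , v⊆W | c , uc , Wc =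
      ∧⁻ˡ (⊆-cnt-≥ (N W c) (N A₀ c) (λ l e → W⊆A₀ l (∧⁻ˡ e) ∧⁺ ∧⁻ʳ {W l} e) large s
        (∧⁻ˡ us ∧⁺ trans (sym (tw-row uc (∧⁻ˡ us))) (∧⁻ʳ {A₀ s} us)))
      where
      open ≤-Reasoning
      Av : A₀ v ≡ true
      Av = big⇒A₀ (bigLeader⇒big (∧⁻ˡ lv))
      large : deg A₀ c ≤ deg W c
      large = begin
        deg A₀ c   ≡⟨ tw-deg uc (λ _ e → e) ⟨
        deg A₀ u   ≡⟨ ≡ᵇ⁻ (∧⁻ʳ {bigLeader v} lv) ⟨
        deg A₀ v   ≤⟨ cnt-mono (λ l e → v⊆W l e ∧⁺ ∧⁻ʳ {A₀ l} e) ⟩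
        deg W v    ≡⟨ regular v (v⊆W v (Av ∧⁺ E-refl v)) ⟩
        cliqueSize ≡⟨ regular c Wc ⟨
        deg W c    ∎

    -- The saturated `u` may itself be deleted, but a twin `c` of it survives, and so does the
    -- neighbour `s`; a kept `x` attached to `s` alone would form the P₃ on `c`, `s`, `x`.
    W⊆A : W ⊆ A
    W⊆A x Wx = A⁺ (W⊆A₀ x Wx) (none⁺ _ λ u e → step u (some⁻ _ e))
      where
      step : ∀ u → ∃[ s ] saturated u ∧ A₀ s ∧ E u s ∧ E s x ∧ not (E u x) ≡ true → ⊥
      step u (s , e) with ∧⁻ {saturated u} e
      ... | sat , e₁ with ∧⁻ {A₀ s} e₁
      ...   | As , e₂ with ∧⁻ {E u s} e₂
      ...     | us , e₃ with ∧⁻ {E s x} e₃ | twin-kept (∧⁻ˡ sat)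
      ...       | sx , ¬ux | c , uc , Wc = true≢false
        (transitive c s x Wc (saturated-intact sat s (As ∧⁺ us)) Wx (trans (sym (tw-row uc As)) us) sx)
        (trans (sym (tw-row uc (W⊆A₀ x Wx))) (not⁻ ¬ux))

    deleted≤k : cnt (full ∖ A) ≤ k
    deleted≤k = ≤-trans (m≤m+n _ _) (≤-trans (≤-reflexive (sym (cnt-complement W⊆A))) cost)

    solves-rest : Solves A (k ∸ cnt (full ∖ A)) W
    solves-rest = record
      { inside = W⊆A ; transitive = transitive ; cliqueSize = cliqueSize ; regular = regular
      ; cost = m+n≤o⇒m≤o∸n _ (≤-trans (≤-reflexive (trans (+-comm _ (cnt (full ∖ A))) (sym (cnt-complement W⊆A)))) cost) }

  solves-all : ∀ {W} → cnt (full ∖ A) ≤ k → Solves A (k ∸ cnt (full ∖ A)) W → Solves full k W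
  solves-all h sol = record
    { inside = λ _ _ → refl ; transitive = transitive ; cliqueSize = cliqueSize ; regular = regular
    ; cost = begin
        _                                              ≡⟨ cnt-complement inside ⟩
        cnt (full ∖ A) + _                             ≤⟨ +-monoʳ-≤ (cnt (full ∖ A)) cost ⟩
        cnt (full ∖ A) + (k ∸ cnt (full ∖ A))          ≡⟨ m+[n∸m]≡n h ⟩
        k                                              ∎ }
    where
    open Solves sol
    open ≤-Reasoning

-- Surplus isolated cliques

module Thin {n : ℕ} (E : Fin n → Fin n → Bool)
            (E-refl : ∀ v → E v v ≡ true) (E-sym : ∀ u v → E u v ≡ E v u)
            (k : ℕ) (A : Pred n) where

  open ClosedGraph E E-refl E-sym

  -- All neighbours of `u` in `A` have the same row as `u` there: the closed neighbourhood is a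
  -- component and a clique.
  isolated : Pred n
  isolated u = A u ∧ not (some λ l → A l ∧ E u l ∧ (0 <ᵇ diff A u l))

  leader : Pred n
  leader u = isolated u ∧ not (some λ l → A l ∧ E u l ∧ (toℕ l <ᵇ toℕ u))

  -- Numbers the isolated cliques of one size from 0 by their leaders, so ranks up to k retain k + 1
  -- of them, one more than k deletions can hit.
  rank : Fin n → ℕ
  rank u = cnt λ l → leader l ∧ (deg A l ≡ᵇ deg A u) ∧ (toℕ l <ᵇ toℕ u)

  surplus : Pred n
  surplus u = some λ l → leader l ∧ E l u ∧ (k <ᵇ rank l)

  opaque
    B : Pred n
    B u = A u ∧ not (surplus u)

    B⁺ : ∀ {u} → A u ≡ true → surplus u ≡ false → B u ≡ true
    B⁺ p q = p ∧⁺ not⁺ q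

    B⊆A : B ⊆ A
    B⊆A u h = ∧⁻ˡ h

    B-¬surplus : ∀ {u} → B u ≡ true → surplus u ≡ false
    B-¬surplus {u} h = not⁻ (∧⁻ʳ {A u} h)

  leader-∈ : ∀ {l} → leader l ≡ true → A l ≡ true
  leader-∈ h = ∧⁻ˡ (∧⁻ˡ h)

  isolated-row : ∀ {l x} → isolated l ≡ true → A x ≡ true → E l x ≡ true →
                 ∀ z → A z ≡ true → E l z ≡ E x z
  isolated-row {l} {x} h Ax lx z Az = diff⁻ A (≢true λ d →
    true≢false (Ax ∧⁺ lx ∧⁺ d) (none⁻ _ (not⁻ (∧⁻ʳ {A l} h)) x)) z Az

  isolated⁺ : ∀ {l} → A l ≡ true → (∀ {x} → A x ≡ true → E l x ≡ true → ∀ z → A z ≡ true → E l z ≡ E x z) →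
              isolated l ≡ true
  isolated⁺ {l} Al h = Al ∧⁺ not⁺ (none⁺ _ λ x e →
    true≢false (∧⁻ʳ {E l x} (∧⁻ʳ {A x} e)) (diff⁺ A (h (∧⁻ˡ e) (∧⁻ˡ (∧⁻ʳ {A x} e)))))

  leader-row : ∀ {l x} → leader l ≡ true → A x ≡ true → E l x ≡ true →
               ∀ {z} → A z ≡ true → E l z ≡ E x z
  leader-row h Ax lx {z} Az = isolated-row (∧⁻ˡ h) Ax lx z Az

  leader-≤ : ∀ {l x} → leader l ≡ true → A x ≡ true → E l x ≡ true → toℕ l ≤ toℕ x
  leader-≤ {l} {x} h Ax lx = ≮⇒≥ λ x<l →
    true≢false (Ax ∧⁺ lx ∧⁺ <ᵇ⁺ x<l) (none⁻ _ (not⁻ (∧⁻ʳ {isolated l} h)) x)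

  leader-unique : ∀ {x l m} → A x ≡ true → leader l ≡ true → leader m ≡ true →
                  E l x ≡ true → E m x ≡ true → l ≡ m
  leader-unique Ax hl hm lx mx = toℕ-injective (≤-antisym
    (leader-≤ hl (leader-∈ hm) lm) (leader-≤ hm (leader-∈ hl) (E-sym⁻ lm)))
    where
    lm = trans (leader-row hl Ax lx (leader-∈ hm)) (E-sym⁻ mx)

  isolated-leader : ∀ {v} → isolated v ≡ true → ∃[ l ] leader l ≡ true × E l v ≡ true
  isolated-leader {v} h with least (N A v) v (∧⁻ˡ h ∧⁺ E-refl v)
  ... | l , e , min = l , (isolated⁺ Al row ∧⁺ not⁺ (none⁺ _ first)) , E-sym⁻ vl
    where
    Al = ∧⁻ˡ e
    vl = ∧⁻ʳ {A l} e
    row : ∀ {x} → A x ≡ true → E l x ≡ true → ∀ z → A z ≡ true → E l z ≡ E x z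
    row {x} Ax lx z Az = trans (sym (isolated-row h Al vl z Az))
      (isolated-row h Ax (trans (isolated-row h Al vl x Ax) lx) z Az)
    first : ∀ x → A x ∧ E l x ∧ (toℕ x <ᵇ toℕ l) ≡ true → ⊥
    first x f with ∧⁻ {A x} f
    ... | Ax , f′ = <⇒≱ (<ᵇ⁻ (∧⁻ʳ {E l x} f′)) (min x (Ax ∧⁺ trans (isolated-row h Al vl x Ax) (∧⁻ˡ f′)))

  leader-deg : ∀ {l v} → leader l ≡ true → A v ≡ true → E l v ≡ true → deg A l ≡ deg A v
  leader-deg {l} {v} h Av lv = cnt-cong λ z → iff⇒≡
    (λ e → ∧⁻ˡ e ∧⁺ trans (sym (leader-row h Av lv (∧⁻ˡ e))) (∧⁻ʳ {A z} e))
    (λ e → ∧⁻ˡ e ∧⁺ trans (leader-row h Av lv (∧⁻ˡ e)) (∧⁻ʳ {A z} e))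

  -- Surplus vertices form whole components, so removing or restoring them leaves the degrees of all
  -- others unchanged.
  surplus-closed : ∀ {u v} → A u ≡ true → A v ≡ true → E u v ≡ true → surplus u ≡ true → surplus v ≡ true
  surplus-closed {u} {v} Au Av uv h with some⁻ _ h
  ... | l , e with ∧⁻ {leader l} e
  ...   | hl , e′ = some⁺ _ l (hl ∧⁺ trans (leader-row hl Au (∧⁻ˡ e′) Av) uv ∧⁺ ∧⁻ʳ {E l u} e′)

  module _ (m : ℕ) where

    leadersOf : Pred n
    leadersOf l = leader l ∧ (deg A l ≡ᵇ m)

    -- The condition `rank l ≤ k` in the form that `cnt-rank<` counts.
    first-leaders : Pred n
    first-leaders l = leadersOf l ∧ (cnt (λ w → leadersOf w ∧ (toℕ w <ᵇ toℕ l)) <ᵇ suc k)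

    first-leaders-cnt : cnt first-leaders ≡ cnt leadersOf ⊓ suc k
    first-leaders-cnt = cnt-rank< leadersOf 0 (suc k)

    rank-leadersOf : ∀ {l} → leadersOf l ≡ true → cnt (λ w → leadersOf w ∧ (toℕ w <ᵇ toℕ l)) ≡ rank l
    rank-leadersOf {l} h with ≡ᵇ⁻ {deg A l} (∧⁻ʳ {leader l} h)
    ... | refl = cnt-cong λ w → ∧-assoc (leader w) _ _

    first-leaders⁺ : ∀ {l} → leadersOf l ≡ true → rank l ≤ k → first-leaders l ≡ true
    first-leaders⁺ h r = h ∧⁺ <ᵇ⁺ (s≤s (≤-trans (≤-reflexive (rank-leadersOf h)) r))

    first-leaders-rank : ∀ {l} → first-leaders l ≡ true → rank l ≤ k
    first-leaders-rank {l} h = ≤-trans (≤-reflexive (sym (rank-leadersOf (∧⁻ˡ h)))) (s≤s⁻¹ (<ᵇ⁻ (∧⁻ʳ {leadersOf l} h)))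

    first-leaders≤ : cnt first-leaders ≤ suc k
    first-leaders≤ = ≤-trans (≤-reflexive first-leaders-cnt) (m⊓n≤n _ _)

    first-leaders≥ : k < cnt leadersOf → k < cnt first-leaders
    first-leaders≥ h = ≤-trans (⊓-glb h ≤-refl) (≤-reflexive (sym first-leaders-cnt))

  surplus-few : ∀ {l} → leader l ≡ true → k < rank l → k < cnt (leadersOf (deg A l))
  surplus-few {l} hl h = ≤-trans h (cnt-mono λ w e →
    ∧⁻ˡ {leader w} e ∧⁺ ∧⁻ˡ {deg A w ≡ᵇ deg A l} (∧⁻ʳ {leader w} e))

  isolated-first-leader : ∀ {v} → isolated v ≡ true → surplus v ≡ false →
                          ∃[ l ] first-leaders (deg A v) l ≡ true × E l v ≡ true
  isolated-first-leader {v} h ¬s with isolated-leader h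
  ... | l , hl , lv = l , first-leaders⁺ (deg A v) (hl ∧⁺ ≡ᵇ⁺ (leader-deg hl (∧⁻ˡ h) lv))
    (≮ᵇ⁻ (≢true λ r → true≢false (hl ∧⁺ lv ∧⁺ r) (none⁻ _ ¬s l))) , lv

  first-leader-neighbours : ∀ {m l x} → first-leaders m l ≡ true → A x ≡ true → E l x ≡ true → B x ≡ true
  first-leader-neighbours {m} {l} {x} h Ax lx = B⁺ Ax (none⁺ _ λ r e → step r (∧⁻ {leader r} e))
    where
    hl = ∧⁻ˡ (∧⁻ˡ {leadersOf m l} h)
    step : ∀ r → leader r ≡ true × E r x ∧ (k <ᵇ rank r) ≡ true → ⊥
    step r (hr , e) with leader-unique Ax hl hr lx (∧⁻ˡ e)
    ... | refl = <⇒≱ (<ᵇ⁻ (∧⁻ʳ {E r x} e)) (first-leaders-rank m h)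

  module _ {b : ℕ} where

    thin : ∀ {W} → Solves A b W → Solves B b (W ∩ B)
    thin {W} sol = record
      { inside     = λ v h → ∧⁻ʳ {W v} h
      ; cost       = ≤-trans (cnt-mono λ v h → B⊆A v (∧⁻ˡ h) ∧⁺ not⁺ (≢true λ Wv →
                       true≢false (Wv ∧⁺ ∧⁻ˡ h) (not⁻ (∧⁻ʳ {B v} h)))) cost
      ; transitive = λ u v w hu hv hw → transitive u v w (∧⁻ˡ hu) (∧⁻ˡ hv) (∧⁻ˡ hw)
      ; cliqueSize = cliqueSize
      ; regular    = λ v h → trans (cnt-cong λ l → iff⇒≡
          (λ e → ∧⁻ˡ {W l} (∧⁻ˡ {W l ∧ B l} e) ∧⁺ ∧⁻ʳ {W l ∧ B l} e)
          (λ e → (∧⁻ˡ {W l} e ∧⁺ stays v l (∧⁻ʳ {W v} h) (inside l (∧⁻ˡ e)) (∧⁻ʳ {W l} e)) ∧⁺ ∧⁻ʳ {W l} e))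
          (regular v (∧⁻ˡ h))
      }
      where
      open Solves sol
      stays : ∀ v l → B v ≡ true → A l ≡ true → E v l ≡ true → B l ≡ true
      stays v l Bv Al vl = B⁺ Al (≢true λ s →
        true≢false (surplus-closed Al (B⊆A v Bv) (E-sym⁻ vl) s) (B-¬surplus Bv))

    module _ (b≤k : b ≤ k) {W : Pred n} (sol : Solves B b W) where
      open Solves sol

      W⁺ : Pred n
      W⁺ v = W v ∨ (A v ∧ surplus v)

      W⁺⊆A : W⁺ ⊆ A
      W⁺⊆A v h with ∨⁻ {W v} h
      ... | inj₁ Wv = B⊆A v (inside v Wv)
      ... | inj₂ e  = ∧⁻ˡ e

      W⇒¬surplus : ∀ {v} → W v ≡ true → surplus v ≡ false
      W⇒¬surplus {v} Wv = B-¬surplus (inside v Wv)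

      W⁺-near-W : ∀ {u v} → W u ≡ true → W⁺ v ≡ true → E u v ≡ true → W v ≡ true
      W⁺-near-W {u} {v} Wu Wv uv with ∨⁻ {W v} Wv
      ... | inj₁ h = h
      ... | inj₂ e = ⊥-elim (true≢false
        (surplus-closed (∧⁻ˡ e) (B⊆A u (inside u Wu)) (E-sym⁻ uv) (∧⁻ʳ {A v} e)) (W⇒¬surplus Wu))

      surplus-row : ∀ {u v} → A u ≡ true → surplus u ≡ true → A v ≡ true → E u v ≡ true →
                    ∀ {z} → A z ≡ true → E u z ≡ E v z
      surplus-row {u} {v} Au s Av uv Az with some⁻ _ s
      ... | l , e = let hl = ∧⁻ˡ e ; lu = ∧⁻ˡ (∧⁻ʳ {leader l} e) in
        trans (sym (leader-row hl Au lu Az)) (leader-row hl Av (trans (leader-row hl Au lu Av) uv) Az)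

      -- A surplus clique has k + 1 retained copies of the same size, one of
      -- which the solution leaves intact.
      surplus-size : ∀ {v} → A v ≡ true → surplus v ≡ true → deg A v ≡ cliqueSize
      surplus-size {v} Av s with some⁻ _ s
      ... | l , e with ∧⁻ {leader l} e
      ...   | hl , e′ with intact B W (first-leaders (deg A l))
                (≤-<-trans (≤-trans cost b≤k) (first-leaders≥ (deg A l) (surplus-few hl (<ᵇ⁻ (∧⁻ʳ {E l v} e′)))))
                (λ Bx hq hr → leader-unique (B⊆A _ Bx) (∧⁻ˡ (∧⁻ˡ hq)) (∧⁻ˡ (∧⁻ˡ hr)))
      ...     | r , hr , kept = begin
        deg A v    ≡⟨ leader-deg hl Av (∧⁻ˡ e′) ⟨
        deg A l    ≡⟨ ≡ᵇ⁻ (∧⁻ʳ {leader r} (∧⁻ˡ hr)) ⟨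
        deg A r    ≡⟨ cnt-cong (λ z → iff⇒≡
                        (λ f → keep (∧⁻ˡ f) (∧⁻ʳ {A z} f) ∧⁺ ∧⁻ʳ {A z} f)
                        (λ f → B⊆A z (inside z (∧⁻ˡ f)) ∧⁺ ∧⁻ʳ {W z} f)) ⟩
        deg W r    ≡⟨ regular r (keep Ar (E-refl r)) ⟩
        cliqueSize ∎
        where
        open ≡-Reasoning
        Ar : A r ≡ true
        Ar = leader-∈ (∧⁻ˡ (∧⁻ˡ hr))
        keep : ∀ {x} → A x ≡ true → E r x ≡ true → W x ≡ true
        keep {x} Ax rx = kept x (first-leader-neighbours hr Ax rx ∧⁺ rx)

      unthin : Solves A b W⁺
      unthin = record
        { inside     = W⁺⊆A
        ; cost       = ≤-trans (cnt-mono λ v h → cost-⊆ v (∧⁻ˡ h) (not⁻ (∧⁻ʳ {A v} h))) cost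
        ; transitive = tr
        ; cliqueSize = cliqueSize
        ; regular    = reg
        }
        where
        cost-⊆ : ∀ v → A v ≡ true → W⁺ v ≡ false → B v ∧ not (W v) ≡ true
        cost-⊆ v Av h = B⁺ Av (≢true λ s → true≢false (∨⁺ʳ {W v} (Av ∧⁺ s)) h)
                        ∧⁺ not⁺ (≢true λ Wv → true≢false (∨⁺ˡ Wv) h)
        tr : Transitive W⁺
        tr u v w hu hv hw uv vw with ∨⁻ {W u} hu
        ... | inj₁ Wu = let Wv = W⁺-near-W Wu hv uv in transitive u v w Wu Wv (W⁺-near-W Wv hw vw) uv vw
        ... | inj₂ e  = trans (surplus-row (∧⁻ˡ e) (∧⁻ʳ {A u} e) (W⁺⊆A v hv) uv (W⁺⊆A w hw)) vw
        reg : ∀ v → W⁺ v ≡ true → deg W⁺ v ≡ cliqueSize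
        reg v h with ∨⁻ {W v} h
        ... | inj₁ Wv = trans (cnt-cong λ l → iff⇒≡
          (λ e → W⁺-near-W Wv (∧⁻ˡ e) (∧⁻ʳ {W⁺ l} e) ∧⁺ ∧⁻ʳ {W⁺ l} e)
          (λ e → ∨⁺ˡ {W l} (∧⁻ˡ {W l} e) ∧⁺ ∧⁻ʳ {W l} e)) (regular v Wv)
        ... | inj₂ e = trans (cnt-cong λ l → iff⇒≡
          (λ f → W⁺⊆A l (∧⁻ˡ f) ∧⁺ ∧⁻ʳ {W⁺ l} f)
          (λ f → ∨⁺ʳ {W l} (∧⁻ˡ f ∧⁺ surplus-closed (∧⁻ˡ e) (∧⁻ˡ f) (∧⁻ʳ {A l} f) (∧⁻ʳ {A v} e)) ∧⁺ ∧⁻ʳ {A l} f))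
          (surplus-size (∧⁻ˡ e) (∧⁻ʳ {A v} e))

-- Shrinking the twin classes

module Shrink {n : ℕ} (E : Fin n → Fin n → Bool)
              (E-refl : ∀ v → E v v ≡ true) (E-sym : ∀ u v → E u v ≡ E v u)
              (k k² : ℕ) (k²≡ : k² ≡ k * k) (B : Pred n) where

  open ClosedGraph E E-refl E-sym
  open Twins B

  clsRank : Fin n → ℕ
  clsRank u = cnt λ l → tw B u l ∧ (toℕ l <ᵇ toℕ u)

  -- In a clique of a solution all but k² vertices are in one twin class.  Any
  -- other class met by it has at most k² + k = τ vertices, counting the at most
  -- k deleted ones, and is not trimmed.  L is such that a class with τ + t
  -- vertices is met whenever L ∸ k vertices of the clique are not trimmed.
  τ L : ℕ
  τ = k² + k
  L = 1 + (τ + τ)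

  -- The excess of the largest class over `L` is a maximum, which is not a sum; as the number of `j`
  -- with `L + j` below that maximum it becomes one.
  exceeded : Pred n
  exceeded j = some λ v → L + toℕ j <ᵇ cls B v

  t : ℕ
  t = cnt exceeded

  -- A window of ranks in each class, from `τ` up to but excluding `τ + t`. The first `τ` members
  -- always stay, so more than k twins are left to exchange with; a class with at least `τ + t`
  -- members loses exactly `t`; if anything is trimmed, the largest class keeps exactly `L`.
  trimmed : Pred n
  trimmed v = not (clsRank v <ᵇ τ) ∧ (clsRank v <ᵇ τ + t)

  opaque
    K : Pred n
    K v = B v ∧ not (trimmed v)

    K⁺ : ∀ {v} → B v ≡ true → trimmed v ≡ false → K v ≡ true
    K⁺ p q = p ∧⁺ not⁺ q

    K⊆B : K ⊆ B
    K⊆B v h = ∧⁻ˡ h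

    K-¬trimmed : ∀ {v} → K v ≡ true → trimmed v ≡ false
    K-¬trimmed {v} h = not⁻ (∧⁻ʳ {B v} h)

  removed : Fin n → ℕ
  removed u = cnt (tw B u ∩ trimmed)

  clsRank-tw : ∀ {u v} → tw B u v ≡ true → clsRank v ≡ cnt (λ l → tw B u l ∧ (toℕ l <ᵇ toℕ v))
  clsRank-tw {u} {v} h = cnt-cong λ l → cong (_∧ (toℕ l <ᵇ toℕ v)) (iff⇒≡ (tw-trans h) (tw-trans (tw-sym h)))

  cls-below : ∀ u a → cnt (λ v → tw B u v ∧ (clsRank v <ᵇ a)) ≡ cls B u ⊓ a
  cls-below u a = trans (cnt-cong λ v → eq v) (cnt-rank< (tw B u) 0 a)
    where
    eq : ∀ v → tw B u v ∧ (clsRank v <ᵇ a) ≡ tw B u v ∧ (cnt (λ l → tw B u l ∧ (toℕ l <ᵇ toℕ v)) <ᵇ a)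
    eq v with tw B u v in uv
    ... | true  = cong (_<ᵇ a) (clsRank-tw uv)
    ... | false = refl

  <ᵇ-+ : ∀ x a b → (x <ᵇ a) ≡ true → (x <ᵇ a + b) ≡ true
  <ᵇ-+ x a b h = <ᵇ⁺ (≤-trans (<ᵇ⁻ h) (m≤m+n a b))

  removed-eq : ∀ u → cls B u ⊓ τ + removed u ≡ cls B u ⊓ (τ + t)
  removed-eq u = begin
    cls B u ⊓ τ + removed u
      ≡⟨ cong₂ _+_ (sym (trans (cnt-cong λ v → iff⇒≡
           (λ e → ∧⁻ˡ {tw B u v} (∧⁻ˡ {tw B u v ∧ _} e) ∧⁺ ∧⁻ʳ {tw B u v ∧ _} e)
           (λ e → (∧⁻ˡ {tw B u v} e ∧⁺ <ᵇ-+ (clsRank v) τ t (∧⁻ʳ {tw B u v} e)) ∧⁺ ∧⁻ʳ {tw B u v} e)) (cls-below u τ)))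
         (cnt-cong λ v → bits (tw B u v) (clsRank v <ᵇ τ) _) ⟩
    cnt (below ∩ low) + cnt (below ∖ low)
      ≡⟨ cnt-split below low ⟨
    cnt below
      ≡⟨ cls-below u (τ + t) ⟩
    cls B u ⊓ (τ + t) ∎
    where
    open ≡-Reasoning
    below low : Pred n
    below v = tw B u v ∧ (clsRank v <ᵇ τ + t)
    low v = clsRank v <ᵇ τ
    bits : ∀ a b c → a ∧ not b ∧ c ≡ (a ∧ c) ∧ not b
    bits true  true  true  = refl
    bits true  true  false = refl
    bits true  false true  = refl
    bits true  false false = refl
    bits false b     c     = refl

  removed-all : ∀ {u} → τ + t ≤ cls B u → removed u ≡ t
  removed-all {u} h = +-cancelˡ-≡ τ _ _ (begin
    τ + removed u           ≡⟨ cong (_+ removed u) (m≥n⇒m⊓n≡n (≤-trans (m≤m+n τ t) h)) ⟨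
    cls B u ⊓ τ + removed u ≡⟨ removed-eq u ⟩
    cls B u ⊓ (τ + t)       ≡⟨ m≥n⇒m⊓n≡n h ⟩
    τ + t                   ∎)
    where open ≡-Reasoning

  removed≤t : ∀ u → removed u ≤ t
  removed≤t u with ≤-total (cls B u) (τ + t)
  ... | inj₂ h = ≤-reflexive (removed-all h)
  ... | inj₁ h with ≤-total (cls B u) τ
  ...   | inj₁ h′ = ≤-trans (≤-reflexive (+-cancelˡ-≡ (cls B u) _ _ (begin
          cls B u + removed u     ≡⟨ cong (_+ removed u) (m≤n⇒m⊓n≡m h′) ⟨
          cls B u ⊓ τ + removed u ≡⟨ removed-eq u ⟩
          cls B u ⊓ (τ + t)       ≡⟨ m≤n⇒m⊓n≡m h ⟩
          cls B u                 ≡⟨ +-identityʳ _ ⟨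
          cls B u + 0             ∎))) z≤n
    where open ≡-Reasoning
  ...   | inj₂ h′ = +-cancelˡ-≤ τ _ _ (begin
          τ + removed u           ≡⟨ cong (_+ removed u) (m≥n⇒m⊓n≡n h′) ⟨
          cls B u ⊓ τ + removed u ≡⟨ removed-eq u ⟩
          cls B u ⊓ (τ + t)       ≤⟨ m⊓n≤n (cls B u) _ ⟩
          τ + t                   ∎)
    where open ≤-Reasoning

  cls-split : ∀ u → cls B u ≡ removed u + cnt (tw B u ∖ trimmed)
  cls-split u = cnt-split (tw B u) trimmed

  kept≤τ : ∀ {u} → cls B u ≤ τ + t → cnt (tw B u ∖ trimmed) ≤ τ
  kept≤τ {u} h = +-cancelˡ-≤ (removed u) _ _ (begin
    removed u + cnt (tw B u ∖ trimmed) ≡⟨ cls-split u ⟨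
    cls B u                            ≡⟨ m≤n⇒m⊓n≡m h ⟨
    cls B u ⊓ (τ + t)                  ≡⟨ removed-eq u ⟨
    cls B u ⊓ τ + removed u            ≤⟨ +-monoˡ-≤ (removed u) (m⊓n≤n (cls B u) τ) ⟩
    τ + removed u                      ≡⟨ +-comm τ _ ⟩
    removed u + τ                      ∎)
    where open ≤-Reasoning

  cls≤ : ∀ u → cls B u ≤ L + t
  cls≤ u = ≮⇒≥ λ h → <-irrefl refl (begin-strict
    -- `exceeded` ranges over `Fin n` only; since a class has at most n members, the indices 0 to
    -- `t` all exist.
    t                                   <⟨ ⊓-glb (≤-trans (s≤s (m≤n+m t L)) (≤-trans h (cnt≤n _))) ≤-refl ⟩
    n ⊓ suc t                           ≡⟨ cnt-below n (suc t) ⟨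
    cnt {n} (λ j → toℕ j <ᵇ suc t)      ≤⟨ cnt-mono (λ j e → some⁺ _ u (<ᵇ⁺ (≤-<-trans (+-monoʳ-≤ L (s≤s⁻¹ (<ᵇ⁻ e))) h))) ⟩
    t                                   ∎)
    where open ≤-Reasoning

  largest-class : 0 < t → ∃[ u ] L + t ≤ cls B u
  largest-class h = go t refl h
    where
    go : ∀ s → s ≡ t → 0 < s → ∃[ u ] L + s ≤ cls B u
    go (suc s) eq _ with cnt-< exceeded (λ j → toℕ j <ᵇ s)
      (≤-trans (s≤s (≤-trans (≤-reflexive (cnt-below n s)) (m⊓n≤n n s))) (≤-reflexive eq))
    ... | j , ej , j≥s with some⁻ _ ej
    ...   | u , e = u , ≤-trans (≤-reflexive (+-suc L s)) (≤-trans (s≤s (+-monoʳ-≤ L (≮ᵇ⁻ j≥s))) (<ᵇ⁻ e))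

  kept≤L : ∀ u → cnt (tw B u ∖ trimmed) ≤ L
  kept≤L u with ≤-total (cls B u) (τ + t)
  ... | inj₁ h = ≤-trans (kept≤τ h) (≤-trans (m≤m+n τ τ) (n≤1+n _))
  ... | inj₂ h = +-cancelˡ-≤ t _ _ (begin
    t + cnt (tw B u ∖ trimmed)         ≡⟨ cong (_+ cnt (tw B u ∖ trimmed)) (removed-all h) ⟨
    removed u + cnt (tw B u ∖ trimmed) ≡⟨ cls-split u ⟨
    cls B u                            ≤⟨ cls≤ u ⟩
    L + t                              ≡⟨ +-comm L t ⟩
    t + L                              ∎)
    where open ≤-Reasoning

  tw-E₂ : ∀ {u u′ v v′} → tw B u u′ ≡ true → tw B v v′ ≡ true → E u v ≡ E u′ v′
  tw-E₂ {u} {u′} {v} {v′} h g =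
    trans (tw-row h (tw-∈ˡ g)) (trans (E-sym u′ v) (trans (tw-row g (tw-∈ʳ h)) (E-sym v′ u′)))

  trimmed-rank : ∀ {v} → trimmed v ≡ true → τ ≤ clsRank v
  trimmed-rank h = ≮ᵇ⁻ (not⁻ (∧⁻ˡ h))

  clsRank<cls : ∀ {v} → B v ≡ true → clsRank v < cls B v
  clsRank<cls {v} Bv = ≮⇒≥ λ h → <⇒≱ (<ᵇ⁻ {toℕ v} (∧⁻ʳ {tw B v v}
    (⊆-cnt-≥ (λ l → tw B v l ∧ (toℕ l <ᵇ toℕ v)) (tw B v) (λ l e → ∧⁻ˡ e) (s≤s⁻¹ h) v (tw-refl Bv)))) ≤-refl

  low : Fin n → Pred n
  low u v = tw B u v ∧ (clsRank v <ᵇ τ)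

  low-τ : ∀ {u} → B u ≡ true → trimmed u ≡ true → cnt (low u) ≡ τ
  low-τ {u} Bu h = trans (cls-below u τ) (m≥n⇒m⊓n≡n (≤-trans (trimmed-rank h) (<⇒≤ (clsRank<cls Bu))))

  low-¬trimmed : ∀ {v} → (clsRank v <ᵇ τ) ≡ true → trimmed v ≡ false
  low-¬trimmed h rewrite h = refl

  no-trim : t ≡ 0 → ∀ v → trimmed v ≡ false
  no-trim e v = ≢true λ h → <⇒≱ (≤-trans (<ᵇ⁻ (∧⁻ʳ {not (clsRank v <ᵇ τ)} h))
    (≤-reflexive (trans (cong (τ +_) e) (+-identityʳ τ)))) (trimmed-rank h)

  -- The hypothesis is the bound k on the hard degree, spelled out.
  module _ (lopsided : ∀ {x} → B x ≡ true → cnt (λ u → k <ᵇ cnt (P x u)) ≤ k) where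

    module _ {W : Pred n} (W⊆B : W ⊆ B) (few : cnt (B ∖ W) ≤ k) (tr : Transitive W) where

      -- x splits the clique of v into neighbours and non-neighbours; if both
      -- parts had more than k vertices, x would be in a hard pair with every
      -- neighbour.
      minority : Fin n → Fin n → Fin n → Bool
      minority v x y = if k <ᵇ cnt (λ z → N W v z ∧ E x z) then not (E x y) else E x y

      minority-small : ∀ {v} → W v ≡ true → ∀ x → B x ≡ true → cnt (λ y → N W v y ∧ minority v x y) ≤ k
      minority-small {v} Wv x Bx with k <ᵇ cnt (λ z → N W v z ∧ E x z) in eq
      ... | false = ≮ᵇ⁻ eq
      ... | true  = ≮⇒≥ λ large → <⇒≱ (<-≤-trans (<ᵇ⁻ eq) (cnt-mono λ y e → <ᵇ⁺ (<-≤-trans large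
              (cnt-mono λ z f → P⁺ (∧⁻ʳ {N W v y} e)
                (tr y v z (∧⁻ˡ {W y} (∧⁻ˡ e)) Wv (∧⁻ˡ {W z} (∧⁻ˡ f)) (E-sym⁻ (∧⁻ʳ {W y} (∧⁻ˡ e))) (∧⁻ʳ {W z} (∧⁻ˡ f)))
                (not⁻ (∧⁻ʳ {N W v z} f)))))) (lopsided Bx)

      minority-rows : ∀ v x {y z} → minority v x y ≡ false → minority v x z ≡ false → E x y ≡ E x z
      minority-rows v x {y} {z} p q with k <ᵇ cnt (λ z → N W v z ∧ E x z)
      ... | false = trans p (sym q)
      ... | true  = not-injective (trans p (sym q))

      odd : Fin n → Pred n
      odd v y = N W v y ∧ some (λ x → (B ∖ W) x ∧ minority v x y)

      odd-few : ∀ {v} → W v ≡ true → cnt (odd v) ≤ k * k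
      odd-few {v} Wv = ≤-trans (cnt-⋃ (B ∖ W) (λ x y → N W v y ∧ minority v x y)
        (λ y e → let x , f = some⁻ _ (∧⁻ʳ {N W v y} e) in
                 x , ∧⁻ˡ f , ∧⁻ˡ e ∧⁺ ∧⁻ʳ {(B ∖ W) x} f)
        (λ x e → minority-small Wv x (∧⁻ˡ e))) (*-monoˡ-≤ k few)

      -- Clique vertices outside `odd` have equal rows: on `W` because they share a clique, and on
      -- each deleted vertex because they are on its majority side. So any one of them represents
      -- the class of all but k² vertices.
      centre : ∀ {v} → W v ≡ true → k * k < deg W v →
               ∃[ c ] N W v c ≡ true × cnt (N W v ∖ tw B c) ≤ k * k
      centre {v} Wv h with cnt-< (N W v) (odd v) (≤-<-trans (odd-few Wv) h)
      ... | c , Nc , ¬oc = c , Nc , ≤-trans (cnt-mono {q = odd v} sub) (odd-few Wv)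
        where
        majority : ∀ {y x} → N W v y ≡ true → odd v y ≡ false → (B ∖ W) x ≡ true → minority v x y ≡ false
        majority {y} {x} Ny ¬oy Xx = ≢true λ m → true≢false
          (Ny ∧⁺ some⁺ (λ x → (B ∖ W) x ∧ minority v x y) x (Xx ∧⁺ m)) ¬oy
        sub : ∀ y → (N W v ∖ tw B c) y ≡ true → odd v y ≡ true
        sub y e = ≢false λ ¬oy → true≢false (tw⁺ (W⊆B c Wc) (W⊆B y Wy) (row ¬oy)) (not⁻ (∧⁻ʳ {N W v y} e))
          where
          Wc = ∧⁻ˡ {W c} Nc
          vc = ∧⁻ʳ {W c} Nc
          Ny = ∧⁻ˡ {N W v y} e
          Wy = ∧⁻ˡ {W y} Ny
          vy = ∧⁻ʳ {W y} Ny
          row : odd v y ≡ false → ∀ l → B l ≡ true → E c l ≡ E y l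
          row ¬oy l Bl with bool-cases (W l)
          ... | inj₁ Wl = iff⇒≡
            (λ cl → tr y c l Wy Wc Wl (tr y v c Wy Wv Wc (E-sym⁻ vy) vc) cl)
            (λ yl → tr c y l Wc Wy Wl (tr c v y Wc Wv Wy (E-sym⁻ vc) vy) yl)
          ... | inj₂ ¬Wl = trans (E-sym c l) (trans
            (minority-rows v l (majority Nc ¬oc (Bl ∧⁺ not⁺ ¬Wl)) (majority Ny ¬oy (Bl ∧⁺ not⁺ ¬Wl))) (E-sym l y))

      module _ (keeps : ∀ x → B x ≡ true → trimmed x ≡ true → W x ≡ true) where

        -- A trimmed `y` of the clique outside the class of `c` has a class of more than `τ`
        -- members, but only k deleted vertices and k² exceptional clique vertices could make it up.
        -- Conversely, trimmed twins of `c` are kept, hence in the clique.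
        trimmed-centre : ∀ {v} → W v ≡ true → k * k < deg W v →
                         ∃[ c ] cnt (N W v ∖ tw B c) ≤ k * k × cnt (N W v ∩ trimmed) ≡ removed c
        trimmed-centre {v} Wv h with centre Wv h
        ... | c , Nc , odd-few = c , odd-few , cnt-cong λ y → iff⇒≡
          (λ e → twin y (∧⁻ˡ e) (∧⁻ʳ {N W v y} e) ∧⁺ ∧⁻ʳ {N W v y} e)
          (λ e → (keeps y (tw-∈ʳ {c} (∧⁻ˡ {tw B c y} e)) (∧⁻ʳ {tw B c y} e) ∧⁺ near y e) ∧⁺ ∧⁻ʳ {tw B c y} e)
          where
          Wc = ∧⁻ˡ {W c} Nc
          vc = ∧⁻ʳ {W c} Nc
          near : ∀ y → tw B c y ∧ trimmed y ≡ true → E v y ≡ true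
          near y e = tr v c y Wv Wc (keeps y (tw-∈ʳ {c} (∧⁻ˡ e)) (∧⁻ʳ {tw B c y} e)) vc (tw-E (∧⁻ˡ e))
          twin : ∀ y → N W v y ≡ true → trimmed y ≡ true → tw B c y ≡ true
          twin y Ny ty = ≢false λ ¬cy → <⇒≱ (clsRank<cls By) (begin
            cls B y                                ≤⟨ cnt-∪ (λ z yz → cover ¬cy z yz) ⟩
            cnt (B ∖ W) + cnt (N W v ∖ tw B c)     ≤⟨ +-mono-≤ few odd-few ⟩
            k + k * k                              ≡⟨ +-comm k _ ⟩
            k * k + k                              ≡⟨ cong (_+ k) k²≡ ⟨
            τ                                      ≤⟨ trimmed-rank ty ⟩
            clsRank y                              ∎)
            where
            open ≤-Reasoning
            Wy = ∧⁻ˡ {W y} Ny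
            By = W⊆B y Wy
            cover : tw B c y ≡ false → ∀ z → tw B y z ≡ true → (B ∖ W) z ≡ true ⊎ (N W v ∖ tw B c) z ≡ true
            cover ¬cy z yz with bool-cases (W z)
            ... | inj₂ ¬Wz = inj₁ (tw-∈ʳ yz ∧⁺ not⁺ ¬Wz)
            ... | inj₁ Wz = inj₂ ((Wz ∧⁺ tr v y z Wv Wy Wz (∧⁻ʳ {W y} Ny) (tw-E yz)) ∧⁺
              not⁺ (≢true λ cz → true≢false (tw-trans cz (tw-sym yz)) ¬cy))

        private
          k²<L : ∀ {d} → L ≤ k + d → k * k < d
          k²<L {d} h = +-cancelˡ-≤ k _ _ (begin
            k + suc (k * k)       ≡⟨ +-suc k (k * k) ⟩
            suc (k + k * k)       ≡⟨ cong suc (+-comm k _) ⟩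
            suc (k * k + k)       ≡⟨ cong (λ x → suc (x + k)) k²≡ ⟨
            suc τ                 ≤⟨ s≤s (m≤m+n τ τ) ⟩
            L                     ≤⟨ h ⟩
            k + d                 ∎)
            where open ≤-Reasoning

        deg-split : ∀ v → deg W v ≡ cnt (N W v ∩ trimmed) + cnt (N W v ∖ trimmed)
        deg-split v = cnt-split (N W v) trimmed

        -- If the class of `c` had fewer than `τ + t` members, at most `τ` of them would be
        -- untrimmed, and with the k² others the right-hand side of the hypothesis would be at most
        -- k + `τ` + k² = 2 `τ` < `L`.
        trims-t : ∀ {v} → W v ≡ true → L ≤ k + cnt (N W v ∖ trimmed) → cnt (N W v ∩ trimmed) ≡ t
        trims-t {v} Wv h with trimmed-centre Wv (k²<L (≤-trans h
                                (+-monoʳ-≤ k (≤-trans (m≤n+m _ _) (≤-reflexive (sym (deg-split v)))))))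
        ... | c , odd-few , eq = trans eq (removed-all (≮⇒≥ λ small → <-irrefl refl (begin-strict
          τ + τ                                                  <⟨ ≤-refl ⟩
          L                                                      ≤⟨ h ⟩
          k + cnt (N W v ∖ trimmed)                              ≤⟨ +-monoʳ-≤ k (cnt-∪ cover) ⟩
          k + (cnt (tw B c ∖ trimmed) + cnt (N W v ∖ tw B c))    ≤⟨ +-monoʳ-≤ k (+-mono-≤ (kept≤τ (<⇒≤ small)) odd-few) ⟩
          k + (τ + k * k)                                        ≡⟨ cong (k +_) (+-comm τ _) ⟩
          k + (k * k + τ)                                        ≡⟨ +-assoc k _ _ ⟨
          k + k * k + τ                                          ≡⟨ cong (_+ τ) (+-comm k _) ⟩
          k * k + k + τ                                          ≡⟨ cong (λ x → x + k + τ) k²≡ ⟨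
          τ + τ                                                  ∎)))
          where
          open ≤-Reasoning
          cover : ∀ y → (N W v ∖ trimmed) y ≡ true →
                  (tw B c ∖ trimmed) y ≡ true ⊎ (N W v ∖ tw B c) y ≡ true
          cover y e with bool-cases (tw B c y)
          ... | inj₁ cy  = inj₁ (cy ∧⁺ ∧⁻ʳ {N W v y} e)
          ... | inj₂ ¬cy = inj₂ (∧⁻ˡ e ∧⁺ not⁺ ¬cy)

        -- The version for sizes before trimming: at most `t` vertices of the clique are trimmed, so
        -- the bound after trimming follows. Shrinking knows the sizes before, unshrinking those
        -- after.
        trims-t′ : ∀ {v} → W v ≡ true → L + t ≤ k + deg W v → cnt (N W v ∩ trimmed) ≡ t
        trims-t′ {v} Wv h with trimmed-centre Wv (k²<L (≤-trans (m≤m+n L t) h))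
        ... | c , _ , eq = trims-t Wv (+-cancelʳ-≤ t _ _ (begin
          L + t                                                     ≤⟨ h ⟩
          k + deg W v                                               ≡⟨ cong (k +_) (deg-split v) ⟩
          k + (cnt (N W v ∩ trimmed) + cnt (N W v ∖ trimmed))       ≤⟨ +-monoʳ-≤ k (+-monoˡ-≤ _ (≤-trans (≤-reflexive eq) (removed≤t c))) ⟩
          k + (t + cnt (N W v ∖ trimmed))                           ≡⟨ cong (k +_) (+-comm t _) ⟩
          k + (cnt (N W v ∖ trimmed) + t)                           ≡⟨ +-assoc k _ t ⟨
          k + cnt (N W v ∖ trimmed) + t                             ∎))
          where open ≤-Reasoning

    lacking : Pred n → Pred n
    lacking W v = B v ∧ trimmed v ∧ not (W v)

    -- Transposing twins is an automorphism of the graph on `B`. A trimmed deleted `u` has `τ` = k²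
    -- + k > k twins of rank below `τ`, so one of them is kept; it is not trimmed, and swapping it
    -- with `u` lowers the number of trimmed deleted vertices.
    exchange : 0 < k → ∀ {b W} → b ≤ k → Solves B b W → 0 < cnt (lacking W) →
               ∃[ W′ ] Solves B b W′ × cnt (lacking W′) < cnt (lacking W)
    exchange k>0 {b} {W} b≤k sol h with cnt-∃ (lacking W) h
    ... | u , lu with cnt-< (low u) (B ∖ W) (begin-strict
            cnt (B ∖ W) ≤⟨ Solves.cost sol ⟩
            b           ≤⟨ b≤k ⟩
            k           <⟨ m<n+m k (≤-trans (*-mono-< k>0 k>0) (≤-reflexive (sym k²≡))) ⟩
            τ           ≡⟨ low-τ {u} (∧⁻ˡ lu) (∧⁻ˡ {trimmed u} (∧⁻ʳ {B u} lu)) ⟨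
            cnt (low u) ∎)
      where open ≤-Reasoning
    ...   | v , e , ¬Xv = W ∘ σ , sol′ , fewer
      where
      open Solves sol
      Bu = ∧⁻ˡ {B u} lu
      tu = ∧⁻ˡ {trimmed u} (∧⁻ʳ {B u} lu)
      ¬Wu = not⁻ (∧⁻ʳ {trimmed u} (∧⁻ʳ {B u} lu))
      uv = ∧⁻ˡ {tw B u v} e
      Bv = tw-∈ʳ uv
      ¬tv = low-¬trimmed (∧⁻ʳ {tw B u v} e)
      Wv : W v ≡ true
      Wv = ≢false λ ¬Wv → true≢false (Bv ∧⁺ not⁺ ¬Wv) ¬Xv
      σ : Fin n → Fin n
      σ = transpose u v ⟨$⟩ʳ_
      σ-tw : ∀ z → B z ≡ true → tw B z (σ z) ≡ true
      σ-tw z Bz with transpose-cases u v z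
      ... | inj₁ (refl , e)        rewrite e = uv
      ... | inj₂ (inj₁ (refl , e)) rewrite e = tw-sym uv
      ... | inj₂ (inj₂ e)          rewrite e = tw-refl Bz
      B-σ : ∀ z → B (σ z) ≡ B z
      B-σ z with transpose-cases u v z
      ... | inj₁ (refl , e)        rewrite e = trans Bv (sym Bu)
      ... | inj₂ (inj₁ (refl , e)) rewrite e = trans Bu (sym Bv)
      ... | inj₂ (inj₂ e)          rewrite e = refl
      in-B : ∀ z → W (σ z) ≡ true → B z ≡ true
      in-B z h = trans (sym (B-σ z)) (inside (σ z) h)
      E-σ : ∀ {y z} → W (σ y) ≡ true → W (σ z) ≡ true → E y z ≡ E (σ y) (σ z)
      E-σ {y} {z} hy hz = tw-E₂ (σ-tw y (in-B y hy)) (σ-tw z (in-B z hz))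
      sol′ : Solves B b (W ∘ σ)
      sol′ = record
        { inside     = in-B
        ; cost       = ≤-trans (≤-reflexive (trans
            (cnt-cong λ z → cong (_∧ not (W (σ z))) (sym (B-σ z)))
            (sym (cnt-transpose (B ∖ W) u v)))) cost
        ; transitive = λ x y z hx hy hz xy yz → trans (E-σ hx hz) (transitive (σ x) (σ y) (σ z) hx hy hz
            (trans (sym (E-σ hx hy)) xy) (trans (sym (E-σ hy hz)) yz))
        ; cliqueSize = cliqueSize
        ; regular    = λ y hy → trans
            (trans (cnt-cong λ z → row y hy z) (sym (cnt-transpose (N W (σ y)) u v)))
            (regular (σ y) hy)
        }
        where
        row : ∀ y → W (σ y) ≡ true → ∀ z → W (σ z) ∧ E y z ≡ W (σ z) ∧ E (σ y) (σ z)
        row y hy z with W (σ z) in hz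
        ... | true  = E-σ hy hz
        ... | false = refl
      sub : lacking (W ∘ σ) ⊆ lacking W
      sub z h with transpose-cases u v z
      ... | inj₁ (refl , e)        = ⊥-elim (true≢false (trans (cong W e) Wv) (not⁻ (∧⁻ʳ {trimmed u} (∧⁻ʳ {B u} h))))
      ... | inj₂ (inj₁ (refl , e)) = ⊥-elim (true≢false (∧⁻ˡ {trimmed v} (∧⁻ʳ {B v} h)) ¬tv)
      ... | inj₂ (inj₂ e)          = subst (λ y → B z ∧ trimmed z ∧ not (W y) ≡ true) e h
      fewer : cnt (lacking (W ∘ σ)) < cnt (lacking W)
      fewer = ≰⇒> λ g → true≢false
        (trans (cong W (transpose-ˡ u v)) Wv)
        (not⁻ (∧⁻ʳ {trimmed u} (∧⁻ʳ {B u} (⊆-cnt-≥ _ _ sub g u lu))))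

    normalise : 0 < k → ∀ {b W} → b ≤ k → Solves B b W →
                ∃[ W′ ] Solves B b W′ × (∀ x → B x ≡ true → trimmed x ≡ true → W′ x ≡ true)
    normalise k>0 {b} {W} b≤k sol = go (cnt (lacking W)) sol ≤-refl
      where
      go : ∀ m {W} → Solves B b W → cnt (lacking W) ≤ m →
           ∃[ W′ ] Solves B b W′ × (∀ x → B x ≡ true → trimmed x ≡ true → W′ x ≡ true)
      go m {W} sol h with cnt (lacking W) in eq
      go m {W} sol h | zero = W , sol , λ x Bx tx → ≢false λ ¬Wx →
        <⇒≱ (cnt-∋ {p = lacking W} x (Bx ∧⁺ tx ∧⁺ not⁺ ¬Wx)) (≤-reflexive eq)
      go (suc m) {W} sol h | suc l with exchange k>0 b≤k sol (≤-trans (s≤s z≤n) (≤-reflexive (sym eq)))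
      ... | W′ , sol′ , lt = go m sol′ (≤-trans (s≤s⁻¹ (≤-trans lt (≤-reflexive eq))) (s≤s⁻¹ h))

    k<L : k < L
    k<L = s≤s (≤-trans (m≤n+m k k²) (m≤m+n τ τ))

    shrink : 0 < k → ∀ {b W} → b ≤ k → Solves B b W → ∃[ W′ ] Solves K b W′
    shrink k>0 {b} b≤k sol₀ with normalise k>0 b≤k sol₀
    ... | W , sol , keeps = W ∩ K , record
      { inside     = λ v h → ∧⁻ʳ {W v} h
      ; cost       = ≤-trans (cnt-mono λ v h → K⊆B v (∧⁻ˡ h) ∧⁺ not⁺ (≢true λ Wv →
                       true≢false (Wv ∧⁺ ∧⁻ˡ h) (not⁻ (∧⁻ʳ {K v} h)))) cost
      ; transitive = λ u v w hu hv hw → transitive u v w (∧⁻ˡ hu) (∧⁻ˡ hv) (∧⁻ˡ hw)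
      ; cliqueSize = cliqueSize ∸ t
      ; regular    = λ v h → sym (trans (cong₂ _∸_ (trans (sym (regular v (∧⁻ˡ h))) (deg-split inside few transitive keeps v))
                                                   (sym (trims v (∧⁻ˡ h))))
                       (trans (m+n∸m≡n (cnt (N W v ∩ trimmed)) _) (cnt-cong λ l → iff⇒≡
          (λ e → (∧⁻ˡ {W l} (∧⁻ˡ e) ∧⁺ K⁺ (inside l (∧⁻ˡ (∧⁻ˡ e))) (not⁻ (∧⁻ʳ {N W v l} e))) ∧⁺ ∧⁻ʳ {W l} (∧⁻ˡ e))
          (λ e → (∧⁻ˡ {W l} (∧⁻ˡ {(W ∩ K) l} e) ∧⁺ ∧⁻ʳ {(W ∩ K) l} e) ∧⁺
                 not⁺ (K-¬trimmed (∧⁻ʳ {W l} (∧⁻ˡ {(W ∩ K) l} e)))))))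
      }
      where
      open Solves sol
      few : cnt (B ∖ W) ≤ k
      few = ≤-trans cost b≤k
      trims : ∀ v → W v ≡ true → cnt (N W v ∩ trimmed) ≡ t
      -- If anything is trimmed, the largest class has `L + t` members, and all but k of them lie in
      -- the clique of a kept one, `c`. By regularity the clique of `v` is as large.
      trims v Wv with t ≟ 0
      ... | yes t≡0 = trans (cnt-none λ y → ≢true λ e → true≢false (∧⁻ʳ {N W v y} e) (no-trim t≡0 y)) (sym t≡0)
      ... | no  t≢0 with largest-class (n≢0⇒n>0 t≢0)
      ...   | u , large with cnt-< (tw B u) (B ∖ W) (≤-<-trans few (<-≤-trans k<L (≤-trans (m≤m+n L t) large)))
      ...     | c , uc , ¬Xc = trims-t′ inside few transitive keeps Wv (begin
        L + t                                ≤⟨ large ⟩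
        cls B u                              ≤⟨ cnt-∪ cover ⟩
        cnt (B ∖ W) + deg W c                ≤⟨ +-mono-≤ few (≤-reflexive (trans (regular c Wc) (sym (regular v Wv)))) ⟩
        k + deg W v                          ∎)
        where
        open ≤-Reasoning
        Wc : W c ≡ true
        Wc = ≢false λ ¬Wc → true≢false (tw-∈ʳ uc ∧⁺ not⁺ ¬Wc) ¬Xc
        cover : ∀ z → tw B u z ≡ true → (B ∖ W) z ≡ true ⊎ N W c z ≡ true
        cover z uz with bool-cases (W z)
        ... | inj₁ Wz  = inj₂ (Wz ∧⁺ tw-E (tw-trans (tw-sym uc) uz))
        ... | inj₂ ¬Wz = inj₁ (tw-∈ʳ uz ∧⁺ not⁺ ¬Wz)

    -- Restoring the trimmed vertices costs nothing. Each has an untrimmed twin in `W`, since the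
    -- `τ` > k lowest members of its class lie in `K`; adjacency and degrees are read off at these
    -- twins.
    unshrink : 0 < k → ∀ {b W} → b ≤ k → Solves K b W → ∃[ W′ ] Solves B b W′
    unshrink k>0 {b} {W} b≤k sol = W⁺ , record
      { inside     = W⁺⊆B
      ; cost       = cost⁺
      ; transitive = tr
      ; cliqueSize = t + cliqueSize
      ; regular    = reg
      }
      where
      open Solves sol
      W⁺ : Pred n
      W⁺ v = W v ∨ (B v ∧ trimmed v)
      W⁺⊆B : W⁺ ⊆ B
      W⁺⊆B v h with ∨⁻ {W v} h
      ... | inj₁ Wv = K⊆B v (inside v Wv)
      ... | inj₂ e  = ∧⁻ˡ e
      B∖W⁺ : (B ∖ W⁺) ⊆ (K ∖ W)
      B∖W⁺ v e = K⁺ Bv (≢true λ tv → true≢false (∨⁺ʳ {W v} (Bv ∧⁺ tv)) ¬W⁺) ∧⁺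
                 not⁺ (≢true λ Wv → true≢false (∨⁺ˡ Wv) ¬W⁺)
        where
        Bv = ∧⁻ˡ {B v} e
        ¬W⁺ = not⁻ (∧⁻ʳ {B v} e)
      cost⁺ : cnt (B ∖ W⁺) ≤ b
      cost⁺ = ≤-trans (cnt-mono B∖W⁺) cost
      W-¬trimmed : ∀ {v} → W v ≡ true → trimmed v ≡ false
      W-¬trimmed {v} Wv = K-¬trimmed (inside v Wv)
      twin : ∀ v → W⁺ v ≡ true → ∃[ c ] tw B v c ≡ true × W c ≡ true
      twin v h with ∨⁻ {W v} h
      ... | inj₁ Wv = v , tw-refl (W⁺⊆B v h) , Wv
      ... | inj₂ e with cnt-< (low v) (K ∖ W) (≤-<-trans (≤-trans cost b≤k) (begin-strict
              k           <⟨ m<n+m k (≤-trans (*-mono-< k>0 k>0) (≤-reflexive (sym k²≡))) ⟩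
              τ           ≡⟨ low-τ {v} (∧⁻ˡ e) (∧⁻ʳ {B v} e) ⟨
              cnt (low v) ∎))
        where open ≤-Reasoning
      ...   | c , f , ¬Xc = c , ∧⁻ˡ f , ≢false λ ¬Wc → true≢false
        (K⁺ (tw-∈ʳ {v} (∧⁻ˡ f)) (low-¬trimmed (∧⁻ʳ {tw B v c} f)) ∧⁺ not⁺ ¬Wc) ¬Xc
      tr : Transitive W⁺
      tr x y z hx hy hz xy yz with twin x hx | twin y hy | twin z hz
      ... | x′ , xx , Wx | y′ , yy , Wy | z′ , zz , Wz = trans (tw-E₂ xx zz)
        (transitive x′ y′ z′ Wx Wy Wz (trans (sym (tw-E₂ xx yy)) xy) (trans (sym (tw-E₂ yy zz)) yz))
      few : cnt (B ∖ W⁺) ≤ k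
      few = ≤-trans cost⁺ b≤k
      keeps : ∀ x → B x ≡ true → trimmed x ≡ true → W⁺ x ≡ true
      keeps x Bx tx = ∨⁺ʳ {W x} (Bx ∧⁺ tx)
      untrimmed : ∀ v → cnt (N W⁺ v ∖ trimmed) ≡ deg W v
      untrimmed v = cnt-cong λ l → iff⇒≡
        (λ e → orig l (∧⁻ˡ (∧⁻ˡ {N W⁺ v l} e)) (not⁻ (∧⁻ʳ {N W⁺ v l} e)) ∧⁺ ∧⁻ʳ {W⁺ l} (∧⁻ˡ e))
        (λ e → (∨⁺ˡ {W l} (∧⁻ˡ e) ∧⁺ ∧⁻ʳ {W l} e) ∧⁺ not⁺ (W-¬trimmed (∧⁻ˡ e)))
        where
        orig : ∀ l → W⁺ l ≡ true → trimmed l ≡ false → W l ≡ true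
        orig l h ¬t with ∨⁻ {W l} h
        ... | inj₁ Wl = Wl
        ... | inj₂ e  = ⊥-elim (true≢false (∧⁻ʳ {B l} e) ¬t)
      trims : ∀ v → W v ≡ true → cnt (N W⁺ v ∩ trimmed) ≡ t
      -- Only sizes after trimming are known here: the largest class has `L` untrimmed members, all
      -- but k of them in one clique of `W`, and all cliques of `W` are equally large.
      trims v Wv with t ≟ 0
      ... | yes t≡0 = trans (cnt-none λ y → ≢true λ e → true≢false (∧⁻ʳ {N W⁺ v y} e) (no-trim t≡0 y)) (sym t≡0)
      ... | no  t≢0 with largest-class (n≢0⇒n>0 t≢0)
      ...   | u , large = trims-t W⁺⊆B few tr keeps (∨⁺ˡ Wv)
        (≤-trans L≤ (+-monoʳ-≤ k (≤-reflexive (trans same (sym (untrimmed v))))))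
        where
        open ≤-Reasoning
        L≤kept : L ≤ cnt (tw B u ∖ trimmed)
        L≤kept = +-cancelʳ-≤ t _ _ (begin
          L + t                              ≤⟨ large ⟩
          cls B u                            ≡⟨ cls-split u ⟩
          removed u + cnt (tw B u ∖ trimmed) ≤⟨ +-monoˡ-≤ _ (removed≤t u) ⟩
          t + cnt (tw B u ∖ trimmed)         ≡⟨ +-comm t _ ⟩
          cnt (tw B u ∖ trimmed) + t         ∎)
        in-W : ∀ z → (tw B u ∖ trimmed) z ≡ true → (K ∖ W) z ≡ false → W z ≡ true
        in-W z e ¬X = ≢false λ ¬Wz → true≢false
          (K⁺ (tw-∈ʳ {u} (∧⁻ˡ e)) (not⁻ (∧⁻ʳ {tw B u z} e)) ∧⁺ not⁺ ¬Wz) ¬X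
        rep : ∃[ c ] (tw B u ∖ trimmed) c ≡ true × (K ∖ W) c ≡ false
        rep = cnt-< (tw B u ∖ trimmed) (K ∖ W) (≤-<-trans (≤-trans cost b≤k) (<-≤-trans k<L L≤kept))
        c = proj₁ rep
        uc : tw B u c ≡ true
        uc = ∧⁻ˡ (proj₁ (proj₂ rep))
        Wc : W c ≡ true
        Wc = in-W c (proj₁ (proj₂ rep)) (proj₂ (proj₂ rep))
        same : deg W c ≡ deg W v
        same = trans (regular c Wc) (sym (regular v Wv))
        cover : ∀ z → (tw B u ∖ trimmed) z ≡ true → (K ∖ W) z ≡ true ⊎ N W c z ≡ true
        cover z e with bool-cases ((K ∖ W) z)
        ... | inj₁ X  = inj₁ X
        ... | inj₂ ¬X = inj₂ (in-W z e ¬X ∧⁺ tw-E (tw-trans (tw-sym uc) (∧⁻ˡ e)))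
        L≤ : L ≤ k + deg W c
        L≤ = begin
          L                          ≤⟨ L≤kept ⟩
          cnt (tw B u ∖ trimmed)     ≤⟨ cnt-∪ cover ⟩
          cnt (K ∖ W) + deg W c      ≤⟨ +-monoˡ-≤ _ (≤-trans cost b≤k) ⟩
          k + deg W c                ∎
      reg : ∀ v → W⁺ v ≡ true → deg W⁺ v ≡ t + cliqueSize
      reg v h with twin v h
      ... | c , vc , Wc = begin
        deg W⁺ v                                                ≡⟨ tw-deg vc W⁺⊆B ⟩
        deg W⁺ c                                                ≡⟨ deg-split W⁺⊆B few tr keeps c ⟩
        cnt (N W⁺ c ∩ trimmed) + cnt (N W⁺ c ∖ trimmed)         ≡⟨ cong₂ _+_ (trims c Wc) (trans (untrimmed c) (regular c Wc)) ⟩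
        t + cliqueSize                                          ∎
        where open ≡-Reasoning

-- The number of remaining vertices

module Reduction {n : ℕ} (E : Fin n → Fin n → Bool)
                 (E-refl : ∀ v → E v v ≡ true) (E-sym : ∀ u v → E u v ≡ E v u)
                 (k k² : ℕ) (k²≡ : k² ≡ k * k) where

  open Forced E E-refl E-sym k k² k²≡ public
  open Thin E E-refl E-sym k A public
  open Shrink E E-refl E-sym k k² k²≡ B public

  B⊆A₀ : B ⊆ A₀
  B⊆A₀ v h = A⊆A₀ v (B⊆A v h)

  -- Allows the bound to be taken from a member of `p`, typically from the size of its twin class.
  cnt-by-member : ∀ {m b} (p : Pred m) → (∀ v → p v ≡ true → cnt p ≤ b) → cnt p ≤ b
  cnt-by-member p h with cnt p in eq
  ... | zero  = z≤n
  ... | suc _ = let v , pv = cnt-∃ p (≤-trans (s≤s z≤n) (≤-reflexive (sym eq))) in h v pv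

  module _ {W : Pred n} (sol : Solves full k W) where
    open Solves sol

    X₀ : Pred n
    X₀ = A₀ ∖ W

    X₀-few : cnt X₀ ≤ k
    X₀-few = cost₀ sol

    suspect : Pred n
    suspect v = some λ x → X₀ x ∧ (hard x v ∨ linked x v)

    suspect-few : cnt suspect ≤ k * (k + (k * k + k))
    suspect-few = ≤-trans (cnt-⋃ X₀ (λ x v → hard x v ∨ linked x v)
      (λ v h → let x , e = some⁻ _ h in x , ∧⁻ e)
      (λ x h → ≤-trans (cnt-∪ {q = hard x} {r = linked x} λ v → ∨⁻)
        (+-mono-≤ (A₀-hardDeg (∧⁻ˡ h)) (A₀-linkDeg (∧⁻ˡ h)))))
      (*-monoˡ-≤ _ X₀-few)

    easy : Pred n
    easy v = W v ∧ not (suspect v)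

    suspect⁺ : ∀ {x v} → X₀ x ≡ true → hard x v ∨ linked x v ≡ true → suspect v ≡ true
    suspect⁺ {x} h e = some⁺ _ x (h ∧⁺ e)

    easy-¬hard : ∀ {v y} → easy v ≡ true → A₀ y ≡ true → hard v y ≡ false
    easy-¬hard {v} {y} h Ay = ≢true λ vy → true≢false
      (suspect⁺ (Ay ∧⁺ not⁺ (hard-hit sol vy (∧⁻ˡ h))) (∨⁺ˡ (trans (hard-sym y v) vy)))
      (not⁻ (∧⁻ʳ {W v} h))

    -- `W` contains no P₃, so `a` or `b` is deleted. An easy `v` is in no hard pair; if `a` and `b`
    -- were not one either, the P₃ would link `v` to a deleted vertex and make it suspect.
    easy-P : ∀ {v a b} → easy v ≡ true → A₀ a ≡ true → A₀ b ≡ true → P v a b ≡ true → hard a b ≡ true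
    easy-P {v} {a} {b} h Aa Ab p = ≢false λ ¬ab → contra ¬ab
      where
      Wv = ∧⁻ˡ {W v} h
      via : ∀ {x y} → A₀ x ≡ true → A₀ y ≡ true → W x ≡ false → P v x y ≡ true → hard x y ≡ false → ⊥
      via {x} {y} Ax Ay ¬Wx q ¬xy = true≢false
        (suspect⁺ (Ax ∧⁺ not⁺ ¬Wx) (∨⁺ʳ {hard x v} (some⁺ (easyP x v) y
          (P-swapˡ⁺ q ∧⁺ not⁺ (trans (hard-sym x v) (easy-¬hard h Ax)) ∧⁺ not⁺ ¬xy ∧⁺ not⁺ (easy-¬hard h Ay)))))
        (not⁻ (∧⁻ʳ {W v} h))
      contra : hard a b ≡ false → ⊥
      contra ¬ab with bool-cases (W a) | bool-cases (W b)
      ... | inj₂ ¬Wa | _        = via Aa Ab ¬Wa p ¬ab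
      ... | inj₁ _   | inj₂ ¬Wb = via Ab Aa ¬Wb (P-swapʳ⁺ p) (trans (hard-sym b a) ¬ab)
      ... | inj₁ Wa  | inj₁ Wb  = transitive⇒¬P transitive Wv Wa Wb p

    easy-A₀ : ∀ {v} → easy v ≡ true → A₀ v ≡ true
    easy-A₀ h = W⊆A₀ sol _ (∧⁻ˡ h)

    -- An easy vertex is in no hard pair, while the other two vertices of each of its P₃ form one.
    -- Hence no P₃ contains two easy vertices, and easy vertices with a common neighbour are
    -- adjacent twins.
    easy-twins : ∀ {s u v} → A₀ s ≡ true → easy u ≡ true → easy v ≡ true →
                 E s u ≡ true → E s v ≡ true → tw A₀ u v ≡ true
    easy-twins {s} {u} {v} As hu hv su sv = tw⁺ Au Av λ l Al → iff⇒≡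
      (λ ul → ≢false λ vl → true≢false (easy-P hu Av Al (P-swapˡ⁺ (P⁺ (E-sym⁻ uv) ul vl))) (easy-¬hard hv Al))
      (λ vl → ≢false λ ul → true≢false (easy-P hu Av Al (P⁺ uv vl ul)) (easy-¬hard hv Al))
      where
      Au = easy-A₀ hu
      Av = easy-A₀ hv
      uv : E u v ≡ true
      uv = ≢false λ ¬uv → true≢false (easy-P hu As Av (P⁺ (E-sym⁻ su) sv ¬uv))
        (trans (hard-sym s v) (easy-¬hard hv As))

    smallAt : Fin n → Pred n
    smallAt s v = easy v ∧ not (big v) ∧ E s v

    smallAt-few : ∀ {s} → A₀ s ≡ true → cnt (smallAt s) ≤ k
    smallAt-few {s} As = cnt-by-member (smallAt s) λ v h → ≤-trans
      (cnt-mono {q = tw A₀ v} λ w g → easy-twins As (∧⁻ˡ h) (∧⁻ˡ g)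
        (∧⁻ʳ {not (big v)} (∧⁻ʳ {easy v} h)) (∧⁻ʳ {not (big w)} (∧⁻ʳ {easy w} g)))
      (≮ᵇ⁻ (not⁻ (∧⁻ˡ (∧⁻ʳ {easy v} h))))

    hardTo : Fin n → Pred n
    hardTo x v = some λ s → (A₀ s ∧ hard x s) ∧ smallAt s v

    -- The centres are the at most k deleted vertices of `A₀` and their at most k² hard partners;
    -- the easy vertices of small classes at one centre are all twins, so at most k.
    touched : Pred n
    touched v = some λ x → X₀ x ∧ (smallAt x v ∨ hardTo x v)

    touched-few : cnt touched ≤ k * (k + k * k)
    touched-few = ≤-trans (cnt-⋃ X₀ (λ x v → smallAt x v ∨ hardTo x v)
      (λ v h → let x , e = some⁻ _ h in x , ∧⁻ e)
      (λ x h → ≤-trans (cnt-∪ {q = smallAt x} {r = hardTo x} λ v → ∨⁻)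
        (+-mono-≤ (smallAt-few (∧⁻ˡ h)) (≤-trans
          (cnt-⋃ (λ s → A₀ s ∧ hard x s) smallAt (λ v e → let s , f = some⁻ _ e in s , ∧⁻ f)
            (λ s e → smallAt-few (∧⁻ˡ e)))
          (*-monoˡ-≤ k (≤-trans (cnt-mono λ s e → ∧⁻ʳ {A₀ s} e) (A₀-hardDeg (∧⁻ˡ h))))))))
      (*-monoˡ-≤ _ X₀-few)

    inLeaderClique : ℕ → Pred n
    inLeaderClique m v = some λ l → first-leaders m l ∧ N A l v

    -- The index is the clique size: a clique of twins that is not big has at most k vertices.
    untouched : Pred n
    untouched v = some λ (m : Fin (suc k)) → inLeaderClique (toℕ m) v

    untouched-few : cnt untouched ≤ suc k * (suc k * k)
    untouched-few = ≤-trans (cnt-⋃ (λ _ → true) (λ m → inLeaderClique (toℕ m))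
      (λ v h → let m , e = some⁻ _ h in m , refl , e)
      (λ m _ → ≤-trans (cnt-⋃ (first-leaders (toℕ m)) (N A)
          (λ v h → let l , e = some⁻ _ h in l , ∧⁻ e)
          (λ l h → ≤-trans (≤-reflexive (≡ᵇ⁻ (∧⁻ʳ {leader l} (∧⁻ˡ h)))) (toℕ≤k m)))
        (*-monoˡ-≤ k (first-leaders≤ (toℕ m)))))
      (*-monoˡ-≤ _ (≤-reflexive (cnt-all {suc k})))
      where
      toℕ≤k : ∀ (m : Fin (suc k)) → toℕ m ≤ k
      toℕ≤k m = s≤s⁻¹ (toℕ<n m)

    bigAt : Fin n → Pred n
    bigAt s v = K v ∧ big v ∧ E s v

    -- All big vertices adjacent to `s` are twins, and trimming leaves at most `L` of a class.
    bigAt-few : ∀ {s} → A₀ s ≡ true → cnt (bigAt s) ≤ L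
    bigAt-few {s} As = cnt-by-member (bigAt s) λ v h → ≤-trans
      (cnt-mono λ w g → sub v w h g) (kept≤L v)
      where
      sub : ∀ v w → bigAt s v ≡ true → bigAt s w ≡ true → (tw B v ∖ trimmed) w ≡ true
      sub v w h g with ∧⁻ {big v} (∧⁻ʳ {K v} h) | ∧⁻ {big w} (∧⁻ʳ {K w} g)
      ... | bv , sv | bw , sw =
        Twins.tw⁺ B (K⊆B v (∧⁻ˡ h)) (K⊆B w (∧⁻ˡ g)) (λ l Bl →
          tw-row (big-disjoint As bv bw (E-sym⁻ sv) (E-sym⁻ sw)) (B⊆A₀ l Bl))
        ∧⁺ not⁺ (K-¬trimmed (∧⁻ˡ g))

    bigAt-⋃ : ∀ (S : Pred n) → S ⊆ A₀ → cnt (λ v → some λ x → S x ∧ bigAt x v) ≤ cnt S * L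
    bigAt-⋃ S S⊆A₀ = cnt-⋃ S bigAt (λ v h → let x , e = some⁻ _ h in x , ∧⁻ e) λ x h → bigAt-few (S⊆A₀ x h)

    common : Bool
    common = k <ᵇ cnt λ l → bigLeader l ∧ (deg₀ l ≡ᵇ cliqueSize)

    bigHit bigSaturated bigRare : Pred n
    bigHit v = some λ x → X₀ x ∧ bigAt x v
    bigSaturated v = some λ l → first-leaders cliqueSize l ∧ bigAt l v
    bigRare v = some λ l → bigLeader l ∧ (deg₀ l ≡ᵇ cliqueSize)
                           ∧ not common ∧ bigAt l v

    -- Since `not common` is part of `bigRare`, any member supplies the bound k on the number of
    -- leaders.
    bigRare-few : cnt bigRare ≤ k * L
    bigRare-few = cnt-by-member bigRare λ v h → let l , e = some⁻ _ h in
      ≤-trans (cnt-mono λ w f → let l , g = some⁻ _ f in some⁺ _ l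
        ((∧⁻ˡ {bigLeader l} g ∧⁺ ∧⁻ˡ {deg₀ l ≡ᵇ cliqueSize} (∧⁻ʳ {bigLeader l} g)) ∧⁺
         ∧⁻ʳ {not common} (∧⁻ʳ {deg₀ l ≡ᵇ cliqueSize} (∧⁻ʳ {bigLeader l} g))))
      (≤-trans (bigAt-⋃ (λ l → bigLeader l ∧ (deg₀ l ≡ᵇ cliqueSize)) λ l g → big⇒A₀ (bigLeader⇒big (∧⁻ˡ g)))
        (*-monoˡ-≤ L (≮ᵇ⁻ {k} {cnt λ l → bigLeader l ∧ (deg₀ l ≡ᵇ cliqueSize)} (not⁻ (∧⁻ˡ {not common} (∧⁻ʳ {deg₀ l ≡ᵇ cliqueSize} (∧⁻ʳ {bigLeader l} e)))))))

    module _ {v : Fin n} (ev : easy v ≡ true) (Bv : B v ≡ true) (¬bv : big v ≡ false) where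

      private
        Av : A v ≡ true
        Av = B⊆A v Bv

      touch : ∀ {s l} → A₀ s ≡ true → E v s ≡ true → A₀ l ≡ true → P v s l ≡ true → touched v ≡ true
      touch {s} {l} As vs Al p = [ (λ Ws → some⁺ _ l ((Al ∧⁺ not⁺ (hard-hit sol sl Ws)) ∧⁺
          ∨⁺ʳ {smallAt l v} (some⁺ _ s ((As ∧⁺ trans (hard-sym l s) sl) ∧⁺ G)))) ,
        (λ ¬Ws → some⁺ _ s ((As ∧⁺ not⁺ ¬Ws) ∧⁺ ∨⁺ˡ G)) ]′ (bool-cases (W s))
        where
        G : smallAt s v ≡ true
        G = ev ∧⁺ not⁺ ¬bv ∧⁺ E-sym⁻ vs
        sl : hard s l ≡ true
        sl = easy-P ev As Al p

      -- A neighbour `s` that is no twin differs from `v` at some `l`, and `v`, `s`, `l` form a P₃.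
      -- Then `s` and `l` are a hard pair, so one of them is deleted, and `v` is adjacent to `s` in
      -- either case.
      untwinned : ∀ {s} → A₀ s ≡ true → E v s ≡ true → tw A₀ v s ≡ false → touched v ≡ true
      untwinned {s} As vs ¬t = step (some⁻ (λ l → A₀ l ∧ not (bit (E v l) ≡ᵇ bit (E s l)))
        (≢false λ ¬d → true≢false (tw⁺ (easy-A₀ ev) As (diff⁻ A₀ {v} {s} ¬d)) ¬t))
        where
        P-diff : ∀ {l} → not (bit (E v l) ≡ᵇ bit (E s l)) ≡ true → P v s l ≡ true
        P-diff {l} d = differ (E v l) (E s l) refl refl d
          where
          differ : ∀ a b → E v l ≡ a → E s l ≡ b → not (bit a ≡ᵇ bit b) ≡ true → P v s l ≡ true
          differ true  false vl sl _ = P-swapˡ⁺ (P⁺ (E-sym⁻ vs) vl sl)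
          differ false true  vl sl _ = P⁺ vs sl vl
        step : ∃[ l ] A₀ l ∧ not (bit (E v l) ≡ᵇ bit (E s l)) ≡ true → touched v ≡ true
        step (l , f) = touch As vs (∧⁻ˡ {A₀ l} f) (P-diff (∧⁻ʳ {A₀ l} f))

      all-twins : (∀ x → A₀ x ≡ true → E v x ≡ true → tw A₀ v x ≡ true) → untouched v ≡ true
      all-twins twins =
        let l , fl , lv = isolated-first-leader
              (isolated⁺ Av λ {x} Ax vx z Az → tw-row (twins x (A⊆A₀ x Ax) vx) (A⊆A₀ z Az))
              (B-¬surplus Bv)
        in some⁺ _ (fromℕ< d<) (some⁺ _ l
             (subst (λ m → first-leaders m l ≡ true) (sym (toℕ-fromℕ< d<)) fl ∧⁺ Av ∧⁺ lv))
        where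
        d< : deg A v < suc k
        d< = s≤s (≤-trans (cnt-mono λ x e → twins x (A⊆A₀ x (∧⁻ˡ e)) (∧⁻ʳ {A x} e)) (≮ᵇ⁻ ¬bv))

      small-cover : touched v ≡ true ⊎ untouched v ≡ true
      small-cover = [ (λ h → let s , e = some⁻ _ h in
          inj₁ (untwinned {s} (∧⁻ˡ (∧⁻ˡ {N A₀ v s} e)) (∧⁻ʳ {A₀ s} (∧⁻ˡ {N A₀ v s} e)) (not⁻ (∧⁻ʳ {N A₀ v s} e)))) ,
        (λ h → inj₂ (all-twins λ x Ax vx → ≢false λ ¬t → true≢false ((Ax ∧⁺ vx) ∧⁺ not⁺ ¬t) (none⁻ _ h x))) ]′
        (bool-cases (some λ s → N A₀ v s ∧ not (tw A₀ v s)))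

    module _ {v : Fin n} (Wv : W v ≡ true) (Kv : K v ≡ true) (bv : big v ≡ true) where

      private
        Bv : B v ≡ true
        Bv = K⊆B v Kv
        Av : A v ≡ true
        Av = B⊆A v Bv

      module _ (near : ∀ x → A₀ x ≡ true → E v x ≡ true → W x ≡ true) where

        deg-size : ∀ S → S ⊆ A₀ → W ⊆ S → deg S v ≡ cliqueSize
        deg-size S S⊆A₀ W⊆S = trans (cnt-cong λ l → iff⇒≡
          (λ e → near l (S⊆A₀ l (∧⁻ˡ e)) (∧⁻ʳ {S l} e) ∧⁺ ∧⁻ʳ {S l} e)
          (λ e → W⊆S l (∧⁻ˡ e) ∧⁺ ∧⁻ʳ {W l} e)) (regular v Wv)

        -- A vertex of `A` adjacent to a neighbour of `v` but not to `v` would be excluded; so `v`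
        -- lies in an isolated clique.
        saturated-row : saturated v ≡ true → ∀ {x} → A x ≡ true → E v x ≡ true → ∀ z → A z ≡ true → E v z ≡ E x z
        saturated-row sat {x} Ax vx z Az = iff⇒≡
          (λ vz → transitive x v z Wx Wv (near z (A⊆A₀ z Az) vz) (E-sym⁻ vx) vz)
          (λ xz → ≢false λ ¬vz → true≢false
            (some⁺ _ v (some⁺ _ x (sat ∧⁺ A⊆A₀ x Ax ∧⁺ vx ∧⁺ xz ∧⁺ not⁺ ¬vz)))
            (A-¬excluded Az))
          where Wx = near x (A⊆A₀ x Ax) vx

        saturated-cover : saturated v ≡ true → bigSaturated v ≡ true
        saturated-cover sat =
          let l , fl , lv = isolated-first-leader (isolated⁺ Av (saturated-row sat)) (B-¬surplus Bv)
          in some⁺ _ l (subst (λ m → first-leaders m l ≡ true) (deg-size A A⊆A₀ (W⊆A sol)) fl ∧⁺ Kv ∧⁺ bv ∧⁺ lv)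

        rare-cover : saturated v ≡ false → bigRare v ≡ true
        rare-cover ¬sat = let l , hl , lv = big-leader bv in some⁺ _ l
          (hl ∧⁺ ≡ᵇ⁺ (trans (tw-deg lv (λ _ e → e)) d≡) ∧⁺ not⁺ rare ∧⁺ Kv ∧⁺ bv ∧⁺ tw-E lv)
          where
          d≡ : deg₀ v ≡ cliqueSize
          d≡ = deg-size A₀ (λ _ e → e) (W⊆A₀ sol)
          rare : common ≡ false
          rare = ≢true λ e → true≢false (bv ∧⁺ subst
            (λ d → (k <ᵇ cnt λ l → bigLeader l ∧ (deg₀ l ≡ᵇ d)) ≡ true) (sym d≡) e) ¬sat

      -- Without a deleted neighbour, `v` has the clique size as its degree in both `A₀` and `A`. If
      -- saturated, it is in one of the retained isolated cliques of that size; otherwise at most k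
      -- big leaders have that degree.
      big-cover : bigHit v ≡ true ⊎ bigSaturated v ≡ true ⊎ bigRare v ≡ true
      big-cover = [ inj₁ , (λ ¬h → inj₂ (
          let near = λ x Ax vx → ≢false λ ¬Wx → true≢false
                ((Ax ∧⁺ not⁺ ¬Wx) ∧⁺ Kv ∧⁺ bv ∧⁺ E-sym⁻ vx) (none⁻ (λ x → X₀ x ∧ bigAt x v) ¬h x)
          in [ (λ sat → inj₁ (saturated-cover near sat)) , (λ ¬sat → inj₂ (rare-cover near ¬sat)) ]′
               (bool-cases (saturated v)))) ]′
        (bool-cases (bigHit v))

    K-few : 0 < k → cnt K ≤ 30 * (k * (k * k))
    K-few k>0 = begin
      cnt K
        ≤⟨ cnt-∪ {q = full ∖ W} c₁ ⟩
      cnt (full ∖ W) + cnt Q₁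
        ≤⟨ +-mono-≤ cost (cnt-∪ {p = Q₁} c₂) ⟩
      k + (cnt suspect + cnt Q₂)
        ≤⟨ +-monoʳ-≤ k (+-mono-≤ suspect-few (cnt-∪ {p = Q₂} λ v → ∨⁻ {touched v ∨ untouched v})) ⟩
      k + (k * (k + (k * k + k)) + (cnt (λ v → touched v ∨ untouched v) + cnt Q₃))
        ≤⟨ +-monoʳ-≤ k (+-monoʳ-≤ (k * (k + (k * k + k))) (+-mono-≤ (cnt-∪ λ v → ∨⁻ {touched v}) (cnt-∪ λ v → ∨⁻ {bigHit v}))) ⟩
      k + (k * (k + (k * k + k)) + ((cnt touched + cnt untouched) + (cnt bigHit + cnt (λ v → bigSaturated v ∨ bigRare v))))
        ≤⟨ +-monoʳ-≤ k (+-monoʳ-≤ (k * (k + (k * k + k))) (+-mono-≤ (+-mono-≤ touched-few untouched-few)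
             (+-mono-≤ (≤-trans (bigAt-⋃ X₀ λ x h → ∧⁻ˡ h) (*-monoˡ-≤ L X₀-few))
               (≤-trans (cnt-∪ λ v → ∨⁻ {bigSaturated v})
                 (+-mono-≤ (≤-trans (bigAt-⋃ (first-leaders cliqueSize) leader-A₀)
                                    (*-monoˡ-≤ L (first-leaders≤ cliqueSize))) bigRare-few))))) ⟩
      k + (k * (k + (k * k + k)) + ((k * (k + k * k) + suc k * (suc k * k)) + (k * L + (suc k * L + k * L))))
        ≤⟨ arith k L k>0 (≤-reflexive (cong (λ x → 1 + (x + k + (x + k))) k²≡)) ⟩
      30 * (k * (k * k)) ∎
      where
      open ≤-Reasoning
      Q₁ Q₂ Q₃ : Pred n
      Q₃ v = bigHit v ∨ bigSaturated v ∨ bigRare v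
      Q₂ v = (touched v ∨ untouched v) ∨ Q₃ v
      Q₁ v = K v ∧ W v
      c₁ : ∀ v → K v ≡ true → (full ∖ W) v ≡ true ⊎ Q₁ v ≡ true
      c₁ v Kv = [ (λ Wv → inj₂ (Kv ∧⁺ Wv)) , (λ ¬Wv → inj₁ (not⁺ ¬Wv)) ]′ (bool-cases (W v))
      ∨⁺ : ∀ {a b} → a ≡ true ⊎ b ≡ true → a ∨ b ≡ true
      ∨⁺ {a} = [ ∨⁺ˡ , ∨⁺ʳ {a} ]′
      c₂ : ∀ v → Q₁ v ≡ true → suspect v ≡ true ⊎ Q₂ v ≡ true
      c₂ v h = [ inj₁ , (λ ¬s → inj₂ ([
          (λ bv → ∨⁺ʳ {touched v ∨ untouched v} (∨⁺ {bigHit v} (map₂ (∨⁺ {bigSaturated v}) (big-cover (∧⁻ʳ {K v} h) (∧⁻ˡ h) bv)))) ,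
          (λ ¬bv → ∨⁺ˡ (∨⁺ {touched v} (small-cover (∧⁻ʳ {K v} h ∧⁺ not⁺ ¬s) (K⊆B v (∧⁻ˡ h)) ¬bv))) ]′
          (bool-cases (big v)))) ]′ (bool-cases (suspect v))
      leader-A₀ : first-leaders cliqueSize ⊆ A₀
      leader-A₀ l h = A⊆A₀ l (leader-∈ (∧⁻ˡ (∧⁻ˡ h)))
      arith : ∀ k L → 0 < k → L ≤ 1 + (k * k + k + (k * k + k)) →
              k + (k * (k + (k * k + k)) + ((k * (k + k * k) + suc k * (suc k * k)) + (k * L + (suc k * L + k * L))))
              ≤ 30 * (k * (k * k))
      -- With the bound on `L` inserted, the sum is 9 k³ + 13 k² + 7 k + 1; its coefficients add up
      -- to 30. In terms of j = k - 1 the difference from 30 k³ has no negative coefficient.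
      arith (suc j) L _ h = begin
        κ + (κ * (κ + (κ * κ + κ)) + ((κ * (κ + κ * κ) + suc κ * (suc κ * κ)) + (κ * L + (suc κ * L + κ * L))))
          ≤⟨ +-monoʳ-≤ κ (+-monoʳ-≤ (κ * (κ + (κ * κ + κ))) (+-monoʳ-≤ (κ * (κ + κ * κ) + suc κ * (suc κ * κ))
               (+-mono-≤ (*-monoʳ-≤ κ h) (+-mono-≤ (*-monoʳ-≤ (suc κ) h) (*-monoʳ-≤ κ h))))) ⟩
        κ + (κ * (κ + (κ * κ + κ)) + ((κ * (κ + κ * κ) + suc κ * (suc κ * κ)) + (κ * M + (suc κ * M + κ * M))))
          ≤⟨ m≤m+n _ (30 * j + 50 * (j * j) + 21 * (j * (j * j))) ⟩
        κ + (κ * (κ + (κ * κ + κ)) + ((κ * (κ + κ * κ) + suc κ * (suc κ * κ)) + (κ * M + (suc κ * M + κ * M))))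
          + (30 * j + 50 * (j * j) + 21 * (j * (j * j)))
          ≡⟨ solve 1 (λ j → let k = con 1 :+ j ; M = con 1 :+ (k :* k :+ k :+ (k :* k :+ k)) ; 1+k = con 1 :+ k in
               k :+ (k :* (k :+ (k :* k :+ k)) :+ ((k :* (k :+ k :* k) :+ 1+k :* (1+k :* k)) :+ (k :* M :+ (1+k :* M :+ k :* M))))
               :+ (con 30 :* j :+ con 50 :* (j :* j) :+ con 21 :* (j :* (j :* j)))
               := con 30 :* (k :* (k :* k))) refl j ⟩
        30 * (κ * (κ * κ)) ∎
        where
        open +-*-Solver
        κ M : ℕ
        κ = suc j
        M = 1 + (κ * κ + κ + (κ * κ + κ))

-- Tables and their compilation

-- There are two kinds so that conditions reduce to the intended Booleans: a flag to itself, a count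
-- to its positivity, which is how `some` is defined.
data Table (n : ℕ) : Set where
  flags  : (Fin n → Fin n → Bool) → Table n
  counts : (Fin n → Fin n → ℕ) → Table n

module _ {n : ℕ} where

  entry : Table n → Fin n → Fin n → ℕ
  entry (flags f)  u v = bit (f u v)
  entry (counts f) u v = f u v

  nonzero : Table n → Fin n → Fin n → Bool
  nonzero (flags f)  u v = f u v
  nonzero (counts f) u v = 0 <ᵇ f u v

  nonzero-entry : ∀ T u v → (0 <ᵇ entry T u v) ≡ nonzero T u v
  nonzero-entry (flags f) u v with f u v
  ... | true  = refl
  ... | false = refl
  nonzero-entry (counts f) u v = refl

-- Formulas over the tables 0, …, m − 1 and d index variables.
infixl 8 _⟨+⟩_ _⟨∸⟩_
infix  7 _⟨<⟩_ _⟨=⟩_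
infixr 6 _⟨∧⟩_
infixr 5 _⟨∨⟩_

-- The hidden argument `T (a <ᵇ m)` restricts references to earlier tables; for literals it is
-- solved by evaluation.
mutual
  data Num (m d : ℕ) : Set where
    const         : ℕ → Num m d
    #k            : Num m d
    var           : Fin d → Num m d
    tab           : (a : ℕ) {_ : T (a <ᵇ m)} → Fin d → Fin d → Num m d
    _⟨+⟩_ _⟨∸⟩_ : Num m d → Num m d → Num m d
    ⟨_⟩           : Cond m d → Num m d

  data Cond (m d : ℕ) : Set where
    _⟨<⟩_ _⟨=⟩_ : Num m d → Num m d → Cond m d
    is            : (a : ℕ) {_ : T (a <ᵇ m)} → Fin d → Fin d → Cond m d
    _⟨∧⟩_ _⟨∨⟩_ : Cond m d → Cond m d → Cond m d
    ⟨¬⟩           : Cond m d → Cond m d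

data Rule (m : ℕ) : Set where
  test  : Cond m 2 → Rule m
  total : Num m 3 → Rule m

infixr 5 _∷_

data Rules : ℕ → ℕ → Set where
  []  : ∀ {m} → Rules m m
  _∷_ : ∀ {m m′} → Rule m → Rules (suc m) m′ → Rules m m′

module Semantics {n : ℕ} (k : ℕ) (𝕋 : ℕ → Table n) where

  mutual
    num : ∀ {m d} → Num m d → (Fin d → Fin n) → ℕ
    num (const x)   ρ = x
    num #k          ρ = k
    num (var x)     ρ = toℕ (ρ x)
    num (tab a x y) ρ = entry (𝕋 a) (ρ x) (ρ y)
    num (x ⟨+⟩ y)   ρ = num x ρ + num y ρ
    num (x ⟨∸⟩ y)   ρ = num x ρ ∸ num y ρ
    num ⟨ c ⟩       ρ = bit (cond c ρ)

    cond : ∀ {m d} → Cond m d → (Fin d → Fin n) → Bool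
    cond (x ⟨<⟩ y)  ρ = num x ρ <ᵇ num y ρ
    cond (x ⟨=⟩ y)  ρ = num x ρ ≡ᵇ num y ρ
    cond (is a x y) ρ = nonzero (𝕋 a) (ρ x) (ρ y)
    cond (c ⟨∧⟩ d)  ρ = cond c ρ ∧ cond d ρ
    cond (c ⟨∨⟩ d)  ρ = cond c ρ ∨ cond d ρ
    cond (⟨¬⟩ c)    ρ = not (cond c ρ)

  at₂ : Fin n → Fin n → Fin 2 → Fin n
  at₂ u v zero       = u
  at₂ u v (suc zero) = v

  at₃ : Fin n → Fin n → Fin n → Fin 3 → Fin n
  at₃ u v w zero             = u
  at₃ u v w (suc zero)       = v
  at₃ u v w (suc (suc zero)) = w

  table : ∀ {m} → Rule m → Fin n → Fin n → ℕ
  table (test c)  u v = bit (cond c (at₂ u v))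
  table (total e) u v = sum λ w → num e (at₃ u v w)

  Obeys : ∀ {m m′} → Rules m m′ → Set
  Obeys []             = ⊤
  Obeys (_∷_ {m} r rs) = (∀ u v → entry (𝕋 m) u v ≡ table r u v) × Obeys rs

-- The scalars n and k live in cells 0 [ 0 ] and 1 [ 0 ] and table a in array
-- 2 + a, row-major; the cells 0 [ 1 ] to 0 [ 7 ] are scratch space: for the
-- index variable x, cell 1 + 2 x holds its value and cell 2 + 2 x its value
-- times n, and cell 7 accumulates a sum.
valueCell offsetCell : ℕ → ℕ
valueCell x  = 1 + (x + x)
offsetCell x = 2 + (x + x)

value offset : ℕ → Expr
value x  = 0 [ lit (valueCell x) ]
offset x = 0 [ lit (offsetCell x) ]

accumulator : Expr
accumulator = 0 [ lit 7 ]

mutual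
  numExpr : ∀ {m d} → Num m d → Expr
  numExpr (const x)   = lit x
  numExpr #k          = 1 [ lit 0 ]
  numExpr (var x)     = value (toℕ x)
  numExpr (tab a x y) = (2 + a) [ offset (toℕ x) ⊕ value (toℕ y) ]
  numExpr (x ⟨+⟩ y)   = numExpr x ⊕ numExpr y
  numExpr (x ⟨∸⟩ y)   = numExpr x ⊖ numExpr y
  numExpr ⟨ c ⟩       = condExpr c

  -- Truth values are 0 and 1; subtracting twice from 1 turns any positive number into 1.
  condExpr : ∀ {m d} → Cond m d → Expr
  condExpr (x ⟨<⟩ y)  = lit 1 ⊖ (lit 1 ⊖ (numExpr y ⊖ numExpr x))
  condExpr (x ⟨=⟩ y)  = lit 1 ⊖ ((numExpr x ⊖ numExpr y) ⊕ (numExpr y ⊖ numExpr x))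
  condExpr (is a x y) = lit 1 ⊖ (lit 1 ⊖ (2 + a) [ offset (toℕ x) ⊕ value (toℕ y) ])
  condExpr (c ⟨∧⟩ d)  = (condExpr c ⊕ condExpr d) ⊖ lit 1
  condExpr (c ⟨∨⟩ d)  = lit 1 ⊖ (lit 1 ⊖ (condExpr c ⊕ condExpr d))
  condExpr (⟨¬⟩ c)    = lit 1 ⊖ condExpr c

-- The row offset grows by n per round because expressions cannot multiply.
loop : ℕ → Expr → Program → Program
loop x bound body =
  0 [ lit (valueCell x) ]≔ lit 0 ⨾
  0 [ lit (offsetCell x) ]≔ lit 0 ⨾
  while (bound ⊖ value x) (body ⨾
    0 [ lit (valueCell x) ]≔ value x ⊕ lit 1 ⨾
    0 [ lit (offsetCell x) ]≔ offset x ⊕ 0 [ lit 0 ])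

ruleProgram : ∀ {m} → Rule m → Program
ruleProgram {m} (test c) =
  loop 0 (0 [ lit 0 ]) (loop 1 (0 [ lit 0 ]) ((2 + m) [ offset 0 ⊕ value 1 ]≔ condExpr c))
ruleProgram {m} (total e) =
  loop 0 (0 [ lit 0 ]) (loop 1 (0 [ lit 0 ])
    (0 [ lit 7 ]≔ lit 0 ⨾
     loop 2 (0 [ lit 0 ]) (0 [ lit 7 ]≔ accumulator ⊕ numExpr e) ⨾
     (2 + m) [ offset 0 ⊕ value 1 ]≔ accumulator))

rulesProgram : ∀ {m m′} → Rules m m′ → Program
rulesProgram []       = skip
rulesProgram (r ∷ rs) = ruleProgram r ⨾ rulesProgram rs

-- Runs with step bounds and postconditions

Runs : Program → State → ℕ → (State → Set) → Set
Runs Q s c Post = ∃[ t ] ∃[ s′ ] (Q , s ⇓[ t ] s′) × t ≤ c × Post s′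

runs-assign : ∀ {a e f s} {Post : State → Set} → Post (s [ a , ⟦ e ⟧ s ↦ ⟦ f ⟧ s ]) → Runs (a [ e ]≔ f) s 1 Post
runs-assign h = _ , _ , ⇓assign , ≤-refl , h

runs-seq : ∀ {Q R s c d} {Mid Post : State → Set} → Runs Q s c Mid →
           (∀ {s′} → Mid s′ → Runs R s′ d Post) → Runs (Q ⨾ R) s (c + d) Post
runs-seq (t , s₁ , r , t≤ , h) g with g h
... | u , s₂ , r′ , u≤ , h′ = t + u , s₂ , ⇓seq r r′ , +-mono-≤ t≤ u≤ , h′

runs-weaken : ∀ {Q s c d} {Pre Post : State → Set} → c ≤ d → (∀ {s′} → Pre s′ → Post s′) →
              Runs Q s c Pre → Runs Q s d Post
runs-weaken c≤d g (t , s′ , r , t≤ , h) = t , s′ , r , ≤-trans t≤ c≤d , g h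

runs-while : ∀ {e Q N c} (Inv : ℕ → State → Set) →
             (∀ {i s} → Inv i s → ⟦ e ⟧ s ≡ N ∸ i) →
             (∀ {i s} → i < N → Inv i s → Runs Q s c (Inv (suc i))) →
             ∀ {s} → Inv 0 s → Runs (while e Q) s (N * suc c + 1) (Inv N)
runs-while {e} {Q} {N} {c} Inv guard step h = go N 0 (+-identityʳ N) h
  where
  go : ∀ r i → r + i ≡ N → ∀ {s} → Inv i s → Runs (while e Q) s (r * suc c + 1) (Inv N)
  go zero    i refl h = _ , _ , ⇓stop (trans (guard h) (n∸n≡0 i)) , ≤-refl , h
  go (suc r) i refl {s} h with step (s≤s (m≤n+m i r)) h
  ... | t , s₁ , run , t≤ , h₁ with go r (suc i) (+-suc r i) h₁
  ...   | u , s₂ , run′ , u≤ , h₂ = suc (t + u) , s₂ , ⇓loop nonzero′ run run′ , s≤s (begin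
            t + u                      ≤⟨ +-mono-≤ t≤ u≤ ⟩
            c + (r * suc c + 1)        ≡⟨ +-assoc c _ 1 ⟨
            c + r * suc c + 1          ∎) , h₂
    where
    open ≤-Reasoning
    nonzero′ : ⟦ e ⟧ s ≢ 0
    nonzero′ eq = 1+n≢0 (trans (sym (m+n∸n≡m (suc r) i)) (trans (sym (guard h)) eq))

At : ℕ → ℕ → ℕ → State → Set
At n x i s = s 0 (valueCell x) ≡ i × s 0 (offsetCell x) ≡ i * n

-- Two initialisations and the final test; each round costs the guard, the body and two counter
-- updates.
loopCost : ℕ → ℕ → ℕ
loopCost N c = 2 + (N * suc (c + 2) + 1)

loopCost-mono : ∀ N {c d} → c ≤ d → loopCost N c ≤ loopCost N d
loopCost-mono N h = +-monoʳ-≤ 2 (+-monoˡ-≤ 1 (*-monoʳ-≤ N (s≤s (+-monoˡ-≤ 2 h))))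

≡ᵇ-refl : ∀ x → (x ≡ᵇ x) ≡ true
≡ᵇ-refl x = ≡ᵇ⁺ {x} refl

valueCell≢offsetCell : ∀ x → (valueCell x ≡ᵇ offsetCell x) ≡ false
valueCell≢offsetCell x = ≢true λ e → 1+n≢n (sym (≡ᵇ⁻ {x + x} e))

offsetCell≢valueCell : ∀ x → (offsetCell x ≡ᵇ valueCell x) ≡ false
offsetCell≢valueCell x = ≢true λ e → 1+n≢n (≡ᵇ⁻ {suc (x + x)} e)

module _ (n x N : ℕ) (bound : Expr) (Inv : ℕ → State → Set)
         (n-cell : ∀ {i s} → Inv i s → s 0 0 ≡ n)
         (bound-value : ∀ {i s} → Inv i s → ⟦ bound ⟧ s ≡ N)
         (stable-v : ∀ {i s y} → Inv i s → Inv i (s [ 0 , valueCell x ↦ y ]))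
         (stable-o : ∀ {i s y} → Inv i s → Inv i (s [ 0 , offsetCell x ↦ y ])) where

  runs-loop : ∀ {body c} →
              (∀ {i s} → i < N → Inv i s → At n x i s → Runs body s c λ s′ → Inv (suc i) s′ × At n x i s′) →
              ∀ {s} → Inv 0 s → Runs (loop x bound body) s (loopCost N c) (Inv N)
  runs-loop {body} {c} step {s} h =
    runs-seq {Mid = λ s′ → Inv 0 s′ × s′ 0 (valueCell x) ≡ 0}
      (runs-assign (stable-v h , cong (λ b → if b then 0 else s 0 (valueCell x)) (≡ᵇ-refl (valueCell x)))) λ {s₁} (h₁ , v₁) →
    runs-seq {Mid = λ s′ → Inv 0 s′ × At n x 0 s′}
      (runs-assign (stable-o h₁ , trans (cong (λ b → if b then 0 else s₁ 0 (valueCell x))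
          (offsetCell≢valueCell x)) v₁ ,
        cong (λ b → if b then 0 else s₁ 0 (offsetCell x)) (≡ᵇ-refl (offsetCell x)))) λ h₂ →
    runs-weaken ≤-refl proj₁
      (runs-while (λ i s → Inv i s × At n x i s)
        (λ (h , v , _) → cong₂ _∸_ (bound-value h) v)
        (λ {i} i<N (h , a) → runs-seq (step i<N h a) λ {s₃} (h₃ , v₃ , o₃) →
          runs-seq {d = 1} {Mid = λ s′ → Inv (suc i) s′ × s′ 0 (valueCell x) ≡ suc i × s′ 0 (offsetCell x) ≡ i * n}
            (runs-assign (stable-v h₃ ,
              trans (cong (λ b → if b then s₃ 0 (valueCell x) + 1 else s₃ 0 (valueCell x)) (≡ᵇ-refl (valueCell x)))
                    (trans (cong (_+ 1) v₃) (+-comm i 1)) ,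
              trans (cong (λ b → if b then s₃ 0 (valueCell x) + 1 else s₃ 0 (offsetCell x)) (valueCell≢offsetCell x)) o₃))
            λ {s₄} (h₄ , v₄ , o₄) → runs-assign (stable-o h₄ ,
              trans (cong (λ b → if b then s₄ 0 (offsetCell x) + s₄ 0 0 else s₄ 0 (valueCell x))
                (offsetCell≢valueCell x)) v₄ ,
              trans (cong (λ b → if b then s₄ 0 (offsetCell x) + s₄ 0 0 else s₄ 0 (offsetCell x)) (≡ᵇ-refl (offsetCell x)))
                    (trans (cong₂ _+_ o₄ (n-cell h₄)) (+-comm (i * n) n))))
        (h₂))

partial : ∀ {n} → (Fin n → ℕ) → ℕ → ℕ
partial {zero}  f l       = 0
partial {suc n} f zero    = 0
partial {suc n} f (suc l) = f zero + partial (f ∘ suc) l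

partial-zero : ∀ {n} (f : Fin n → ℕ) → partial f 0 ≡ 0
partial-zero {zero}  f = refl
partial-zero {suc n} f = refl

partial-suc : ∀ {n} (f : Fin n → ℕ) i → partial f (suc (toℕ i)) ≡ partial f (toℕ i) + f i
partial-suc f zero    = trans (cong (f zero +_) (partial-zero (f ∘ suc))) (+-identityʳ (f zero))
partial-suc f (suc i) = trans (cong (f zero +_) (partial-suc (f ∘ suc) i)) (sym (+-assoc (f zero) _ _))

partial-sum : ∀ {n} (f : Fin n → ℕ) → partial f n ≡ sum f
partial-sum {zero}  f = refl
partial-sum {suc n} f = cong (f zero +_) (partial-sum (f ∘ suc))

module _ {n : ℕ} where

  position : Fin n → Fin n → ℕ
  position u v = toℕ u * n + toℕ v

  position-combine : ∀ u v → position u v ≡ toℕ (combine u v)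
  position-combine u v = trans (cong (_+ toℕ v) (*-comm (toℕ u) n)) (sym (toℕ-combine u v))

  position-injective : ∀ u v u′ v′ → position u v ≡ position u′ v′ → u ≡ u′ × v ≡ v′
  position-injective u v u′ v′ h = combine-injective u v u′ v′
    (toℕ-injective (trans (sym (position-combine u v)) (trans h (position-combine u′ v′))))

  position< : ∀ u v → position u v < n * n
  position< u v = ≤-<-trans (≤-reflexive (position-combine u v)) (toℕ<n (combine u v))

-- Correctness and cost of the compiled rules

module Execution {n : ℕ} (k : ℕ) (𝕋 : ℕ → Table n) where

  open Semantics k 𝕋

  record Stored (m q : ℕ) (s : State) : Set where
    field
      n-cell  : s 0 0 ≡ n
      k-cell  : s 1 0 ≡ k
      earlier : ∀ {a} → a < m → ∀ u v → s (2 + a) (position u v) ≡ entry (𝕋 a) u v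
      current : ∀ u v → position u v < q → s (2 + m) (position u v) ≡ entry (𝕋 m) u v

  open Stored

  stored-scratch : ∀ {m q s} c {y} → Stored m q s → Stored m q (s [ 0 , suc c ↦ y ])
  stored-scratch c st = record
    { n-cell = n-cell st ; k-cell = k-cell st ; earlier = earlier st ; current = current st }

  stored-step : ∀ {m s u v y} → Stored m (position u v) s → y ≡ entry (𝕋 m) u v →
                Stored m (suc (position u v)) (s [ 2 + m , position u v ↦ y ])
  stored-step {m} {s} {u} {v} {y} st eq = record
    { n-cell = n-cell st ; k-cell = k-cell st
    ; earlier = λ {a} a<m u′ v′ → trans
        (cong (λ b → if b ∧ (position u v ≡ᵇ position u′ v′) then y else s (2 + a) (position u′ v′))
          (≢true {m ≡ᵇ a} λ e → <⇒≢ a<m (sym (≡ᵇ⁻ e)))) (earlier st a<m u′ v′)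
    ; current = now }
    where
    now : ∀ u′ v′ → position u′ v′ < suc (position u v) →
          (s [ 2 + m , position u v ↦ y ]) (2 + m) (position u′ v′) ≡ entry (𝕋 m) u′ v′
    now u′ v′ h rewrite ≡ᵇ-refl m with position u v ≡ᵇ position u′ v′ in e
    ... | true  with position-injective u v u′ v′ (≡ᵇ⁻ e)
    ...   | refl , refl = eq
    now u′ v′ h | false = current st u′ v′
      (≤∧≢⇒< (s≤s⁻¹ h) λ p → true≢false (≡ᵇ⁺ (sym p)) e)

  stored-next : ∀ {m s} → Stored m (n * n) s → Stored (suc m) 0 s
  stored-next {m} {s} st = record
    { n-cell = n-cell st ; k-cell = k-cell st ; current = λ _ _ ()
    ; earlier = λ {a} a<1+m u v → [ (λ a<m → earlier st a<m u v) ,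
        (λ { refl → current st u v (position< u v) }) ]′ (m≤n⇒m<n∨m≡n (s≤s⁻¹ a<1+m)) }

  module _ {m q s} (st : Stored m q s) {d} {ρ : Fin d → Fin n}
           (at : ∀ x → At n (toℕ x) (toℕ (ρ x)) s) where

    lookup-correct : ∀ {a} → a < m → ∀ x y →
      s (2 + a) (s 0 (offsetCell (toℕ x)) + s 0 (valueCell (toℕ y))) ≡ entry (𝕋 a) (ρ x) (ρ y)
    lookup-correct {a} a<m x y = trans
      (cong (s (2 + a)) (cong₂ _+_ (proj₂ (at x)) (proj₁ (at y)))) (earlier st a<m (ρ x) (ρ y))

    private
      lt-bit : ∀ x y → 1 ∸ (1 ∸ (y ∸ x)) ≡ bit (x <ᵇ y)
      lt-bit x y with x <ᵇ y in e
      ... | false rewrite m≤n⇒m∸n≡0 (≮ᵇ⁻ {x} {y} e) = refl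
      ... | true  with y ∸ x in d
      ...   | zero  = ⊥-elim (<⇒≱ (<ᵇ⁻ {x} e) (m∸n≡0⇒m≤n d))
      ...   | suc z = cong (1 ∸_) (0∸n≡0 z)

      eq-bit : ∀ x y → 1 ∸ ((x ∸ y) + (y ∸ x)) ≡ bit (x ≡ᵇ y)
      eq-bit zero    zero    = refl
      eq-bit zero    (suc y) = 0∸n≡0 y
      eq-bit (suc x) zero    = 0∸n≡0 (x + 0)
      eq-bit (suc x) (suc y) = eq-bit x y

      and-bit : ∀ a b → bit a + bit b ∸ 1 ≡ bit (a ∧ b)
      and-bit true  true  = refl
      and-bit true  false = refl
      and-bit false true  = refl
      and-bit false false = refl

      or-bit : ∀ a b → 1 ∸ (1 ∸ (bit a + bit b)) ≡ bit (a ∨ b)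
      or-bit true  true  = refl
      or-bit true  false = refl
      or-bit false true  = refl
      or-bit false false = refl

      not-bit : ∀ a → 1 ∸ bit a ≡ bit (not a)
      not-bit true  = refl
      not-bit false = refl

    mutual
      num-correct : ∀ (e : Num m d) → ⟦ numExpr e ⟧ s ≡ num e ρ
      num-correct (const x)       = refl
      num-correct #k              = k-cell st
      num-correct (var x)         = proj₁ (at x)
      num-correct (tab a {p} x y) = lookup-correct (<ᵇ⇒< a m p) x y
      num-correct (x ⟨+⟩ y)       = cong₂ _+_ (num-correct x) (num-correct y)
      num-correct (x ⟨∸⟩ y)       = cong₂ _∸_ (num-correct x) (num-correct y)
      num-correct ⟨ c ⟩           = cond-correct c

      cond-correct : ∀ (c : Cond m d) → ⟦ condExpr c ⟧ s ≡ bit (cond c ρ)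
      cond-correct (x ⟨<⟩ y) = trans (cong₂ (λ a b → 1 ∸ (1 ∸ (b ∸ a))) (num-correct x) (num-correct y)) (lt-bit (num x ρ) (num y ρ))
      cond-correct (x ⟨=⟩ y) = trans (cong₂ (λ a b → 1 ∸ ((a ∸ b) + (b ∸ a))) (num-correct x) (num-correct y)) (eq-bit (num x ρ) _)
      cond-correct (is a {p} x y) = trans (cong (λ z → 1 ∸ (1 ∸ z)) (lookup-correct (<ᵇ⇒< a m p) x y))
        (trans (lt-bit 0 (entry (𝕋 a) (ρ x) (ρ y))) (cong bit (nonzero-entry (𝕋 a) (ρ x) (ρ y))))
      cond-correct (c ⟨∧⟩ d) = trans (cong₂ (λ a b → a + b ∸ 1) (cond-correct c) (cond-correct d)) (and-bit (cond c ρ) _)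
      cond-correct (c ⟨∨⟩ d) = trans (cong₂ (λ a b → 1 ∸ (1 ∸ (a + b))) (cond-correct c) (cond-correct d)) (or-bit (cond c ρ) _)
      cond-correct (⟨¬⟩ c)   = trans (cong (1 ∸_) (cond-correct c)) (not-bit _)

  ruleCost : ℕ
  ruleCost = loopCost n (loopCost n (1 + (loopCost n 1 + 1)))

  runs-cells : ∀ {m c body} →
    (∀ u v {s} → Stored m (position u v) s → At n 0 (toℕ u) s → At n 1 (toℕ v) s →
      Runs body s c λ s′ → Stored m (suc (position u v)) s′ × At n 0 (toℕ u) s′ × At n 1 (toℕ v) s′) →
    ∀ {s} → Stored m 0 s →
    Runs (loop 0 (0 [ lit 0 ]) (loop 1 (0 [ lit 0 ]) body)) s (loopCost n (loopCost n c)) (Stored (suc m) 0)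
  runs-cells {m} {c} {body} step st =
    runs-weaken ≤-refl stored-next
      (runs-loop n 0 n (0 [ lit 0 ]) (λ i → Stored m (i * n)) n-cell n-cell (stored-scratch 0) (stored-scratch 1) row st)
    where
    row : ∀ {i s} → i < n → Stored m (i * n) s → At n 0 i s →
          Runs (loop 1 (0 [ lit 0 ]) body) s (loopCost n c) λ s′ → Stored m (suc i * n) s′ × At n 0 i s′
    row {i} {s} i<n st at =
      runs-weaken ≤-refl (λ {s′} (st′ , at′) → subst (λ q → Stored m q s′) (+-comm (i * n) n) st′ , at′)
        (runs-loop n 1 n (0 [ lit 0 ]) (λ j s → Stored m (i * n + j) s × At n 0 i s)
          (n-cell ∘ proj₁) (n-cell ∘ proj₁)
          (λ (st , at) → stored-scratch 2 st , at) (λ (st , at) → stored-scratch 3 st , at)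
          (λ j<n → cell (fromℕ< i<n) (fromℕ< j<n) (sym (toℕ-fromℕ< i<n)) (sym (toℕ-fromℕ< j<n)))
          (subst (λ q → Stored m q s) (sym (+-identityʳ (i * n))) st , at))
      where
      cell : ∀ u v {i j} → i ≡ toℕ u → j ≡ toℕ v →
             ∀ {s} → Stored m (i * n + j) s × At n 0 i s → At n 1 j s →
             Runs body s c λ s′ → (Stored m (i * n + suc j) s′ × At n 0 i s′) × At n 1 j s′
      cell u v refl refl (st , at₀) at₁ = runs-weaken ≤-refl
        (λ {s′} (st′ , a , b) → (subst (λ q → Stored m q s′) (sym (+-suc (toℕ u * n) (toℕ v))) st′ , a) , b)
        (step u v st at₀ at₁)

  write-cell : ∀ {m e s} u v → Stored m (position u v) s → At n 0 (toℕ u) s → At n 1 (toℕ v) s →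
               ⟦ e ⟧ s ≡ entry (𝕋 m) u v →
               Runs ((2 + m) [ offset 0 ⊕ value 1 ]≔ e) s 1
                 λ s′ → Stored m (suc (position u v)) s′ × At n 0 (toℕ u) s′ × At n 1 (toℕ v) s′
  write-cell {m} {e} {s} u v st at₀ at₁ eq = runs-assign
    (subst (λ p → Stored m (suc (position u v)) (s [ 2 + m , p ↦ ⟦ e ⟧ s ]))
       (sym (cong₂ _+_ (proj₂ at₀) (proj₁ at₁))) (stored-step st eq) , at₀ , at₁)

  at₂-correct : ∀ {u v s} → At n 0 (toℕ u) s → At n 1 (toℕ v) s → ∀ x → At n (toℕ x) (toℕ (at₂ u v x)) s
  at₂-correct a b zero       = a
  at₂-correct a b (suc zero) = b

  at₃-correct : ∀ {u v w s} → At n 0 (toℕ u) s → At n 1 (toℕ v) s → At n 2 (toℕ w) s →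
                ∀ x → At n (toℕ x) (toℕ (at₃ u v w x)) s
  at₃-correct a b c zero             = a
  at₃-correct a b c (suc zero)       = b
  at₃-correct a b c (suc (suc zero)) = c

  runs-rule : ∀ {m} (r : Rule m) → (∀ u v → entry (𝕋 m) u v ≡ table r u v) →
              ∀ {s} → Stored m 0 s → Runs (ruleProgram r) s ruleCost (Stored (suc m) 0)
  runs-rule {m} (test c) obeys st =
    runs-weaken (loopCost-mono n (loopCost-mono n {d = 1 + (loopCost n 1 + 1)} (s≤s z≤n))) (λ h → h)
      (runs-cells (λ u v {s} st at₀ at₁ → write-cell u v st at₀ at₁
        (trans (cond-correct st (at₂-correct {s = s} at₀ at₁) c) (sym (obeys u v)))) st)
  runs-rule {m} (total e) obeys st = runs-cells cell st
    where
    cell : ∀ u v {s} → Stored m (position u v) s → At n 0 (toℕ u) s → At n 1 (toℕ v) s →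
           Runs _ s (1 + (loopCost n 1 + 1))
             λ s′ → Stored m (suc (position u v)) s′ × At n 0 (toℕ u) s′ × At n 1 (toℕ v) s′
    cell u v st at₀ at₁ =
      runs-seq {Mid = Inv 0} (runs-assign (stored-scratch 6 st , at₀ , at₁ , sym (partial-zero f))) λ h →
      runs-seq (runs-loop n 2 n (0 [ lit 0 ]) Inv (n-cell ∘ proj₁) (n-cell ∘ proj₁)
                  (λ (st , h) → stored-scratch 4 st , h) (λ (st , h) → stored-scratch 5 st , h)
                  (λ l<n → add (fromℕ< l<n) (sym (toℕ-fromℕ< l<n))) h)
        λ (st , at₀ , at₁ , acc) → write-cell u v st at₀ at₁ (trans acc (trans (partial-sum f) (sym (obeys u v))))
      where
      f : Fin n → ℕ
      f w = num e (at₃ u v w)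
      Inv : ℕ → State → Set
      Inv l s = Stored m (position u v) s × At n 0 (toℕ u) s × At n 1 (toℕ v) s × s 0 7 ≡ partial f l
      add : ∀ w {l s} → l ≡ toℕ w → Inv l s → At n 2 l s →
            Runs (0 [ lit 7 ]≔ accumulator ⊕ numExpr e) s 1 λ s′ → Inv (suc l) s′ × At n 2 l s′
      add w {s = s} refl (st , at₀ , at₁ , acc) at₂ = runs-assign
        ((stored-scratch 6 st , at₀ , at₁ ,
          trans (cong₂ _+_ acc (num-correct st (at₃-correct {s = s} at₀ at₁ at₂) e)) (sym (partial-suc f w))) , at₂)

  length : ∀ {m m′} → Rules m m′ → ℕ
  length []       = 0
  length (_ ∷ rs) = suc (length rs)

  runs-rules : ∀ {m m′} (rs : Rules m m′) → Obeys rs → ∀ {s} → Stored m 0 s →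
               Runs (rulesProgram rs) s (length rs * ruleCost + 1) (Stored m′ 0)
  runs-rules []       _       st = _ , _ , ⇓skip , ≤-refl , st
  runs-rules (r ∷ rs) (o , os) st = runs-weaken (≤-reflexive (sym (+-assoc ruleCost _ 1))) (λ h → h)
    (runs-seq (runs-rule r o st) (runs-rules rs os))

-- The order of the output is in ord [ 0 ], its parameter in par [ 0 ].
copyProgram : Name → Name → Name → Program
copyProgram src ord par =
  -- Cell 7 is the row offset in the output matrix, whose rows have length `ord [ 0 ]`, whereas
  -- `offset 0` advances by n in the source.
  0 [ lit 7 ]≔ lit 0 ⨾
  loop 0 (ord [ lit 0 ])
    (loop 1 (ord [ lit 0 ]) (2 [ accumulator ⊕ value 1 ]≔ src [ offset 0 ⊕ value 1 ]) ⨾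
     0 [ lit 7 ]≔ accumulator ⊕ ord [ lit 0 ]) ⨾
  0 [ lit 0 ]≔ ord [ lit 0 ] ⨾
  1 [ lit 0 ]≔ par [ lit 0 ]

module Copy (n n′ k′ : ℕ) (f : Fin n′ → Fin n′ → ℕ) (a b c : Name) where

  -- Names of the form 3 + a differ from 0, 1 and 2 by computation, so writes to those arrays
  -- visibly preserve the sources.
  src ord par : Name
  src = 3 + a
  ord = 3 + b
  par = 3 + c

  record Copied (q : ℕ) (s : State) : Set where
    field
      n-cell   : s 0 0 ≡ n
      ord-cell : s ord 0 ≡ n′
      par-cell : s par 0 ≡ k′
      source   : ∀ u v → s src (toℕ u * n + toℕ v) ≡ f u v
      target   : ∀ u v → position u v < q → s 2 (position u v) ≡ f u v

  open Copied

  copied-scratch : ∀ {q s} c {y} → Copied q s → Copied q (s [ 0 , suc c ↦ y ])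
  copied-scratch c h = record
    { n-cell = n-cell h ; ord-cell = ord-cell h ; par-cell = par-cell h ; source = source h ; target = target h }

  copied-step : ∀ {s u v y} → Copied (position u v) s → y ≡ f u v → Copied (suc (position u v)) (s [ 2 , position u v ↦ y ])
  copied-step {s} {u} {v} {y} h eq = record
    { n-cell = n-cell h ; ord-cell = ord-cell h ; par-cell = par-cell h ; source = source h ; target = now }
    where
    now : ∀ u′ v′ → position u′ v′ < suc (position u v) → (s [ 2 , position u v ↦ y ]) 2 (position u′ v′) ≡ f u′ v′
    now u′ v′ lt with position u v ≡ᵇ position u′ v′ in e
    ... | true  with position-injective u v u′ v′ (≡ᵇ⁻ e)
    ...   | refl , refl = eq
    now u′ v′ lt | false = target h u′ v′ (≤∧≢⇒< (s≤s⁻¹ lt) λ p → true≢false (≡ᵇ⁺ (sym p)) e)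

  copyCost : ℕ
  copyCost = 1 + (loopCost n′ (loopCost n′ 1 + 1) + (1 + 1))

  runs-copy : ∀ {s} → Copied 0 s → Runs (copyProgram src ord par) s copyCost λ s′ →
              s′ 0 0 ≡ n′ × s′ 1 0 ≡ k′ × (∀ u v → s′ 2 (position u v) ≡ f u v)
  runs-copy h =
    runs-seq {Mid = λ s → Copied 0 s × s 0 7 ≡ 0} (runs-assign (copied-scratch 6 h , refl)) λ h →
    runs-seq (runs-loop n 0 n′ (ord [ lit 0 ]) Rows (n-cell ∘ proj₁) (ord-cell ∘ proj₁)
                (λ (h , e) → copied-scratch 0 h , e) (λ (h , e) → copied-scratch 1 h , e) row h) λ (h , _) →
    runs-seq {Mid = λ s → s 0 0 ≡ n′ × s par 0 ≡ k′ × (∀ u v → s 2 (position u v) ≡ f u v)}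
      (runs-assign (ord-cell h , par-cell h , λ u v → target h u v (position< u v))) λ (e₀ , e₁ , e₂) →
    runs-assign (e₀ , e₁ , e₂)
    where
    Rows : ℕ → State → Set
    Rows i s = Copied (i * n′) s × s 0 7 ≡ i * n′
    Cells : ℕ → ℕ → State → Set
    Cells i j s = Copied (i * n′ + j) s × s 0 7 ≡ i * n′ × At n 0 i s
    cell : ∀ u v {i j} → i ≡ toℕ u → j ≡ toℕ v → ∀ {s} → Cells i j s → At n 1 j s →
           Runs (2 [ accumulator ⊕ value 1 ]≔ src [ offset 0 ⊕ value 1 ]) s 1 λ s′ → Cells i (suc j) s′ × At n 1 j s′
    cell u v refl refl {s} (h , e , at₀) at₁ = runs-assign
      ((subst₂ (λ q p → Copied q (s [ 2 , p ↦ s src (s 0 2 + s 0 3) ])) (sym (+-suc (toℕ u * n′) (toℕ v)))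
          (sym (cong₂ _+_ e (proj₁ at₁)))
          (copied-step h (trans (cong (s src) (cong₂ _+_ (proj₂ at₀) (proj₁ at₁))) (source h u v))) , e , at₀) , at₁)
    row : ∀ {i s} → i < n′ → Rows i s → At n 0 i s →
          Runs _ s (loopCost n′ 1 + 1) λ s′ → Rows (suc i) s′ × At n 0 i s′
    row {i} {s} i<n′ (h , e) at₀ = runs-seq
      (runs-loop n 1 n′ (ord [ lit 0 ]) (Cells i) (n-cell ∘ proj₁) (ord-cell ∘ proj₁)
        (λ (h , e) → copied-scratch 2 h , e) (λ (h , e) → copied-scratch 3 h , e)
        (λ j<n′ → cell (fromℕ< i<n′) (fromℕ< j<n′) (sym (toℕ-fromℕ< i<n′)) (sym (toℕ-fromℕ< j<n′)))
        (subst (λ q → Copied q s) (sym (+-identityʳ (i * n′))) h , e , at₀))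
      λ {s′} (h , e , at₀) → runs-assign
        ((subst (λ q → Copied q (s′ [ 0 , 7 ↦ s′ 0 7 + s′ ord 0 ])) (+-comm (i * n′) n′) (copied-scratch 6 h) ,
          trans (cong₂ _+_ e (ord-cell h)) (+-comm (i * n′) n′)) , at₀)

-- The reduction as a list of tables

module _ {n : ℕ} (G : Graph n) where

  closed : Fin n → Fin n → Bool
  closed u v = adj G u v ∨ (toℕ u ≡ᵇ toℕ v)

  closed-refl : ∀ v → closed v v ≡ true
  closed-refl v = ∨⁺ʳ {adj G v v} (≡ᵇ⁺ {toℕ v} refl)

  closed-sym : ∀ u v → closed u v ≡ closed v u
  closed-sym u v = cong₂ _∨_ (adj-sym G u v) (≡ᵇ-sym (toℕ u) (toℕ v))

-- For k ≤ n, k² and k³ are the numbers of pairs and triples of vertices with indices below k; sums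
-- replace the missing multiplication.
ifBelow : ∀ {n} → ℕ → Fin n → ℕ
ifBelow {n} k u = cnt {n} λ w → (toℕ w <ᵇ k) ∧ (toℕ u <ᵇ k)

square : ℕ → ℕ → ℕ
square n k = sum {n} (ifBelow k)

ifBothBelow : ∀ {n} → ℕ → Fin n → Fin n → ℕ
ifBothBelow {n} k u v = cnt {n} λ w → (toℕ w <ᵇ k) ∧ (toℕ u <ᵇ k) ∧ (toℕ v <ᵇ k)

cube : ℕ → ℕ → ℕ
cube n k = sum {n} λ u → sum {n} λ w → ifBothBelow k w u

opaque
  unfolding cnt

  sum-if : ∀ {n k} → k ≤ n → ∀ b → sum {n} (λ u → bit (toℕ u <ᵇ k) * b) ≡ k * b
  sum-if {n} {k} k≤n b = trans (sum-*ʳ {n} (λ u → bit (toℕ u <ᵇ k)) b) (cong (_* b) (trans (cnt-below n k) (m≥n⇒m⊓n≡n k≤n)))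

ifBelow-value : ∀ {n k} → k ≤ n → ∀ u → ifBelow {n} k u ≡ bit (toℕ u <ᵇ k) * k
ifBelow-value {n} {k} k≤n u with toℕ u <ᵇ k
... | true  = trans (cnt-cong λ w → ∧-identityʳ (toℕ w <ᵇ k)) (trans (cnt-below n k) (trans (m≥n⇒m⊓n≡n k≤n) (sym (+-identityʳ k))))
... | false = cnt-none λ w → ∧-zeroʳ (toℕ w <ᵇ k)

square-value : ∀ {n k} → k ≤ n → square n k ≡ k * k
square-value {n} {k} k≤n = trans (sum-cong-≗ {n} (ifBelow-value k≤n)) (sum-if k≤n k)

cube-value : ∀ {n k} → k ≤ n → cube n k ≡ k * (k * k)
cube-value {n} {k} k≤n = trans (sum-cong-≗ {n} row) (sum-if k≤n (k * k))
  where
  row : ∀ u → sum {n} (λ w → ifBothBelow k w u) ≡ bit (toℕ u <ᵇ k) * (k * k)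
  row u with toℕ u <ᵇ k
  ... | true  = trans (sum-cong-≗ {n} λ w → cnt-cong λ x → cong ((toℕ x <ᵇ k) ∧_) (∧-identityʳ (toℕ w <ᵇ k)))
                      (trans (square-value k≤n) (sym (+-identityʳ (k * k))))
  ... | false = trans (sum-cong-≗ {n} λ w → cnt-none λ x → trans (cong ((toℕ x <ᵇ k) ∧_) (∧-zeroʳ (toℕ w <ᵇ k))) (∧-zeroʳ (toℕ x <ᵇ k))) (sum-replicate-zero n)

entries : ∀ {n} → List (Table n) → ℕ → Table n
entries []       _       = counts λ _ _ → 0
entries (t ∷ ts) zero    = t
entries (t ∷ ts) (suc a) = entries ts a

module Tables {n : ℕ} (G : Graph n) (k : ℕ) (k≤n : k ≤ n) where

  E : Fin n → Fin n → Bool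
  E = closed G

  open Reduction E (closed-refl G) (closed-sym G) k (square n k) (square-value k≤n) public

  deletions : ℕ
  deletions = cnt (full ∖ A)

  -- With no budget left, `A` itself must be a uniform cluster graph: no P₃ and equal degrees.
  conflict : Fin n → Fin n → Bool
  conflict u v = some λ w → A u ∧ A v ∧ A w ∧ P u v w

  defective : Fin n → Bool
  defective u = some λ v → A u ∧ A v ∧ (conflict u v ∨ not (deg A u ≡ᵇ deg A v))

  defect : Bool
  defect = some defective

  rejects : Bool
  rejects = (k <ᵇ deletions) ∨ (30 * cube n k <ᵇ cnt K) ∨ (deletions ≡ᵇ k) ∧ defect

  accepts : Bool
  accepts = (deletions ≡ᵇ k) ∧ not defect

  newName : Fin n → ℕ
  newName u = cnt λ w → K w ∧ (toℕ w <ᵇ toℕ u)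

  -- The endpoints are renamed one at a time, as a rule can bind only one further vertex.
  named : Fin n → Fin n → Bool
  named p v = some λ w → K w ∧ (newName w ≡ᵇ toℕ p) ∧ E w v

  renamed : Fin n → Fin n → Bool
  renamed p q = some λ w → K w ∧ (newName w ≡ᵇ toℕ q) ∧ named p w

  -- A rejected input is replaced by the path on four vertices with parameter 1,
  -- an accepted one by the empty graph with parameter 1.
  newAdj : Fin n → Fin n → Bool
  newAdj p q = rejects ∧ ((toℕ p ≡ᵇ toℕ q + 1) ∨ (toℕ q ≡ᵇ toℕ p + 1))
               ∨ not rejects ∧ renamed p q ∧ not (toℕ p ≡ᵇ toℕ q)

  -- Even the constants 4 and 1 and the remaining budget appear as counts over `Fin n`; they have
  -- these values because 4 ≤ n and k ≤ n.
  newOrder : ℕ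
  newOrder = cnt {n} λ w → rejects ∧ (toℕ w <ᵇ 4) ∨ not rejects ∧ not accepts ∧ K w

  newParam : ℕ
  newParam = cnt {n} λ w → (rejects ∨ accepts) ∧ (toℕ w <ᵇ 1) ∨ not rejects ∧ not accepts ∧ (toℕ w <ᵇ k ∸ deletions)

  tables : ℕ → Table n
  tables = entries (
    (flags (adj G)) ∷
    (flags E) ∷
    (counts λ u v → cnt (P u v)) ∷
    (flags hard) ∷
    (counts λ u _ → hardDeg u) ∷
    (counts λ u v → cnt (easyP u v)) ∷
    (counts λ u _ → linkDeg u) ∷
    (counts λ u _ → ifBelow k u) ∷
    (counts λ _ _ → square n k) ∷
    (flags λ u _ → A₀ u) ∷
    (counts (diff A₀)) ∷
    (flags (tw A₀)) ∷
    (counts λ u _ → cls₀ u) ∷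
    (counts λ u _ → deg₀ u) ∷
    (counts λ u _ → cnt λ l → tw A₀ u l ∧ (toℕ l <ᵇ toℕ u)) ∷
    (flags λ u _ → bigLeader u) ∷
    (counts λ u _ → cnt λ l → bigLeader l ∧ (deg₀ l ≡ᵇ deg₀ u)) ∷
    (flags λ u _ → saturated u) ∷
    (counts λ x u → cnt λ s → saturated u ∧ A₀ s ∧ E u s ∧ E s x ∧ not (E u x)) ∷
    (counts λ x _ → cnt λ u → some λ s → saturated u ∧ A₀ s ∧ E u s ∧ E s x ∧ not (E u x)) ∷
    (flags λ u _ → A u) ∷
    (counts λ u _ → deg A u) ∷
    (counts (diff A)) ∷
    (counts λ u _ → cnt λ l → A l ∧ E u l ∧ (0 <ᵇ diff A u l)) ∷
    (counts λ u _ → cnt λ l → A l ∧ E u l ∧ (toℕ l <ᵇ toℕ u)) ∷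
    (flags λ u _ → leader u) ∷
    (counts λ u _ → rank u) ∷
    (counts λ u _ → cnt λ l → leader l ∧ E l u ∧ (k <ᵇ rank l)) ∷
    (flags λ u _ → B u) ∷
    (counts (diff B)) ∷
    (flags (tw B)) ∷
    (counts λ u _ → cls B u) ∷
    (counts λ u _ → clsRank u) ∷
    (counts λ j _ → cnt λ v → L + toℕ j <ᵇ cls B v) ∷
    (counts λ _ _ → t) ∷
    (flags λ u _ → K u) ∷
    (counts λ _ _ → deletions) ∷
    (counts λ _ _ → cnt K) ∷
    (counts (ifBothBelow k)) ∷
    (counts λ u _ → sum λ w → ifBothBelow k w u) ∷
    (counts λ _ _ → cube n k) ∷
    (counts λ u v → cnt λ w → A u ∧ A v ∧ A w ∧ P u v w) ∷
    (counts λ u _ → cnt λ v → A u ∧ A v ∧ (conflict u v ∨ not (deg A u ≡ᵇ deg A v))) ∷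
    (counts λ _ _ → cnt defective) ∷
    (flags λ _ _ → rejects) ∷
    (flags λ _ _ → accepts) ∷
    (counts λ u _ → newName u) ∷
    (counts λ p v → cnt λ w → K w ∧ (newName w ≡ᵇ toℕ p) ∧ E w v) ∷
    (counts λ p q → cnt λ w → K w ∧ (newName w ≡ᵇ toℕ q) ∧ named p w) ∷
    (flags newAdj) ∷
    (counts λ _ _ → newOrder) ∷
    (counts λ _ _ → newParam) ∷
    [])

pattern 𝐢 = zero
pattern 𝐣 = suc zero
pattern 𝐥 = suc (suc zero)

times : ∀ {m d} → ℕ → Num m d → Num m d
times zero    e = const 0
times (suc c) e = e ⟨+⟩ times c e

-- The a-th rule computes the a-th entry of tables, where entry 0 is the input.
rules : Rules 1 52
rules =
  test (is 0 𝐢 𝐣 ⟨∨⟩ var 𝐢 ⟨=⟩ var 𝐣) ∷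
  total ⟨ ⟨ is 1 𝐢 𝐣 ⟩ ⟨+⟩ ⟨ is 1 𝐢 𝐥 ⟩ ⟨+⟩ ⟨ is 1 𝐣 𝐥 ⟩ ⟨=⟩ const 2 ⟩ ∷
  test (#k ⟨<⟩ tab 2 𝐢 𝐣) ∷
  total ⟨ is 3 𝐢 𝐥 ⟩ ∷
  total ⟨ ⟨ is 1 𝐢 𝐣 ⟩ ⟨+⟩ ⟨ is 1 𝐢 𝐥 ⟩ ⟨+⟩ ⟨ is 1 𝐣 𝐥 ⟩ ⟨=⟩ const 2
          ⟨∧⟩ ⟨¬⟩ (is 3 𝐢 𝐣) ⟨∧⟩ ⟨¬⟩ (is 3 𝐢 𝐥) ⟨∧⟩ ⟨¬⟩ (is 3 𝐣 𝐥) ⟩ ∷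
  total ⟨ is 5 𝐢 𝐥 ⟩ ∷
  total ⟨ var 𝐥 ⟨<⟩ #k ⟨∧⟩ var 𝐢 ⟨<⟩ #k ⟩ ∷
  total (tab 7 𝐥 𝐥) ∷
  test (⟨¬⟩ (#k ⟨<⟩ tab 4 𝐢 𝐢) ⟨∧⟩ ⟨¬⟩ (tab 8 𝐢 𝐢 ⟨+⟩ #k ⟨<⟩ tab 6 𝐢 𝐢)) ∷
  total ⟨ is 9 𝐥 𝐥 ⟨∧⟩ ⟨¬⟩ (⟨ is 1 𝐢 𝐥 ⟩ ⟨=⟩ ⟨ is 1 𝐣 𝐥 ⟩) ⟩ ∷
  test (is 9 𝐢 𝐢 ⟨∧⟩ is 9 𝐣 𝐣 ⟨∧⟩ ⟨¬⟩ (is 10 𝐢 𝐣)) ∷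
  total ⟨ is 11 𝐢 𝐥 ⟩ ∷
  total ⟨ is 9 𝐥 𝐥 ⟨∧⟩ is 1 𝐢 𝐥 ⟩ ∷
  total ⟨ is 11 𝐢 𝐥 ⟨∧⟩ var 𝐥 ⟨<⟩ var 𝐢 ⟩ ∷
  test (#k ⟨<⟩ tab 12 𝐢 𝐢 ⟨∧⟩ ⟨¬⟩ (is 14 𝐢 𝐢)) ∷
  total ⟨ is 15 𝐥 𝐥 ⟨∧⟩ tab 13 𝐥 𝐥 ⟨=⟩ tab 13 𝐢 𝐢 ⟩ ∷
  test (#k ⟨<⟩ tab 12 𝐢 𝐢 ⟨∧⟩ #k ⟨<⟩ tab 16 𝐢 𝐢) ∷
  total ⟨ is 17 𝐣 𝐣 ⟨∧⟩ is 9 𝐥 𝐥 ⟨∧⟩ is 1 𝐣 𝐥 ⟨∧⟩ is 1 𝐥 𝐢 ⟨∧⟩ ⟨¬⟩ (is 1 𝐣 𝐢) ⟩ ∷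
  total ⟨ is 18 𝐢 𝐥 ⟩ ∷
  test (is 9 𝐢 𝐢 ⟨∧⟩ ⟨¬⟩ (is 19 𝐢 𝐢)) ∷
  total ⟨ is 20 𝐥 𝐥 ⟨∧⟩ is 1 𝐢 𝐥 ⟩ ∷
  total ⟨ is 20 𝐥 𝐥 ⟨∧⟩ ⟨¬⟩ (⟨ is 1 𝐢 𝐥 ⟩ ⟨=⟩ ⟨ is 1 𝐣 𝐥 ⟩) ⟩ ∷
  total ⟨ is 20 𝐥 𝐥 ⟨∧⟩ is 1 𝐢 𝐥 ⟨∧⟩ is 22 𝐢 𝐥 ⟩ ∷
  total ⟨ is 20 𝐥 𝐥 ⟨∧⟩ is 1 𝐢 𝐥 ⟨∧⟩ var 𝐥 ⟨<⟩ var 𝐢 ⟩ ∷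
  test ((is 20 𝐢 𝐢 ⟨∧⟩ ⟨¬⟩ (is 23 𝐢 𝐢)) ⟨∧⟩ ⟨¬⟩ (is 24 𝐢 𝐢)) ∷
  total ⟨ is 25 𝐥 𝐥 ⟨∧⟩ tab 21 𝐥 𝐥 ⟨=⟩ tab 21 𝐢 𝐢 ⟨∧⟩ var 𝐥 ⟨<⟩ var 𝐢 ⟩ ∷
  total ⟨ is 25 𝐥 𝐥 ⟨∧⟩ is 1 𝐥 𝐢 ⟨∧⟩ #k ⟨<⟩ tab 26 𝐥 𝐥 ⟩ ∷
  test (is 20 𝐢 𝐢 ⟨∧⟩ ⟨¬⟩ (is 27 𝐢 𝐢)) ∷
  total ⟨ is 28 𝐥 𝐥 ⟨∧⟩ ⟨¬⟩ (⟨ is 1 𝐢 𝐥 ⟩ ⟨=⟩ ⟨ is 1 𝐣 𝐥 ⟩) ⟩ ∷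
  test (is 28 𝐢 𝐢 ⟨∧⟩ is 28 𝐣 𝐣 ⟨∧⟩ ⟨¬⟩ (is 29 𝐢 𝐣)) ∷
  total ⟨ is 30 𝐢 𝐥 ⟩ ∷
  total ⟨ is 30 𝐢 𝐥 ⟨∧⟩ var 𝐥 ⟨<⟩ var 𝐢 ⟩ ∷
  total ⟨ (const 1 ⟨+⟩ ((tab 8 𝐢 𝐢 ⟨+⟩ #k) ⟨+⟩ (tab 8 𝐢 𝐢 ⟨+⟩ #k))) ⟨+⟩ var 𝐢 ⟨<⟩ tab 31 𝐥 𝐥 ⟩ ∷
  total ⟨ is 33 𝐥 𝐥 ⟩ ∷
  test (is 28 𝐢 𝐢 ⟨∧⟩ ⟨¬⟩ (⟨¬⟩ (tab 32 𝐢 𝐢 ⟨<⟩ tab 8 𝐢 𝐢 ⟨+⟩ #k)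
                           ⟨∧⟩ tab 32 𝐢 𝐢 ⟨<⟩ tab 8 𝐢 𝐢 ⟨+⟩ #k ⟨+⟩ tab 34 𝐢 𝐢)) ∷
  total ⟨ ⟨¬⟩ (is 20 𝐥 𝐥) ⟩ ∷
  total ⟨ is 35 𝐥 𝐥 ⟩ ∷
  total ⟨ var 𝐥 ⟨<⟩ #k ⟨∧⟩ var 𝐢 ⟨<⟩ #k ⟨∧⟩ var 𝐣 ⟨<⟩ #k ⟩ ∷
  total (tab 38 𝐥 𝐢) ∷
  total (tab 39 𝐥 𝐥) ∷
  total ⟨ is 20 𝐢 𝐢 ⟨∧⟩ is 20 𝐣 𝐣 ⟨∧⟩ is 20 𝐥 𝐥
          ⟨∧⟩ ⟨ is 1 𝐢 𝐣 ⟩ ⟨+⟩ ⟨ is 1 𝐢 𝐥 ⟩ ⟨+⟩ ⟨ is 1 𝐣 𝐥 ⟩ ⟨=⟩ const 2 ⟩ ∷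
  total ⟨ is 20 𝐢 𝐢 ⟨∧⟩ is 20 𝐥 𝐥 ⟨∧⟩ (is 41 𝐢 𝐥 ⟨∨⟩ ⟨¬⟩ (tab 21 𝐢 𝐢 ⟨=⟩ tab 21 𝐥 𝐥)) ⟩ ∷
  total ⟨ is 42 𝐥 𝐥 ⟩ ∷
  test (#k ⟨<⟩ tab 36 𝐢 𝐢 ⟨∨⟩ times 30 (tab 40 𝐢 𝐢) ⟨<⟩ tab 37 𝐢 𝐢
        ⟨∨⟩ tab 36 𝐢 𝐢 ⟨=⟩ #k ⟨∧⟩ is 43 𝐢 𝐢) ∷
  test (tab 36 𝐢 𝐢 ⟨=⟩ #k ⟨∧⟩ ⟨¬⟩ (is 43 𝐢 𝐢)) ∷
  total ⟨ is 35 𝐥 𝐥 ⟨∧⟩ var 𝐥 ⟨<⟩ var 𝐢 ⟩ ∷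
  total ⟨ is 35 𝐥 𝐥 ⟨∧⟩ tab 46 𝐥 𝐥 ⟨=⟩ var 𝐢 ⟨∧⟩ is 1 𝐥 𝐣 ⟩ ∷
  total ⟨ is 35 𝐥 𝐥 ⟨∧⟩ tab 46 𝐥 𝐥 ⟨=⟩ var 𝐣 ⟨∧⟩ is 47 𝐢 𝐥 ⟩ ∷
  test (is 44 𝐢 𝐢 ⟨∧⟩ (var 𝐢 ⟨=⟩ var 𝐣 ⟨+⟩ const 1 ⟨∨⟩ var 𝐣 ⟨=⟩ var 𝐢 ⟨+⟩ const 1)
        ⟨∨⟩ ⟨¬⟩ (is 44 𝐢 𝐢) ⟨∧⟩ is 48 𝐢 𝐣 ⟨∧⟩ ⟨¬⟩ (var 𝐢 ⟨=⟩ var 𝐣)) ∷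
  total ⟨ is 44 𝐢 𝐢 ⟨∧⟩ var 𝐥 ⟨<⟩ const 4
          ⟨∨⟩ ⟨¬⟩ (is 44 𝐢 𝐢) ⟨∧⟩ ⟨¬⟩ (is 45 𝐢 𝐢) ⟨∧⟩ is 35 𝐥 𝐥 ⟩ ∷
  total ⟨ (is 44 𝐢 𝐢 ⟨∨⟩ is 45 𝐢 𝐢) ⟨∧⟩ var 𝐥 ⟨<⟩ const 1
          ⟨∨⟩ ⟨¬⟩ (is 44 𝐢 𝐢) ⟨∧⟩ ⟨¬⟩ (is 45 𝐢 𝐢) ⟨∧⟩ var 𝐥 ⟨<⟩ #k ⟨∸⟩ tab 36 𝐢 𝐢 ⟩ ∷
  []

module _ {n : ℕ} (G : Graph n) (k : ℕ) (k≤n : k ≤ n) where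

  open Tables G k k≤n

  opaque
    unfolding cnt ClosedGraph.P ClosedGraph.tw Forced.A₀ Forced.A Thin.B Shrink.K

    -- Once the opaque names are unfolded, each table is the value of its rule by definition, so the
    -- algorithm needs no further verification.
    obeys : Semantics.Obeys k tables rules
    obeys = (λ _ _ → refl) , (λ _ _ → refl) , (λ _ _ → refl) , (λ _ _ → refl) , (λ _ _ → refl) , (λ _ _ → refl) , (λ _ _ → refl) , (λ _ _ → refl) , (λ _ _ → refl) , (λ _ _ → refl) , (λ _ _ → refl) , (λ _ _ → refl) , (λ _ _ → refl) , (λ _ _ → refl) , (λ _ _ → refl) , (λ _ _ → refl) , (λ _ _ → refl) , (λ _ _ → refl) , (λ _ _ → refl) , (λ _ _ → refl) , (λ _ _ → refl) , (λ _ _ → refl) , (λ _ _ → refl) , (λ _ _ → refl) , (λ _ _ → refl) , (λ _ _ → refl) , (λ _ _ → refl) , (λ _ _ → refl) , (λ _ _ → refl) , (λ _ _ → refl) , (λ _ _ → refl) , (λ _ _ → refl) , (λ _ _ → refl) , (λ _ _ → refl) , (λ _ _ → refl) , (λ _ _ → refl) , (λ _ _ → refl) , (λ _ _ → refl) , (λ _ _ → refl) , (λ _ _ → refl) , (λ _ _ → refl) , (λ _ _ → refl) , (λ _ _ → refl) , (λ _ _ → refl) , (λ _ _ → refl) , (λ _ _ → refl) , (λ _ _ → refl) , (λ _ _ → refl) , (λ _ _ → refl) , (λ _ _ → refl) , (λ _ _ → refl) , tt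

-- Uniform cluster graphs and induced subgraphs

opaque
  unfolding cnt

  ∣∣≡cnt : ∀ {n} (S : Subset n) → ∣ S ∣ ≡ cnt (lookup S)
  ∣∣≡cnt []            = refl
  ∣∣≡cnt (true  ∷ S) = cong suc (∣∣≡cnt S)
  ∣∣≡cnt (false ∷ S) = ∣∣≡cnt S

-- Building a component as a `Subset` takes a decision of connectivity. The goals that use it are
-- equations between Booleans or numbers, so having one under double negation suffices.
¬¬-decidable : ∀ {n} (Q : Fin n → Set) → ¬ ¬ (∀ i → Dec (Q i))
¬¬-decidable {zero}  Q κ = κ λ ()
¬¬-decidable {suc n} Q κ = ¬¬-excluded-middle λ d → ¬¬-decidable (Q ∘ suc) λ ds →
  κ λ where
    zero    → d
    (suc i) → ds i

does⁻ : ∀ {A : Set} (d : Dec A) → does d ≡ true → A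
does⁻ (yes a) _ = a

module UniformCluster {n : ℕ} (G : Graph n) where

  open ClosedGraph (closed G) (closed-refl G) (closed-sym G) public

  adj⇒closed : ∀ {u v} → adj G u v ≡ true → closed G u v ≡ true
  adj⇒closed = ∨⁺ˡ

  closed⇒adj : ∀ {u v} → closed G u v ≡ true → u ≢ v → adj G u v ≡ true
  closed⇒adj {u} {v} h u≢v = [ (λ e → e) , (λ e → ⊥-elim (u≢v (toℕ-injective (≡ᵇ⁻ e)))) ]′ (∨⁻ {adj G u v} h)

  module _ (S : Subset n) (W : Pred n) (S≡W : ∀ v → lookup S v ≡ W v) where

    open Induced G S

    ∈⁺ : ∀ {v} → W v ≡ true → v ∈ˢ S
    ∈⁺ {v} h = lookup⇒[]= v S (trans (S≡W v) h)

    ∈⁻ : ∀ {v} → v ∈ˢ S → W v ≡ true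
    ∈⁻ {v} h = trans (sym (S≡W v)) ([]=⇒lookup h)

    closed⇒connected : ∀ {u v} → W u ≡ true → W v ≡ true → closed G u v ≡ true → Connected u v
    closed⇒connected {u} {v} Wu Wv h with u ≟ᶠ v
    ... | yes refl = ε
    ... | no  u≢v  = (∈⁺ Wu , ∈⁺ Wv , closed⇒adj h u≢v) ◅ ε

    module _ (tr : Transitive W) where

      connected⇒closed : ∀ {u v} → W u ≡ true → Connected u v → W v ≡ true × closed G u v ≡ true
      connected⇒closed {u} Wu ε = Wu , closed-refl G u
      connected⇒closed {u} Wu ((_ , hv , uv) ◅ path) =
        let Wv , h = connected⇒closed (∈⁻ hv) path in
        Wv , tr _ _ _ Wu (∈⁻ hv) Wv (adj⇒closed uv) h

      component-size : ∀ {v} → W v ≡ true → ∀ C → (∀ x → x ∈ˢ C ⇔ Connected v x) → ∣ C ∣ ≡ deg W v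
      component-size {v} Wv C h = trans (∣∣≡cnt C) (cnt-cong λ x → iff⇒≡
        (λ Cx → let Wx , vx = connected⇒closed Wv (Equivalence.to (h x) (lookup⇒[]= x C Cx)) in Wx ∧⁺ vx)
        (λ e → []=⇒lookup (Equivalence.from (h x) (closed⇒connected Wv (∧⁻ˡ e) (∧⁻ʳ {W x} e)))))

    module _ {v : Fin n} (d : ∀ x → Dec (Connected v x)) where

      component : Subset n
      component = tabulate (λ x → does (d x))

      component-∈ : ∀ x → x ∈ˢ component ⇔ Connected v x
      component-∈ x = mk⇔
        (λ h → does⁻ (d x) (trans (sym (lookup∘tabulate _ x)) ([]=⇒lookup h)))
        (λ h → lookup⇒[]= x component (trans (lookup∘tabulate _ x) (dec-true (d x) h)))

    uniform⇒transitive : IsUniformCluster → Transitive W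
    uniform⇒transitive (cliques , _) u v w Wu Wv Ww uv vw = ≢false λ ¬uw →
      ¬¬-decidable (Connected v) λ d → true≢false
        (adj⇒closed (proj₂ (proj₂ (cliques (component d) (v , ∈⁺ Wv , component-∈ d) u w
          (Equivalence.from (component-∈ d u) (closed⇒connected Wv Wu (E-sym⁻ uv)))
          (Equivalence.from (component-∈ d w) (closed⇒connected Wv Ww vw))
          λ { refl → true≢false (closed-refl G u) ¬uw })))) ¬uw

    uniform⇒regular : IsUniformCluster → ∀ {u v} → W u ≡ true → W v ≡ true → deg W u ≡ deg W v
    uniform⇒regular unif@(_ , sizes) {u} {v} Wu Wv = decidable-stable (_ ≟ _) λ ≢ →
      ¬¬-decidable (Connected u) λ d → ¬¬-decidable (Connected v) λ d′ → ≢ (begin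
        deg W u             ≡⟨ component-size tr Wu (component d) (component-∈ d) ⟨
        ∣ component d ∣     ≡⟨ sizes _ _ (u , ∈⁺ Wu , component-∈ d) (v , ∈⁺ Wv , component-∈ d′) ⟩
        ∣ component d′ ∣    ≡⟨ component-size tr Wv (component d′) (component-∈ d′) ⟩
        deg W v             ∎)
      where
      open ≡-Reasoning
      tr = uniform⇒transitive unif

    solution⇒uniform : Transitive W → ∀ {s} → (∀ v → W v ≡ true → deg W v ≡ s) → IsUniformCluster
    solution⇒uniform tr reg =
      (λ C (v , hv , h) x y hx hy x≢y →
        let Wx , vx = connected⇒closed tr (∈⁻ hv) (Equivalence.to (h x) hx)
            Wy , vy = connected⇒closed tr (∈⁻ hv) (Equivalence.to (h y) hy)
        in ∈⁺ Wx , ∈⁺ Wy , closed⇒adj (tr x v y Wx (∈⁻ hv) Wy (E-sym⁻ vx) vy) x≢y) ,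
      (λ C D (u , hu , h) (v , hv , h′) → trans
        (trans (component-size tr (∈⁻ hu) C h) (reg u (∈⁻ hu)))
        (sym (trans (component-size tr (∈⁻ hv) D h′) (reg v (∈⁻ hv)))))

  common-size : ∀ {W} → (∀ {u v} → W u ≡ true → W v ≡ true → deg W u ≡ deg W v) →
                ∃[ s ] ∀ v → W v ≡ true → deg W v ≡ s
  common-size {W} h with bool-cases (some W)
  ... | inj₁ e = let u , Wu = some⁻ W e in deg W u , λ v Wv → h Wv Wu
  -- No vertex is kept, so any size will do.
  ... | inj₂ e = 0 , λ v Wv → ⊥-elim (true≢false Wv (none⁻ W e v))

  deletable⇔solvable : ∀ {k} → (∃[ S ] ∣ S ∣ ≤ k × IsUniformClusterAfterDeleting G S) ⇔ (∃[ W ] Solves full k W)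
  deletable⇔solvable {k} = mk⇔
    (λ (S , small , unif) →
      let W = λ v → not (lookup S v)
          s , reg = common-size {W} (uniform⇒regular (∁ S) W (λ v → lookup-map v not S) unif)
      in W , record
        { inside = λ _ _ → refl
        ; cost = ≤-trans (≤-reflexive (trans (cnt-cong λ v → not-involutive (lookup S v)) (sym (∣∣≡cnt S)))) small
        ; transitive = uniform⇒transitive (∁ S) W (λ v → lookup-map v not S) unif
        ; cliqueSize = s ; regular = reg })
    (λ (W , sol) →
      let S = tabulate (λ v → not (W v))
          S≡ = λ v → lookup∘tabulate (λ v → not (W v)) v
      in S , ≤-trans (≤-reflexive (trans (∣∣≡cnt S) (cnt-cong S≡))) (Solves.cost sol) ,
         solution⇒uniform (∁ S) W (λ v → trans (lookup-map v not S) (trans (cong not (S≡ v)) (not-involutive (W v))))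
           (Solves.transitive sol) (Solves.regular sol))

module Selection {n : ℕ} (K : Pred n) where

  index : Fin n → ℕ
  index u = cnt λ w → K w ∧ (toℕ w <ᵇ toℕ u)

  index-mono : ∀ {u v} → K u ≡ true → toℕ u < toℕ v → index u < index v
  index-mono {u} {v} Ku u<v = ≰⇒> λ h → <-irrefl refl (<ᵇ⁻ {toℕ u} (∧⁻ʳ {K u}
    (⊆-cnt-≥ (λ w → K w ∧ (toℕ w <ᵇ toℕ u)) (λ w → K w ∧ (toℕ w <ᵇ toℕ v))
      (λ w e → ∧⁻ˡ e ∧⁺ <ᵇ⁺ (<-trans (<ᵇ⁻ {toℕ w} (∧⁻ʳ {K w} e)) u<v)) h u (Ku ∧⁺ <ᵇ⁺ u<v))))

  index-injective : ∀ {u v} → K u ≡ true → K v ≡ true → index u ≡ index v → u ≡ v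
  index-injective Ku Kv h = toℕ-injective (≤-antisym
    (≮⇒≥ λ lt → <⇒≢ (index-mono Kv lt) (sym h)) (≮⇒≥ λ lt → <⇒≢ (index-mono Ku lt) h))

  index< : ∀ {u} → K u ≡ true → index u < cnt K
  index< {u} Ku = ≰⇒> λ h → <-irrefl refl (<ᵇ⁻ {toℕ u} (∧⁻ʳ {K u}
    (⊆-cnt-≥ (λ w → K w ∧ (toℕ w <ᵇ toℕ u)) K (λ w e → ∧⁻ˡ e) h u Ku)))

  private
    before : ℕ → Pred n
    before a v = K v ∧ (index v <ᵇ a)

    -- By `cnt-rank<` the two sets have at most p and exactly p + 1 elements, so a vertex of index
    -- exactly p lies between them.
    selected : ∀ (p : Fin (cnt K)) → ∃[ u ] before (suc (toℕ p)) u ≡ true × before (toℕ p) u ≡ false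
    selected p = cnt-< _ _ (begin-strict
      cnt (before (toℕ p))        ≡⟨ cnt-rank< K 0 (toℕ p) ⟩
      cnt K ⊓ toℕ p               ≤⟨ m⊓n≤n (cnt K) _ ⟩
      toℕ p                       <⟨ ≤-refl ⟩
      suc (toℕ p)                 ≡⟨ m≥n⇒m⊓n≡n (toℕ<n p) ⟨
      cnt K ⊓ suc (toℕ p)         ≡⟨ cnt-rank< K 0 (suc (toℕ p)) ⟨
      cnt (before (suc (toℕ p)))  ∎)
      where open ≤-Reasoning

  select : Fin (cnt K) → Fin n
  select p = proj₁ (selected p)

  select-∈ : ∀ p → K (select p) ≡ true
  select-∈ p = ∧⁻ˡ (proj₁ (proj₂ (selected p)))

  index-select : ∀ p → index (select p) ≡ toℕ p
  index-select p = ≤-antisym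
    (s≤s⁻¹ (<ᵇ⁻ {index (select p)} (∧⁻ʳ {K (select p)} (proj₁ (proj₂ (selected p))))))
    (≮⇒≥ λ lt → true≢false (select-∈ p ∧⁺ <ᵇ⁺ lt) (proj₂ (proj₂ (selected p))))

  select-unique : ∀ {u} p → K u ≡ true → index u ≡ toℕ p → u ≡ select p
  select-unique p Ku h = index-injective Ku (select-∈ p) (trans h (sym (index-select p)))

  select-injective : ∀ {p q} → select p ≡ select q → p ≡ q
  select-injective {p} {q} h = toℕ-injective (trans (sym (index-select p)) (trans (cong index h) (index-select q)))

  select-surjective : ∀ {u} → K u ≡ true → ∃[ p ] u ≡ select p
  select-surjective Ku = fromℕ< (index< Ku) , select-unique _ Ku (sym (toℕ-fromℕ< (index< Ku)))

  -- `select` is a bijection onto `K`; each inequality is a union bound over singletons.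
  cnt-select : ∀ (q : Pred n) → cnt (q ∘ select) ≡ cnt (K ∩ q)
  cnt-select q = ≤-antisym
    (≤-trans (cnt-⋃ (K ∩ q) (λ u p → toℕ (select p) ≡ᵇ toℕ u)
      (λ p h → select p , (select-∈ p ∧⁺ h) , ≡ᵇ⁺ {toℕ (select p)} refl)
      (λ u _ → cnt≤1 _ λ p p′ h h′ → select-injective
        (toℕ-injective (trans (≡ᵇ⁻ {toℕ (select p)} h) (sym (≡ᵇ⁻ {toℕ (select p′)} h′))))))
      (≤-reflexive (*-identityʳ _)))
    (≤-trans (cnt-⋃ (q ∘ select) (λ p u → toℕ (select p) ≡ᵇ toℕ u)
      (λ u h → let p , eq = select-surjective (∧⁻ˡ h) in
        p , trans (cong q (sym eq)) (∧⁻ʳ {K u} h) , ≡ᵇ⁺ {toℕ (select p)} (cong toℕ (sym eq)))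
      (λ p _ → cnt≤1 _ λ u u′ h h′ →
        toℕ-injective (trans (sym (≡ᵇ⁻ {toℕ (select p)} h)) (≡ᵇ⁻ {toℕ (select p)} h′))))
      (≤-reflexive (*-identityʳ _)))

module InducedSubgraph {n : ℕ} (G : Graph n) (K : Pred n) where

  open Selection K public

  induced : Graph (cnt K)
  induced = record
    { adj        = λ p q → closed G (select p) (select q) ∧ not (toℕ p ≡ᵇ toℕ q)
    ; adj-sym    = λ p q → cong₂ (λ a b → a ∧ not b) (closed-sym G (select p) (select q))
                     (≡ᵇ-sym (toℕ p) (toℕ q))
    ; adj-irrefl = λ p → ≢true λ e → true≢false (≡ᵇ⁺ {toℕ p} refl) (not⁻ (∧⁻ʳ {closed G (select p) (select p)} e))
    }

  closed-induced : ∀ p q → closed induced p q ≡ closed G (select p) (select q)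
  closed-induced p q with toℕ p ≡ᵇ toℕ q in e
  ... | false = bits (closed G (select p) (select q))
    where
    bits : ∀ b → b ∧ true ∨ false ≡ b
    bits true  = refl
    bits false = refl
  ... | true with toℕ-injective {i = p} {q} (≡ᵇ⁻ e)
  ...   | refl = trans (∨⁺ʳ {closed G (select p) (select p) ∧ false} refl) (sym (closed-refl G (select p)))

  private
    module G  = UniformCluster G
    module G′ = UniformCluster induced

  deg-induced : ∀ {W} → W ⊆ K → ∀ p → G′.deg (W ∘ select) p ≡ G.deg W (select p)
  deg-induced {W} W⊆K p = trans
    (trans (cnt-cong λ q → cong (W (select q) ∧_) (closed-induced p q)) (cnt-select (G.N W (select p))))
    (cnt-cong λ u → iff⇒≡ (∧⁻ʳ {K u}) (λ e → W⊆K u (∧⁻ˡ e) ∧⁺ e))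

  restrict : ∀ {b W} → G.Solves K b W → G′.Solves G′.full b (W ∘ select)
  restrict {b} {W} sol = record
    { inside     = λ _ _ → refl
    ; cost       = ≤-trans (≤-reflexive (cnt-select (not ∘ W))) cost
    ; transitive = λ p q r hp hq hr pq qr → trans (closed-induced p r)
        (transitive _ _ _ hp hq hr (trans (sym (closed-induced p q)) pq) (trans (sym (closed-induced q r)) qr))
    ; cliqueSize = cliqueSize
    ; regular    = λ p h → trans (deg-induced inside p) (regular _ h)
    }
    where open G.Solves sol

  extend : ∀ {b W′} → G′.Solves G′.full b W′ → ∃[ W ] G.Solves K b W
  extend {b} {W′} sol = W , record
    { inside     = W⊆K
    ; cost       = ≤-trans (≤-reflexive (trans (sym (cnt-select (not ∘ W))) (cnt-cong λ p → cong not (W-select p)))) cost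
    ; transitive = tr
    ; cliqueSize = cliqueSize
    ; regular    = reg
    }
    where
    open G′.Solves sol
    W : Pred n
    W u = some λ p → W′ p ∧ (toℕ (select p) ≡ᵇ toℕ u)
    origin : ∀ {u} → W u ≡ true → ∃[ p ] u ≡ select p × W′ p ≡ true
    origin {u} h = let p , e = some⁻ _ h in
      p , toℕ-injective (sym (≡ᵇ⁻ {toℕ (select p)} (∧⁻ʳ {W′ p} e))) , ∧⁻ˡ e
    W⊆K : W ⊆ K
    W⊆K u h with origin {u} h
    ... | p , refl , _ = select-∈ p
    W-select : ∀ p → W (select p) ≡ W′ p
    W-select p = iff⇒≡
      (λ h → let q , eq , hq = origin h in trans (cong W′ (select-injective eq)) hq)
      (λ h → some⁺ (λ q → W′ q ∧ (toℕ (select q) ≡ᵇ toℕ (select p))) p (h ∧⁺ ≡ᵇ⁺ {toℕ (select p)} refl))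
    tr : G.Transitive W
    tr u v w hu hv hw uv vw with origin {u} hu | origin {v} hv | origin {w} hw
    ... | p , refl , hp | q , refl , hq | r , refl , hr = trans (sym (closed-induced p r))
      (transitive p q r hp hq hr (trans (closed-induced p q) uv) (trans (closed-induced q r) vw))
    reg : ∀ v → W v ≡ true → G.deg W v ≡ cliqueSize
    reg v hv with origin {v} hv
    ... | p , refl , hp = trans (sym (deg-induced W⊆K p))
      (trans (cnt-cong λ q → cong (_∧ closed induced p q) (W-select q)) (regular p hp))

-- The kernel

module Correctness {n : ℕ} (G : Graph n) (k : ℕ) (k≤n : k ≤ n) (k>0 : 0 < k) where

  open Tables G k k≤n

  budget : ℕ
  budget = k ∸ deletions

  budget≤k : budget ≤ k
  budget≤k = m∸n≤m k deletions

  to-K : ∃[ W ] Solves full k W → ∃[ W ] Solves K budget W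
  to-K (_ , sol) = shrink A₀-lopsided k>0 budget≤k (thin (solves-rest sol))
    where
    A₀-lopsided : ∀ {x} → B x ≡ true → hardDeg x ≤ k
    A₀-lopsided {x} Bx = A₀-hardDeg (B⊆A₀ x Bx)

  from-K : deletions ≤ k → ∃[ W ] Solves K budget W → ∃[ W ] Solves full k W
  from-K h (_ , sol) with unshrink (λ {x} Bx → A₀-hardDeg (B⊆A₀ x Bx)) k>0 budget≤k sol
  ... | _ , sol′ = _ , solves-all h (unthin budget≤k sol′)

  defect⇒unsolvable : ∀ {W} → Solves A 0 W → defect ≡ true → ⊥
  defect⇒unsolvable {W} sol h = step (some⁻ defective h)
    where
    open Solves sol
    A⊆W : A ⊆ W
    A⊆W v Av = ≢false λ ¬Wv → <⇒≱ (cnt-∋ {p = A ∖ W} v (Av ∧⁺ not⁺ ¬Wv)) cost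
    deg≡ : ∀ v → A v ≡ true → deg A v ≡ cliqueSize
    deg≡ v Av = trans (cnt-cong λ l → iff⇒≡
      (λ e → A⊆W l (∧⁻ˡ e) ∧⁺ ∧⁻ʳ {A l} e) (λ e → inside l (∧⁻ˡ e) ∧⁺ ∧⁻ʳ {W l} e)) (regular v (A⊆W v Av))
    clash : ∀ {u v} → A u ≡ true → A v ≡ true → conflict u v ∨ not (deg A u ≡ᵇ deg A v) ≡ true → ⊥
    clash {u} {v} Au Av e = [
      (λ c → let w , f = some⁻ (λ w → A u ∧ A v ∧ A w ∧ P u v w) c
                 g = ∧⁻ʳ {A v} (∧⁻ʳ {A u} f)
             in transitive⇒¬P transitive (A⊆W u Au) (A⊆W v Av) (A⊆W w (∧⁻ˡ g)) (∧⁻ʳ {A w} g)) ,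
      (λ d → true≢false (≡ᵇ⁺ (trans (deg≡ u Au) (sym (deg≡ v Av)))) (not⁻ d)) ]′ (∨⁻ {conflict u v} e)
    step : ∃[ u ] defective u ≡ true → ⊥
    step (u , h) = let v , e = some⁻ (λ v → A u ∧ A v ∧ (conflict u v ∨ not (deg A u ≡ᵇ deg A v))) h in
      clash {u} {v} (∧⁻ˡ e) (∧⁻ˡ (∧⁻ʳ {A u} e)) (∧⁻ʳ {A v} (∧⁻ʳ {A u} e))

  ¬defect⇒solvable : defect ≡ false → ∃[ s ] Transitive A × (∀ v → A v ≡ true → deg A v ≡ s)
  ¬defect⇒solvable h =
    let s , reg = UniformCluster.common-size G {A} λ {u} {v} Au Av → ≡ᵇ⁻ (≢false λ e →
          fine Au Av (∨⁺ʳ {conflict u v} (not⁺ e)))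
    in s , ¬P⇒transitive (λ {u} {v} {w} Au Av Aw p →
         fine Au Av (∨⁺ˡ (some⁺ (λ w → A u ∧ A v ∧ A w ∧ P u v w) w (Au ∧⁺ Av ∧⁺ Aw ∧⁺ p)))) , reg
    where
    fine : ∀ {u v} → A u ≡ true → A v ≡ true → conflict u v ∨ not (deg A u ≡ᵇ deg A v) ≡ true → ⊥
    fine {u} {v} Au Av e = true≢false
      (some⁺ (λ v → A u ∧ A v ∧ (conflict u v ∨ not (deg A u ≡ᵇ deg A v))) v (Au ∧⁺ Av ∧⁺ e))
      (none⁻ defective h u)

  rejects⇒unsolvable : rejects ≡ true → ∃[ W ] Solves full k W → ⊥
  rejects⇒unsolvable h (W , sol) = [
    (λ e → <⇒≱ (<ᵇ⁻ e) (deleted≤k sol)) ,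
    (λ e → [
      (λ f → <⇒≱ (<ᵇ⁻ f) (≤-trans (K-few sol k>0) (≤-reflexive (cong (30 *_) (sym (cube-value k≤n)))))) ,
      (λ f → defect⇒unsolvable
        (subst (λ b → Solves A b W) (m≤n⇒m∸n≡0 (≤-reflexive (sym (≡ᵇ⁻ {deletions} {k} (∧⁻ˡ f))))) (solves-rest sol))
        (∧⁻ʳ {deletions ≡ᵇ k} f)) ]′ (∨⁻ {30 * cube n k <ᵇ cnt K} e)) ]′
    (∨⁻ {k <ᵇ deletions} h)

  accepts⇒solvable : accepts ≡ true → ∃[ W ] Solves full k W
  accepts⇒solvable h =
    let s , tr , reg = ¬defect⇒solvable (not⁻ (∧⁻ʳ {deletions ≡ᵇ k} h)) in
    A , solves-all (≤-reflexive (≡ᵇ⁻ (∧⁻ˡ h))) (record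
      { inside = λ _ e → e
      ; cost = ≤-trans (≤-reflexive (cnt-none λ v → ≢true λ e → true≢false (∧⁻ˡ e) (not⁻ (∧⁻ʳ {A v} e)))) z≤n
      ; transitive = tr ; cliqueSize = s ; regular = reg })

  module _ (¬r : rejects ≡ false) where

    K-bound : cnt K ≤ 30 * (k * (k * k))
    K-bound = ≤-trans (≮ᵇ⁻ (≢true λ e → true≢false (∨⁺ʳ {k <ᵇ deletions} (∨⁺ˡ e)) ¬r))
                      (≤-reflexive (cong (30 *_) (cube-value k≤n)))

    deletions≤k : deletions ≤ k
    deletions≤k = ≮ᵇ⁻ (≢true λ e → true≢false (∨⁺ˡ e) ¬r)

    deletions<k : accepts ≡ false → deletions < k
    deletions<k ¬a = ≤∧≢⇒< deletions≤k λ eq → true≢false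
      (≡ᵇ⁺ eq ∧⁺ not⁺ (≢true λ d → true≢false
        (∨⁺ʳ {k <ᵇ deletions} (∨⁺ʳ {30 * cube n k <ᵇ cnt K} (≡ᵇ⁺ eq ∧⁺ d))) ¬r)) ¬a

path : Graph 4
path = record
  { adj        = λ p q → (toℕ p ≡ᵇ toℕ q + 1) ∨ (toℕ q ≡ᵇ toℕ p + 1)
  ; adj-sym    = λ p q → ∨-comm (toℕ p ≡ᵇ toℕ q + 1) _
  ; adj-irrefl = λ where
      zero                   → refl
      (suc zero)             → refl
      (suc (suc zero))       → refl
      (suc (suc (suc zero))) → refl
  }

noInstance yesInstance : Instance
noInstance  = record { order = 4 ; graph = path ; param = 1 ; param-pos = z<s }
yesInstance = record
  { order = 0 ; param = 1 ; param-pos = z<s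
  ; graph = record { adj = λ () ; adj-sym = λ () ; adj-irrefl = λ () } }

-- Without an end the path is a P₃; without an inner vertex it is an edge plus a single vertex, of
-- unequal sizes.
path-unsolvable : ∀ {W} → UniformCluster.Solves path (UniformCluster.full path) 1 W → ⊥
path-unsolvable {W} sol = go (W v₀) (W v₁) (W v₂) (W v₃) refl refl refl refl
  where
  open UniformCluster path using (deg; module Solves)
  open Solves sol
  v₀ v₁ v₂ v₃ : Fin 4
  v₀ = zero
  v₁ = suc zero
  v₂ = suc (suc zero)
  v₃ = suc (suc (suc zero))
  opaque
    unfolding cnt
    cost′ : bit (not (W v₀)) + (bit (not (W v₁)) + (bit (not (W v₂)) + (bit (not (W v₃)) + 0))) ≤ 1
    cost′ = cost
    deg₀ : deg W v₀ ≡ bit (W v₀ ∧ true) + (bit (W v₁ ∧ true) + (bit (W v₂ ∧ false) + (bit (W v₃ ∧ false) + 0)))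
    deg₀ = refl
    deg₁ : deg W v₁ ≡ bit (W v₀ ∧ true) + (bit (W v₁ ∧ true) + (bit (W v₂ ∧ true) + (bit (W v₃ ∧ false) + 0)))
    deg₁ = refl
    deg₂ : deg W v₂ ≡ bit (W v₀ ∧ false) + (bit (W v₁ ∧ true) + (bit (W v₂ ∧ true) + (bit (W v₃ ∧ true) + 0)))
    deg₂ = refl
    deg₃ : deg W v₃ ≡ bit (W v₀ ∧ false) + (bit (W v₁ ∧ false) + (bit (W v₂ ∧ true) + (bit (W v₃ ∧ true) + 0)))
    deg₃ = refl
  go : ∀ a b c d → W v₀ ≡ a → W v₁ ≡ b → W v₂ ≡ c → W v₃ ≡ d → ⊥
  go true  true  true  d     e₀ e₁ e₂ e₃ = true≢false (transitive v₀ v₁ v₂ e₀ e₁ e₂ refl refl) refl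
  go a     true  true  true  e₀ e₁ e₂ e₃ = true≢false (transitive v₁ v₂ v₃ e₁ e₂ e₃ refl refl) refl
  go true  false true  true  e₀ e₁ e₂ e₃ with trans (regular v₀ e₀) (sym (regular v₂ e₂))
  ... | eq rewrite deg₀ | deg₂ | e₀ | e₁ | e₂ | e₃ with eq
  ...   | ()
  go true  true  false true  e₀ e₁ e₂ e₃ with trans (regular v₁ e₁) (sym (regular v₃ e₃))
  ... | eq rewrite deg₁ | deg₃ | e₀ | e₁ | e₂ | e₃ with eq
  ...   | ()
  go a     b     false false e₀ e₁ e₂ e₃ with a | b | cost′
  ... | true  | true  | h rewrite e₀ | e₁ | e₂ | e₃ = <⇒≱ ≤-refl h
  ... | true  | false | h rewrite e₀ | e₁ | e₂ | e₃ = <⇒≱ (s≤s (s≤s z≤n)) h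
  ... | false | true  | h rewrite e₀ | e₁ | e₂ | e₃ = <⇒≱ (s≤s (s≤s z≤n)) h
  ... | false | false | h rewrite e₀ | e₁ | e₂ | e₃ = <⇒≱ (s≤s (s≤s z≤n)) h
  go a     false c     false e₀ e₁ e₂ e₃ with a | c | cost′
  ... | true  | true  | h rewrite e₀ | e₁ | e₂ | e₃ = <⇒≱ ≤-refl h
  ... | true  | false | h rewrite e₀ | e₁ | e₂ | e₃ = <⇒≱ (s≤s (s≤s z≤n)) h
  ... | false | true  | h rewrite e₀ | e₁ | e₂ | e₃ = <⇒≱ (s≤s (s≤s z≤n)) h
  ... | false | false | h rewrite e₀ | e₁ | e₂ | e₃ = <⇒≱ (s≤s (s≤s z≤n)) h
  go false b     c     false e₀ e₁ e₂ e₃ with b | c | cost′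
  ... | true  | true  | h rewrite e₀ | e₁ | e₂ | e₃ = <⇒≱ ≤-refl h
  ... | true  | false | h rewrite e₀ | e₁ | e₂ | e₃ = <⇒≱ (s≤s (s≤s z≤n)) h
  ... | false | true  | h rewrite e₀ | e₁ | e₂ | e₃ = <⇒≱ (s≤s (s≤s z≤n)) h
  ... | false | false | h rewrite e₀ | e₁ | e₂ | e₃ = <⇒≱ (s≤s (s≤s z≤n)) h
  go true  false false true e₀ e₁ e₂ e₃ with cost′
  ... | h rewrite e₀ | e₁ | e₂ | e₃ = <⇒≱ ≤-refl h
  go false true  false true e₀ e₁ e₂ e₃ with cost′
  ... | h rewrite e₀ | e₁ | e₂ | e₃ = <⇒≱ ≤-refl h
  go false false c     true e₀ e₁ e₂ e₃ with c | cost′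
  ... | true  | h rewrite e₀ | e₁ | e₂ | e₃ = <⇒≱ ≤-refl h
  ... | false | h rewrite e₀ | e₁ | e₂ | e₃ = <⇒≱ (s≤s (s≤s z≤n)) h

cnt-first : ∀ {n} {p : Pred n} a → a ≤ n → (∀ w → p w ≡ (toℕ w <ᵇ a)) → cnt p ≡ a
cnt-first {n} a a≤n h = trans (cnt-cong h) (trans (cnt-below n a) (m≥n⇒m⊓n≡n a≤n))

module Output {n : ℕ} (G : Graph n) (k : ℕ) (k+3<n : k + 3 < n) (k>0 : 0 < k) where

  4≤n : 4 ≤ n
  4≤n = ≤-trans (≤-trans (+-monoˡ-≤ 3 k>0) (n≤1+n _)) k+3<n

  k≤n : k ≤ n
  k≤n = ≤-trans (m≤m+n k 3) (<⇒≤ k+3<n)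

  open Correctness G k k≤n k>0
  open Tables G k k≤n
  open InducedSubgraph G K

  outputBy : Bool → Bool → Instance
  outputBy true  _     = noInstance
  outputBy false true  = yesInstance
  -- Here deletions < k, so the parameter is k ∸ deletions.
  outputBy false false = record
    { order = cnt K ; graph = induced ; param = suc (k ∸ suc deletions) ; param-pos = z<s }

  output : Instance
  output = outputBy rejects accepts

  suc-budget : rejects ≡ false → accepts ≡ false → suc (k ∸ suc deletions) ≡ budget
  suc-budget ¬r ¬a = sym (+-∸-assoc 1 (deletions<k ¬r ¬a))

  renamed≡ : ∀ {u v : Fin n} {p q : Fin (cnt K)} → toℕ u ≡ toℕ p → toℕ v ≡ toℕ q →
             renamed u v ≡ closed G (select p) (select q)
  renamed≡ {u} {v} {p} {q} up vq = iff⇒≡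
    (λ h → let w , e = some⁻ (λ w → K w ∧ (newName w ≡ᵇ toℕ v) ∧ named u w) h
               x , f = some⁻ (λ x → K x ∧ (newName x ≡ᵇ toℕ u) ∧ closed G x w)
                         (∧⁻ʳ {newName w ≡ᵇ toℕ v} (∧⁻ʳ {K w} e))
               w≡ = select-unique q (∧⁻ˡ e) (trans (≡ᵇ⁻ {newName w} (∧⁻ˡ (∧⁻ʳ {K w} e))) vq)
               x≡ = select-unique p (∧⁻ˡ f) (trans (≡ᵇ⁻ {newName x} (∧⁻ˡ (∧⁻ʳ {K x} f))) up)
           in subst₂ (λ a b → closed G a b ≡ true) x≡ w≡ (∧⁻ʳ {newName x ≡ᵇ toℕ u} (∧⁻ʳ {K x} f)))
    (λ h → some⁺ (λ w → K w ∧ (newName w ≡ᵇ toℕ v) ∧ named u w) (select q)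
      (select-∈ q ∧⁺ ≡ᵇ⁺ (trans (index-select q) (sym vq)) ∧⁺
       some⁺ (λ x → K x ∧ (newName x ≡ᵇ toℕ u) ∧ closed G x (select q)) (select p)
         (select-∈ p ∧⁺ ≡ᵇ⁺ (trans (index-select p) (sym up)) ∧⁺ h)))

  -- The output matrix is the upper left corner of `newAdj`; `u` and `p` are the same number in
  -- different `Fin` types.
  record Described (O : Instance) : Set where
    field
      order≡     : newOrder ≡ order O
      param≡     : newParam ≡ param O
      order≤     : order O ≤ n
      param≤     : param O ≤ k
      adj≡       : ∀ {u v : Fin n} {p q} → toℕ u ≡ toℕ p → toℕ v ≡ toℕ q → newAdj u v ≡ adj (graph O) p q
      kernelised : order O ≤ 30 * (k * (k * k)) + (k + 4)
      same       : (∃[ W ] Solves full k W) ⇔ UCVD O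

  -- The verdicts are variables tied by equations, so the case split affects `outputBy` but not the
  -- tables mentioning `rejects` and `accepts`.
  described : ∀ r a → rejects ≡ r → accepts ≡ a → Described (outputBy r a)
  described true a r≡ a≡ = record
    { order≡ = cnt-first 4 4≤n λ w → on-r (toℕ w <ᵇ 4) _
    ; param≡ = cnt-first 1 (≤-trans (s≤s z≤n) 4≤n) λ w →
        trans (cong (λ r → (r ∨ accepts) ∧ (toℕ w <ᵇ 1) ∨ not r ∧ not accepts ∧ (toℕ w <ᵇ k ∸ deletions)) r≡) (∨-identityʳ _)
    ; order≤ = 4≤n
    ; param≤ = k>0
    ; adj≡ = λ {u} {v} up vq → trans (on-r _ _)
        (cong₂ _∨_ (cong₂ (λ a b → a ≡ᵇ b + 1) up vq) (cong₂ (λ a b → a ≡ᵇ b + 1) vq up))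
    ; kernelised = ≤-trans (m≤n+m 4 k) (m≤n+m (k + 4) (30 * (k * (k * k))))
    ; same = mk⇔ (λ h → ⊥-elim (rejects⇒unsolvable r≡ h))
        (λ h → ⊥-elim (path-unsolvable (proj₂ (Equivalence.to (UniformCluster.deletable⇔solvable path) h))))
    }
    where
    on-r : ∀ x y → rejects ∧ x ∨ not rejects ∧ y ≡ x
    on-r x y = trans (cong (λ r → r ∧ x ∨ not r ∧ y) r≡) (∨-identityʳ x)
  described false true r≡ a≡ = record
    { order≡ = cnt-none λ w → cong₂ (λ r a → r ∧ (toℕ w <ᵇ 4) ∨ not r ∧ not a ∧ K w) r≡ a≡
    ; param≡ = cnt-first 1 (≤-trans (s≤s z≤n) 4≤n) λ w → trans
        (cong₂ (λ r a → (r ∨ a) ∧ (toℕ w <ᵇ 1) ∨ not r ∧ not a ∧ (toℕ w <ᵇ k ∸ deletions)) r≡ a≡) (∨-identityʳ _)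
    ; order≤ = z≤n
    ; param≤ = k>0
    ; adj≡ = λ { {p = ()} }
    ; kernelised = z≤n
    ; same = mk⇔ (λ _ → Equivalence.from (UniformCluster.deletable⇔solvable (graph yesInstance))
                          ((λ ()) , record { inside = λ () ; cost = ≤-trans (cnt≤n {0} _) z≤n ; transitive = λ () ; cliqueSize = 0 ; regular = λ () }))
                 (λ _ → accepts⇒solvable a≡)
    }
  described false false r≡ a≡ = record
    { order≡ = cnt-cong λ w → cong₂ (λ r a → r ∧ (toℕ w <ᵇ 4) ∨ not r ∧ not a ∧ K w) r≡ a≡
    ; param≡ = trans (cnt-first budget (≤-trans budget≤k k≤n) λ w →
        cong₂ (λ r a → (r ∨ a) ∧ (toℕ w <ᵇ 1) ∨ not r ∧ not a ∧ (toℕ w <ᵇ k ∸ deletions)) r≡ a≡) (sym budget≡)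
    ; order≤ = cnt≤n K
    ; param≤ = ≤-trans (≤-reflexive budget≡) budget≤k
    ; adj≡ = λ {u} {v} up vq → trans
        (cong (λ r → r ∧ ((toℕ u ≡ᵇ toℕ v + 1) ∨ (toℕ v ≡ᵇ toℕ u + 1)) ∨ not r ∧ renamed u v ∧ not (toℕ u ≡ᵇ toℕ v)) r≡)
        (cong₂ (λ x y → x ∧ not y) (renamed≡ up vq) (cong₂ _≡ᵇ_ up vq))
    ; kernelised = ≤-trans (K-bound r≡) (m≤m+n _ (k + 4))
    ; same = mk⇔
        (λ h → Equivalence.from (UniformCluster.deletable⇔solvable induced)
          (let W , sol = to-K h in W ∘ select ,
             restrict (subst (λ b → Solves K b W) (sym budget≡) sol)))
        (λ h → from-K (deletions≤k r≡)
          (let W , sol = extend (proj₂ (Equivalence.to (UniformCluster.deletable⇔solvable induced) h)) in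
           W , subst (λ b → Solves K b W) budget≡ sol))
    }
    where
    budget≡ : suc (k ∸ suc deletions) ≡ budget
    budget≡ = suc-budget r≡ a≡

  output-described : Described output
  output-described = described rejects accepts refl refl

-- The program and its running time

main : Program
-- The test is n > k + 3. Arrays 51, 52 and 53 hold the tables 49, 50 and 51: `newAdj`, `newOrder`
-- and `newParam`.
main = ifnz (0 [ lit 0 ] ⊖ (1 [ lit 0 ] ⊕ lit 3)) (rulesProgram rules ⨾ copyProgram 51 52 53) skip

module Run (I : Instance) (large : param I + 3 < order I) where

  private
    n = order I
    k = param I
    G = graph I

  open Output G k large (param-pos I)
  open Tables G k k≤n using (tables; newAdj; newOrder; newParam)
  open Described output-described
  open Execution k tables

  zeroᶠ : Fin n
  zeroᶠ = fromℕ< (≤-trans (s≤s z≤n) 4≤n)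

  start : Stored 1 0 (input I)
  start = record
    { n-cell = refl ; k-cell = refl ; current = λ _ _ ()
    ; earlier = λ { (s≤s z≤n) u v → matrix-entry G u v } }

  -- Tables of a single number are constant, so their first cell can be read without computing a
  -- position.
  corner : ∀ {s} a → a < 52 → Stored 52 0 s → s (2 + a) 0 ≡ entry (tables a) zeroᶠ zeroᶠ
  corner {s} a a< st = trans
    (cong (s (2 + a)) (sym (trans (cong (λ z → z * n + z) (toℕ-fromℕ< (≤-trans (s≤s z≤n) 4≤n))) refl)))
    (Stored.earlier st a< zeroᶠ zeroᶠ)

  open Copy n (order output) (param output) (λ u v → bit (adj (graph output) u v)) 48 49 50

  embed : Fin (order output) → Fin n
  embed p = fromℕ< (<-≤-trans (toℕ<n p) order≤)

  toℕ-embed : ∀ p → toℕ (embed p) ≡ toℕ p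
  toℕ-embed p = toℕ-fromℕ< (<-≤-trans (toℕ<n p) order≤)

  copied-start : ∀ {s} → Stored 52 0 s → Copied 0 s
  copied-start {s} st = record
    { n-cell   = Stored.n-cell st
    ; ord-cell = trans (corner 50 (m<m+n 50 z<s) st) order≡
    ; par-cell = trans (corner 51 (m<m+n 51 z<s) st) param≡
    ; source   = λ p q → trans
        (cong₂ (λ x y → s 51 (x * n + y)) (sym (toℕ-embed p)) (sym (toℕ-embed q)))
        (trans (Stored.earlier st (m<m+n 49 z<s) (embed p) (embed q))
               (cong bit (adj≡ (toℕ-embed p) (toℕ-embed q))))
    ; target   = λ _ _ () }

  mainCost : ℕ
  mainCost = 51 * ruleCost + 1 + copyCost

  runs-main : Runs main (input I) (suc mainCost) (λ s → Holds s output)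
  runs-main = finish (runs-seq (runs-rules rules (obeys G k k≤n) start) (λ st → runs-copy (copied-start st)))
    where
    finish : Runs (rulesProgram rules ⨾ copyProgram 51 52 53) (input I) mainCost (λ s →
               s 0 0 ≡ order output × s 1 0 ≡ param output ×
               (∀ u v → s 2 (position u v) ≡ bit (adj (graph output) u v))) →
             Runs main (input I) (suc mainCost) (λ s → Holds s output)
    finish (c , s , run , c≤ , (e₀ , e₁ , e₂)) = suc c , s , ⇓then (m>n⇒m∸n≢0 large) run , s≤s c≤ ,
      record { order-cell = e₀ ; param-cell = e₁ ; adj-cell = e₂ }

  size-output : size output ≤ size I
  size-output = +-mono-≤ (*-mono-≤ order≤ order≤) (s≤s (⌊log₂⌋-mono-≤ param≤))

reduceBy : ∀ I → Dec (order I ≤ param I + 3) → Instance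
reduceBy I (yes _) = I
reduceBy I (no ¬h) = Output.output (graph I) (param I) (≰⇒> ¬h) (param-pos I)

small? : ∀ I → Dec (order I ≤ param I + 3)
small? I = order I ≤? param I + 3

loopCost≤ : ∀ {N s} c → 1 ≤ s → N ≤ s → loopCost N c ≤ s * (6 + c)
loopCost≤ {N} {s} c 1≤s N≤s = begin
  2 + (N * suc (c + 2) + 1)        ≤⟨ +-monoʳ-≤ 2 (+-monoˡ-≤ 1 (*-monoˡ-≤ (suc (c + 2)) N≤s)) ⟩
  2 + (s * suc (c + 2) + 1)        ≡⟨ solve 2 (λ s c → con 2 :+ (s :* (con 1 :+ (c :+ con 2)) :+ con 1)
                                        := s :* (con 3 :+ c) :+ con 3) refl s c ⟩
  s * (3 + c) + 3                  ≤⟨ +-monoʳ-≤ (s * (3 + c)) (*-monoˡ-≤ 3 1≤s) ⟩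
  s * (3 + c) + s * 3              ≡⟨ solve 2 (λ s c → s :* (con 3 :+ c) :+ s :* con 3 := s :* (con 6 :+ c)) refl s c ⟩
  s * (6 + c)                      ∎
  where
  open ≤-Reasoning
  open +-*-Solver

1≤size : ∀ I → 1 ≤ size I
1≤size I = ≤-trans (s≤s z≤n) (m≤n+m _ (order I * order I))

order≤size : ∀ I → order I ≤ size I
order≤size I = ≤-trans (n≤n*n (order I)) (m≤m+n _ _)
  where
  n≤n*n : ∀ n → n ≤ n * n
  n≤n*n zero    = z≤n
  n≤n*n (suc n) = m≤m+n (suc n) _

1≤s^ : ∀ {s} → 1 ≤ s → s ≤ s ^ 3
1≤s^ {suc s} _ = ≤-trans (≤-reflexive (sym (*-identityʳ (suc s)))) (*-monoʳ-≤ (suc s) (m^n>0 (suc s) 2))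

-- The left side is 357 s³ + 415 s² + 313 s + 5, with coefficient sum 1090; in terms of r = s - 1
-- the difference has only positive coefficients.
cost-polynomial : ∀ s → 1 ≤ s →
  suc (51 * (s * (6 + s * (6 + (1 + (s * 7 + 1))))) + 1 + (1 + (s * (6 + (s * 7 + 1)) + 2))) ≤ 1110 * s ^ 3
cost-polynomial (suc r) _ = ≤-trans
  (m≤m+n (suc (51 * (suc r * (6 + suc r * (6 + (1 + (suc r * 7 + 1))))) + 1 + (1 + (suc r * (6 + (suc r * 7 + 1)) + 2))))
         (20 + 1116 * r + 1844 * (r * r) + 753 * (r * (r * r))))
  (≤-reflexive (solve 1 (λ r → let s = con 1 :+ r in
    con 1 :+ (con 51 :* (s :* (con 6 :+ s :* (con 6 :+ (con 1 :+ (s :* con 7 :+ con 1))))) :+ con 1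
      :+ (con 1 :+ (s :* (con 6 :+ (s :* con 7 :+ con 1)) :+ con 2)))
    :+ (con 20 :+ con 1116 :* r :+ con 1844 :* (r :* r) :+ con 753 :* (r :* (r :* r)))
    := con 1110 :* (s :* (s :* (s :* con 1)))) refl r))
  where open +-*-Solver

cost-bound : ∀ {n n′ s} → 1 ≤ s → n ≤ s → n′ ≤ s →
             suc (51 * loopCost n (loopCost n (1 + (loopCost n 1 + 1))) + 1 + (1 + (loopCost n′ (loopCost n′ 1 + 1) + 2)))
             ≤ 1110 * s ^ 3
cost-bound {n} {n′} {s} 1≤s n≤s n′≤s = ≤-trans
  (s≤s (+-mono-≤ (+-monoˡ-≤ 1 (*-monoʳ-≤ 51 rule≤)) (s≤s (+-monoˡ-≤ 2 copy≤))))
  (cost-polynomial s 1≤s)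
  where
  rule≤ : loopCost n (loopCost n (1 + (loopCost n 1 + 1))) ≤ s * (6 + s * (6 + (1 + (s * 7 + 1))))
  rule≤ = ≤-trans
    (loopCost-mono n (≤-trans (loopCost-mono n (s≤s (+-monoˡ-≤ 1 (loopCost≤ {n} 1 1≤s n≤s))))
                               (loopCost≤ {n} (1 + (s * 7 + 1)) 1≤s n≤s)))
    (loopCost≤ {n} (s * (6 + (1 + (s * 7 + 1)))) 1≤s n≤s)
  copy≤ : loopCost n′ (loopCost n′ 1 + 1) ≤ s * (6 + (s * 7 + 1))
  copy≤ = ≤-trans (loopCost-mono n′ (+-monoˡ-≤ 1 (loopCost≤ {n′} 1 1≤s n′≤s))) (loopCost≤ {n′} (s * 7 + 1) 1≤s n′≤s)

module _ (I : Instance) where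

  runs : ∀ d → Runs main (input I) (1110 * size I ^ 3) (λ s → Holds s (reduceBy I d))
  runs (yes h) = 2 , _ , ⇓else (m≤n⇒m∸n≡0 h) ⇓skip , ≤-trans (s≤s (s≤s z≤n))
    (*-monoʳ-≤ 1110 (≤-trans (1≤size I) (1≤s^ (1≤size I)))) , input-holds I
  runs (no ¬h) = runs-weaken (cost-bound (1≤size I) (order≤size I)
      (≤-trans (Output.Described.order≤ (Output.output-described (graph I) (param I) (≰⇒> ¬h) (param-pos I))) (order≤size I)))
    (λ h → h) (Run.runs-main I (≰⇒> ¬h))

  size-reduce : ∀ d → size (reduceBy I d) ≤ size I
  size-reduce (yes _) = ≤-refl
  size-reduce (no ¬h) = Run.size-output I (≰⇒> ¬h)

  equivalent : ∀ d → UCVD I ⇔ UCVD (reduceBy I d)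
  equivalent (yes _) = mk⇔ (λ h → h) (λ h → h)
  equivalent (no ¬h) = Output.Described.same (Output.output-described (graph I) (param I) (≰⇒> ¬h) (param-pos I))
    ⇔-∘ UniformCluster.deletable⇔solvable (graph I)

  order-bound : ∀ d → order (reduceBy I d) ≤ 30 * (param I * (param I * param I)) + (param I + 4)
  order-bound (yes h) = ≤-trans h (≤-trans (+-monoʳ-≤ (param I) (n≤1+n 3)) (m≤n+m (param I + 4) (30 * (param I * (param I * param I)))))
  order-bound (no ¬h) = Output.Described.kernelised (Output.output-described (graph I) (param I) (≰⇒> ¬h) (param-pos I))

  param-bound : ∀ d → param (reduceBy I d) ≤ param I
  param-bound (yes _) = ≤-refl
  param-bound (no ¬h) = Output.Described.param≤ (Output.output-described (graph I) (param I) (≰⇒> ¬h) (param-pos I))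

theorem1 : ∃[ f ] (f ∈O (λ k → k ^ 3)) × Kernel UCVD f
theorem1 = (λ k → 30 * (k * (k * k)) + (k + 4)) , (35 , 1 , cubic) , record
  { reduce           = λ I → reduceBy I (small? I)
  -- One more than 1110, to pay for the size of the output.
  ; polynomial-time  = main , 1111 , 3 , λ I →
      let t , s , run , t≤ , holds = runs I (small? I) in
      t , s , run , holds , ≤-trans
        (+-mono-≤ t≤ (≤-trans (size-reduce I (small? I)) (1≤s^ (1≤size I))))
        (≤-reflexive (+-comm (1110 * size I ^ 3) _))
  ; equivalent       = λ I → equivalent I (small? I)
  ; order-bound      = λ I → order-bound I (small? I)
  ; bound            = λ k → k
  ; bound-computable = skip , λ x → 1 , numberInput x , ⇓skip , refl
  ; param-bound      = λ I → param-bound I (small? I)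
  }
  where
  -- 35 = 30 + 1 + 4, the coefficient sum, which suffices from k = 1 on.
  cubic : ∀ k → 1 ≤ k → 30 * (k * (k * k)) + (k + 4) ≤ 35 * k ^ 3
  cubic (suc j) _ = ≤-trans (m≤m+n _ (14 * j + 15 * (j * j) + 5 * (j * (j * j)))) (≤-reflexive
    (solve 1 (λ j → let k = con 1 :+ j in
      con 30 :* (k :* (k :* k)) :+ (k :+ con 4) :+ (con 14 :* j :+ con 15 :* (j :* j) :+ con 5 :* (j :* (j :* j)))
      := con 35 :* (k :* (k :* (k :* con 1)))) refl j))
    where open +-*-Solver
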